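{- For every fixed integer $r\ge 2$, \[\mathrm{sat}_\circlearrowright(n,M_1^{(r)})\sim\binom{n}{r-1}\quad (n\to\infty).\] Moreover, for $n\ge 4$ every $M_1^{(2)}$-saturated $2$-cgh on $\Omega_n$ has exactly $n$ edges. Furthermore, for $n\ge 6$, \[\mathrm{sat}_\circlearrowright(n,M_1^{(3)})=\binom{n-1}{2}+3n-11,\] and for $n>6$ the cgh $H_n^{(3)}$ is, up to isomorphism, the unique $M_1^{(3)}$-saturated $3$-cgh on $\Omega_n$ with exactly this number of edges.
   Context: $\Omega_n=\{v_0,\dots,v_{n-1}\}$ carries the cyclic (clockwise) order $v_0<v_1<\dots<v_{n-1}<v_0$; indices of $v$ are taken modulo $n$. For $v_i,v_j\in\Omega_n$, $(v_i,v_j)$ denotes the set of points met strictly between $v_i$ and $v_j$ when travelling clockwise from $v_i$ to $v_j$, and $[v_i,v_j]=(v_i,v_j)\cup\{v_i,v_j\}$. An $r$-uniform convex geometric hypergraph ($r$-cgh) on $\Omega_n$ is a set $H\subseteq\binom{\Omega_n}{r}$. Two cghs are isomorphic if there is a bijection of vertex sets respecting the cyclic orders and inducing a bijection of edges. For a cgh $F$ on a cyclically ordered set $U$, $H$ contains a copy of $F$ if there is an injection $U\to\Omega_n$ preserving the cyclic order and mapping every edge of $F$ onto an edge of $H$; $H$ is $F$-free if it contains no copy of $F$. $H$ is $F$-saturated if it is $F$-free and for every $e\in\binom{\Omega_n}{r}\setminus H$, $H\cup\{e\}$ contains a copy of $F$. $\mathrm{sat}_\circlearrowright(n,F)$ is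 the minimum number of edges of an $F$-saturated $r$-cgh on $\Omega_n$. $M_1^{(r)}$ is the $r$-cgh on $2r$ cyclically ordered points $u_0<\dots<u_{2r-1}<u_0$ with the two edges $\{u_0,\dots,u_{r-1}\}$ and $\{u_r,\dots,u_{2r-1}\}$ (two geometrically disjoint $r$-sets). For $n\ge 6$, \[H_n^{(3)}=\{h\in\tbinom{\Omega_n}{3}: v_0\in h\}\cup\{h\in\tbinom{\Omega_n}{3}:\{v_1,v_{n-2}\}\subseteq h\text{ or }\{v_1,v_{n-1}\}\subseteq h\text{ or }\{v_2,v_{n-1}\}\subseteq h\}.\] -}

module Defs where

open import Data.Nat as ℕ using (ℕ; zero; suc; _+_; _*_; _∸_; _≤_; _<_)
open import Data.Nat.Combinatorics using (_C_)
open import Data.Bool using (Bool; true; false; _∧_; _∨_)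
open import Data.Fin as Fin using (Fin; toℕ)
open import Data.Fin.Subset as Sub using (Subset; ∣_∣)
open import Data.Vec using (Vec; []; _∷_; tabulate)
open import Data.List as List using (List; []; _∷_; length; filterᵇ; _++_)
open import Data.List.Membership.Propositional as LM using ()
open import Data.List.Relation.Unary.All using (All)
open import Data.List.Relation.Unary.Unique.Propositional using (Unique)
open import Data.Product using (Σ; ∃; _×_; _,_)
open import Data.Sum using (_⊎_)
open import Relation.Binary.PropositionalEquality using (_≡_)
open import Function.Definitions using (Injective; Bijective)
open import Function.Bundles using (_⇔_)

-- Vertices of Ω_n are Fin n, with v_i = the element of Fin n with toℕ i;
-- the clockwise cyclic order v_0 < v_1 < ... < v_{n-1} < v_0 gives the
-- ternary relation "a, b, c occur in this clockwise order".
Cyc : {n : ℕ} → Fin n → Fin n → Fin n → Set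
Cyc a b c = (a Fin.< b × b Fin.< c) ⊎ (b Fin.< c × c Fin.< a) ⊎ (c Fin.< a × a Fin.< b)

CGH : ℕ → Set
CGH n = List (Subset n)

IsRCgh : (r : ℕ) {n : ℕ} → CGH n → Set
IsRCgh r H = Unique H × All (λ h → ∣ h ∣ ≡ r) H

MapsOnto : {m n : ℕ} → (Fin m → Fin n) → Subset m → Subset n → Set
MapsOnto φ e h = ∀ y → (y Sub.∈ h) ⇔ (∃ λ x → x Sub.∈ e × φ x ≡ y)

CycEmbedding : {m n : ℕ} → (Fin m → Fin n) → Set
CycEmbedding φ = Injective _≡_ _≡_ φ × (∀ a b c → Cyc a b c → Cyc (φ a) (φ b) (φ c))

Contains : {m n : ℕ} → CGH m → CGH n → Set
Contains {m} {n} F H =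
  Σ (Fin m → Fin n) λ φ → CycEmbedding φ ×
    (∀ e → e LM.∈ F → ∃ λ h → h LM.∈ H × MapsOnto φ e h)

Free : {m n : ℕ} → CGH m → CGH n → Set
Free F H = Contains F H → Data.Empty.⊥
  where import Data.Empty

Saturated : (r : ℕ) {m n : ℕ} → CGH m → CGH n → Set
Saturated r F H =
  IsRCgh r H × Free F H ×
  (∀ e → ∣ e ∣ ≡ r → (e LM.∈ H → Data.Empty.⊥) → Contains F (e ∷ H))
  where import Data.Empty

IsSat : (r : ℕ) {m : ℕ} → CGH m → (n : ℕ) → ℕ → Set
IsSat r F n s =
  (∃ λ (H : CGH n) → Saturated r F H × length H ≡ s) ×
  (∀ (H : CGH n) → Saturated r F H → s ≤ length H)

M1 : (r : ℕ) → CGH (r + r)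
M1 r = tabulate (λ i → toℕ i ℕ.<ᵇ r) ∷ tabulate (λ i → r ℕ.≤ᵇ toℕ i) ∷ []

Iso : {n : ℕ} → CGH n → CGH n → Set
Iso {n} H H' =
  Σ (Fin n → Fin n) λ f → Bijective _≡_ _≡_ f ×
    (∀ a b c → Cyc a b c → Cyc (f a) (f b) (f c)) ×
    (∀ h → h LM.∈ H → ∃ λ h' → h' LM.∈ H' × MapsOnto f h h') ×
    (∀ h' → h' LM.∈ H' → ∃ λ h → h LM.∈ H × MapsOnto f h h')

allSubsets : (n : ℕ) → List (Subset n)
allSubsets zero = [] ∷ []
allSubsets (suc n) = List.map (false ∷_) (allSubsets n) ++ List.map (true ∷_) (allSubsets n)

memIdx : {n : ℕ} → Subset n → ℕ → Bool
memIdx [] i = false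
memIdx (b ∷ h) zero = b
memIdx (b ∷ h) (suc i) = memIdx h i

H3pred : (n : ℕ) → Subset n → Bool
H3pred n h =
  memIdx h 0 ∨ (memIdx h 1 ∧ memIdx h (n ∸ 2)) ∨ (memIdx h 1 ∧ memIdx h (n ∸ 1))
    ∨ (memIdx h 2 ∧ memIdx h (n ∸ 1))

H3 : (n : ℕ) → CGH n
H3 n = filterᵇ (λ h → (∣ h ∣ ℕ.≡ᵇ 3) ∧ H3pred n h) (allSubsets n)

{-# OPTIONS --safe #-}

-- Two r-sets form a copy of M1 exactly when they lie in two complementary arcs of the cycle.  For a saturated
-- family H call an arc full if it contains an edge of H.  Supersets of full arcs are full, disjoint arcs are not
-- both full, and maximality of H makes exactly one of each arc and its complement full.  An r-set is a non-edge
-- iff one of its gaps is full, and then only one is, so the number of non-edges is the sum over j of u(j) w(j),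
-- where u(j) is the number of full arcs of length j and w(j) = C(n - 2 - j, r - 2) is the number of r-sets with a
-- given gap of length j.  Since u(j) + u(n - j) = n, w is decreasing, and u(j) ≤ j for 2j ≤ n by Katona's cycle
-- argument, this sum is largest for the star, in which u(j) = j for r ≤ j ≤ n - r.  For r = 2 all weights are 1
-- and the sum does not depend on H.  For r = 3 and n > 6 equality forces u(3) = 3, so three arcs of length 3 share
-- a point, and every edge of H meets all of them.
module Submission where

open import Defs
open import Data.Nat using (ℕ; zero; suc; _+_; _*_; _∸_; _≤_; _<_; z≤n; s≤s; NonZero; >-nonZero⁻¹;
  _≤?_; _<?_; _≟_; _<ᵇ_; _≤ᵇ_; _≡ᵇ_; _%_; _/_)
open import Data.Nat.Combinatorics using (_C_; nCk+nC[k+1]≡[n+1]C[k+1]; nC1≡n)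
open import Data.Nat.DivMod using (_mod_; m%n<n; m<n⇒m%n≡m; [m+kn]%n≡m%n; [m+n]%n≡m%n; m≡m%n+[m/n]*n)
open import Data.Nat.Properties
open import Data.Nat.Tactic.RingSolver using (solve)
open import Algebra.Properties.Semiring.Sum +-*-semiring
  using (sum; sum-cong-≗; ∑-distrib-+; ∑-comm; *-distribʳ-sum)
open import Algebra.Properties.CommutativeSemigroup +-commutativeSemigroup using (interchange)
open import Data.Bool using (Bool; true; false; T; T?; _∧_; _∨_; if_then_else_)
import Data.Bool.Properties as Bool
open import Data.Empty using (⊥; ⊥-elim)
open import Data.Fin as Fin using (Fin; toℕ; fromℕ<)
open import Data.Fin.Properties using (toℕ<n; toℕ-fromℕ<; toℕ-injective)
open import Data.Fin.Subset as Sub using (Subset; ∣_∣)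
open import Data.List as List using (List; []; _∷_; length; filter; map)
open import Data.List.Membership.Propositional using (_∈_; _∉_; find; lose)
open import Data.List.Membership.Propositional.Properties
  using (∈-map⁺; ∈-map⁻; ∈-++⁺ˡ; ∈-++⁺ʳ; ∈-filter⁺; ∈-filter⁻)
open import Data.List.Relation.Unary.All as All using (All)
open import Data.List.Relation.Unary.All.Properties using (All¬⇒¬Any)
open import Data.List.Relation.Unary.Any as Any using (Any; here; there)
open import Data.List.Relation.Unary.AllPairs as AllPairs using (AllPairs)
open import Data.List.Relation.Unary.Unique.Propositional using (Unique)
import Data.List.Relation.Unary.Unique.Propositional.Properties as Unique
open import Data.Maybe using (Maybe; just; nothing)
open import Data.Product using (∃; ∃₂; ∃-syntax; _×_; _,_; proj₁; proj₂)
open import Data.Sum using (_⊎_; inj₁; inj₂)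
open import Data.Vec as Vec using (lookup; tabulate)
open import Data.Vec.Properties using (≡-dec; []=⇒lookup; lookup⇒[]=; lookup∘tabulate)
open import Function using (_∘_; id; mk⇔; Equivalence)
open import Relation.Binary using (tri<; tri≈; tri>)
open import Relation.Binary.PropositionalEquality
  using (_≡_; _≢_; refl; sym; trans; cong; cong₂; subst; subst₂; module ≡-Reasoning)
open import Relation.Nullary using (¬_; Dec; yes; no; does; contradiction)
open import Relation.Nullary.Decidable using (_→-dec_; _×-dec_; ¬?; map′; decidable-stable; dec-true; dec-false)

-- That one of two complementary arcs is full comes from a special test set: an r-set inside the arc
-- which contains both end points of the arc. If the arc is not full, this set is no edge and has a
-- full gap; a gap inside the arc would make the arc full, so the full gap is the outside. The
-- condition 2r ≤ n ensures that one of two complementary arcs has room for such a set.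
--
-- Since u(j) + u(n - j) = n, the sums for an arbitrary family and for the star are compared pair by
-- pair, and equality in a pair determines u(j) only if w(j) > w(n - j). For r = 3 and j = 3 the
-- weights are n - 5 and 1, which is where n > 6 enters.
--
-- The asymptotics need no closed form for the star: it contains all C(n - 1, r - 1) sets through
-- its centre, and any other member has a gap of length below 2r around the centre, which leaves
-- O(C(n - 1, r - 2)) sets for fixed r.
--
-- Subsets are extended periodically to ℕ and arcs are intervals of naturals, so that arcs through
-- v_0 need no separate treatment.

private
  variable
    P Q : Set

-- Linear arithmetic: A ≤ B is the sum of the hypotheses, and the identity is left to the ring solver.
by-lin : ∀ {A B c d} k → A ≤ B → c + B + k ≡ d + A → c ≤ d
by-lin {A} {B} {c} {d} k A≤B eq = +-cancelʳ-≤ A c d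
  (≤-trans (≤-trans (+-monoʳ-≤ c A≤B) (m≤m+n (c + B) k)) (≤-reflexive eq))

𝟙 : Bool → ℕ
𝟙 b = if b then 1 else 0

⟦_⟧ : Dec P → ℕ
⟦ d ⟧ = 𝟙 (does d)

⟦⟧-yes : (d : Dec P) → P → ⟦ d ⟧ ≡ 1
⟦⟧-yes (yes _) _ = refl
⟦⟧-yes (no ¬p) p = contradiction p ¬p

⟦⟧-no : (d : Dec P) → ¬ P → ⟦ d ⟧ ≡ 0
⟦⟧-no (yes p) ¬p = contradiction p ¬p
⟦⟧-no (no _)  _  = refl

⟦⟧-mono : (p? : Dec P) (q? : Dec Q) → (P → Q) → ⟦ p? ⟧ ≤ ⟦ q? ⟧
⟦⟧-mono (yes p) q? f = ≤-reflexive (sym (⟦⟧-yes q? (f p)))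
⟦⟧-mono (no _)  q? f = z≤n

⟦⟧-cong : (p? : Dec P) (q? : Dec Q) → (P → Q) → (Q → P) → ⟦ p? ⟧ ≡ ⟦ q? ⟧
⟦⟧-cong p? q? f g = ≤-antisym (⟦⟧-mono p? q? f) (⟦⟧-mono q? p? g)

⟦⟧-pos : (d : Dec P) → 0 < ⟦ d ⟧ → P
⟦⟧-pos (yes p) _ = p

⟦⟧-exclusive : (p? : Dec P) (q? : Dec Q) → (P → Q → ⊥) → ⟦ p? ⟧ + ⟦ q? ⟧ ≤ 1
⟦⟧-exclusive (no _)  (yes _) _ = s≤s z≤n
⟦⟧-exclusive (no _)  (no _)  _ = z≤n
⟦⟧-exclusive (yes _) (no _)  _ = s≤s z≤n
⟦⟧-exclusive (yes p) (yes q) f = ⊥-elim (f p q)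

-- Finite sums

∑ : ℕ → (ℕ → ℕ) → ℕ
∑ n f = sum {n} (f ∘ toℕ)

∑-cong : ∀ n {f g : ℕ → ℕ} → (∀ i → i < n → f i ≡ g i) → ∑ n f ≡ ∑ n g
∑-cong n eq = sum-cong-≗ {n} (λ i → eq (toℕ i) (toℕ<n i))

∑-mono : ∀ n {f g : ℕ → ℕ} → (∀ i → i < n → f i ≤ g i) → ∑ n f ≤ ∑ n g
∑-mono zero    le = z≤n
∑-mono (suc n) le = +-mono-≤ (le 0 (s≤s z≤n)) (∑-mono n (λ i i<n → le (suc i) (s≤s i<n)))

∑-+ : ∀ n (f g : ℕ → ℕ) → ∑ n (λ i → f i + g i) ≡ ∑ n f + ∑ n g
∑-+ n f g = ∑-distrib-+ {n} (f ∘ toℕ) (g ∘ toℕ)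

∑-swap : ∀ m n (f : ℕ → ℕ → ℕ) → ∑ m (λ i → ∑ n (f i)) ≡ ∑ n (λ j → ∑ m (λ i → f i j))
∑-swap m n f = ∑-comm {m} {n} (λ i j → f (toℕ i) (toℕ j))

∑-*ʳ : ∀ n (f : ℕ → ℕ) c → ∑ n f * c ≡ ∑ n (λ i → f i * c)
∑-*ʳ n f c = *-distribʳ-sum {n} c (f ∘ toℕ)

∑-const : ∀ n c → ∑ n (λ _ → c) ≡ n * c
∑-const zero    c = refl
∑-const (suc n) c = cong (c +_) (∑-const n c)

∑-zero : ∀ n {f : ℕ → ℕ} → (∀ i → i < n → f i ≡ 0) → ∑ n f ≡ 0
∑-zero n eq = trans (∑-cong n eq) (trans (∑-const n 0) (*-zeroʳ n))

∑-snoc : ∀ n (f : ℕ → ℕ) → ∑ (suc n) f ≡ ∑ n f + f n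
∑-snoc zero    f = +-identityʳ (f 0)
∑-snoc (suc n) f = trans (cong (f 0 +_) (∑-snoc n (f ∘ suc))) (sym (+-assoc (f 0) _ _))

∑-split : ∀ m n (f : ℕ → ℕ) → ∑ (m + n) f ≡ ∑ m f + ∑ n (λ i → f (m + i))
∑-split zero    n f = refl
∑-split (suc m) n f = trans (cong (f 0 +_) (∑-split m n (f ∘ suc))) (sym (+-assoc (f 0) _ _))

∑-rev : ∀ n (f : ℕ → ℕ) → ∑ (suc n) f ≡ ∑ (suc n) (λ i → f (n ∸ i))
∑-rev zero    f = refl
∑-rev (suc n) f = begin
  ∑ (suc (suc n)) f                          ≡⟨ ∑-snoc (suc n) f ⟩
  ∑ (suc n) f + f (suc n)                    ≡⟨ +-comm (∑ (suc n) f) _ ⟩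
  f (suc n) + ∑ (suc n) f                    ≡⟨ cong (f (suc n) +_) (∑-rev n f) ⟩
  f (suc n) + ∑ (suc n) (λ i → f (n ∸ i))    ∎
  where open ≡-Reasoning

-- Moving the window by one drops `f a` and gains `f (a + n)`, which are equal. The windows are
-- compared after adding `f a`, so that nothing is subtracted.
∑-shift : ∀ n {f : ℕ → ℕ} → (∀ i → f (i + n) ≡ f i) → ∀ a → ∑ n (λ i → f (a + i)) ≡ ∑ n f
∑-shift n     per zero    = refl
∑-shift n {f} per (suc a) = trans (+-cancelˡ-≡ (f a) _ _ step) (∑-shift n per a)
  where
  open ≡-Reasoning
  step : f a + ∑ n (λ i → f (suc a + i)) ≡ f a + ∑ n (λ i → f (a + i))
  step = begin
    f a + ∑ n (λ i → f (suc a + i))          ≡⟨ cong₂ _+_ (cong f (sym (+-identityʳ a)))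
                                                  (∑-cong n (λ i _ → cong f (sym (+-suc a i)))) ⟩
    ∑ (suc n) (λ i → f (a + i))              ≡⟨ ∑-snoc n (λ i → f (a + i)) ⟩
    ∑ n (λ i → f (a + i)) + f (a + n)        ≡⟨ cong (∑ n (λ i → f (a + i)) +_) (per a) ⟩
    ∑ n (λ i → f (a + i)) + f a              ≡⟨ +-comm _ (f a) ⟩
    f a + ∑ n (λ i → f (a + i))              ∎

∑-term : ∀ {n} (f : ℕ → ℕ) {i} → i < n → f i ≤ ∑ n f
∑-term {suc n} f {zero}  _         = m≤m+n (f 0) _
∑-term {suc n} f {suc i} (s≤s i<n) = ≤-trans (∑-term (f ∘ suc) i<n) (m≤n+m _ (f 0))

∑-single : ∀ {n} (f : ℕ → ℕ) {i} → i < n → (∀ j → j < n → j ≢ i → f j ≡ 0) → ∑ n f ≡ f i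
∑-single {suc n} f {zero}  _         z =
  trans (cong (f 0 +_) (∑-zero n (λ j j<n → z (suc j) (s≤s j<n) λ ()))) (+-identityʳ (f 0))
∑-single {suc n} f {suc i} (s≤s i<n) z =
  trans (cong (_+ ∑ n (f ∘ suc)) (z 0 (s≤s z≤n) λ ()))
        (∑-single (f ∘ suc) i<n (λ j j<n j≢i → z (suc j) (s≤s j<n) (j≢i ∘ suc-injective)))

∑-pos : ∀ n (f : ℕ → ℕ) → 0 < ∑ n f → ∃[ i ] i < n × 0 < f i
∑-pos (suc n) f pos with f 0 in eq
... | suc _ = 0 , s≤s z≤n , subst (0 <_) (sym eq) (s≤s z≤n)
... | zero  with i , i<n , fi ← ∑-pos n (f ∘ suc) pos = suc i , s≤s i<n , fi

-- A strict inequality at one index would make the whole sum strict. This is how a family of minimum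
-- size is forced to agree with the star in every paired term.
∑-tight : ∀ {n} (f g : ℕ → ℕ) → (∀ i → i < n → f i ≤ g i) → ∑ n f ≡ ∑ n g →
          ∀ {i} → i < n → f i ≡ g i
∑-tight {suc n} f g le eq {i} i<n with f 0 ≟ g 0 | i
... | yes e | zero  = e
... | yes e | suc j = ∑-tight (f ∘ suc) (g ∘ suc) (λ k k<n → le (suc k) (s≤s k<n))
                        (+-cancelˡ-≡ (f 0) _ _ (trans eq (cong (_+ ∑ n (g ∘ suc)) (sym e))))
                        (≤-pred i<n)
... | no ne | _     = contradiction eq (<⇒≢
  (+-mono-<-≤ (≤∧≢⇒< (le 0 (s≤s z≤n)) ne) (∑-mono n (λ k k<n → le (suc k) (s≤s k<n)))))

-- Sums over all subsets of Fin n

-- Recursion on the first coordinate, so that pattern counts follow Pascal's rule by induction on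
-- `n`.
∑ˢ : ∀ n → (Subset n → ℕ) → ℕ
∑ˢ zero    f = f Vec.[]
∑ˢ (suc n) f = ∑ˢ n (f ∘ (false Vec.∷_)) + ∑ˢ n (f ∘ (true Vec.∷_))

∑ˢ-cong : ∀ n {f g : Subset n → ℕ} → (∀ e → f e ≡ g e) → ∑ˢ n f ≡ ∑ˢ n g
∑ˢ-cong zero    eq = eq Vec.[]
∑ˢ-cong (suc n) eq = cong₂ _+_ (∑ˢ-cong n (eq ∘ (false Vec.∷_))) (∑ˢ-cong n (eq ∘ (true Vec.∷_)))

∑ˢ-mono : ∀ n {f g : Subset n → ℕ} → (∀ e → f e ≤ g e) → ∑ˢ n f ≤ ∑ˢ n g
∑ˢ-mono zero    le = le Vec.[]
∑ˢ-mono (suc n) le = +-mono-≤ (∑ˢ-mono n (le ∘ (false Vec.∷_))) (∑ˢ-mono n (le ∘ (true Vec.∷_)))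

∑ˢ-+ : ∀ n (f g : Subset n → ℕ) → ∑ˢ n (λ e → f e + g e) ≡ ∑ˢ n f + ∑ˢ n g
∑ˢ-+ zero    f g = refl
∑ˢ-+ (suc n) f g = trans
  (cong₂ _+_ (∑ˢ-+ n (f ∘ (false Vec.∷_)) (g ∘ (false Vec.∷_))) (∑ˢ-+ n (f ∘ (true Vec.∷_)) (g ∘ (true Vec.∷_))))
  (interchange (∑ˢ n (f ∘ (false Vec.∷_))) _ _ _)

∑ˢ-zero : ∀ n {f : Subset n → ℕ} → (∀ e → f e ≡ 0) → ∑ˢ n f ≡ 0
∑ˢ-zero zero    eq = eq Vec.[]
∑ˢ-zero (suc n) eq = cong₂ _+_ (∑ˢ-zero n (eq ∘ (false Vec.∷_))) (∑ˢ-zero n (eq ∘ (true Vec.∷_)))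

∑ˢ-*ˡ : ∀ n c (f : Subset n → ℕ) → ∑ˢ n (λ e → c * f e) ≡ c * ∑ˢ n f
∑ˢ-*ˡ zero    c f = refl
∑ˢ-*ˡ (suc n) c f = trans (cong₂ _+_ (∑ˢ-*ˡ n c _) (∑ˢ-*ˡ n c _)) (sym (*-distribˡ-+ c _ _))

∑ˢ-∑ : ∀ n m (f : Subset n → ℕ → ℕ) → ∑ˢ n (λ e → ∑ m (f e)) ≡ ∑ m (λ i → ∑ˢ n (λ e → f e i))
∑ˢ-∑ n zero    f = ∑ˢ-zero n (λ _ → refl)
∑ˢ-∑ n (suc m) f = trans (∑ˢ-+ n _ _) (cong (∑ˢ n (λ e → f e 0) +_) (∑ˢ-∑ n m (λ e → f e ∘ suc)))

_≟ˢ_ : ∀ {n} (e f : Subset n) → Dec (e ≡ f)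
_≟ˢ_ = ≡-dec Bool._≟_

∑ˢ-δ : ∀ {n} (x : Subset n) → ∑ˢ n (λ e → ⟦ e ≟ˢ x ⟧) ≡ 1
∑ˢ-δ Vec.[]          = refl
∑ˢ-δ {suc n} (false Vec.∷ x) = cong₂ _+_
  (trans (∑ˢ-cong n (λ e → ⟦⟧-cong ((false Vec.∷ e) ≟ˢ (false Vec.∷ x)) (e ≟ˢ x) (cong Vec.tail)
        (cong (false Vec.∷_)))) (∑ˢ-δ x))
  (∑ˢ-zero n (λ e → ⟦⟧-no ((true Vec.∷ e) ≟ˢ (false Vec.∷ x)) λ ()))
∑ˢ-δ {suc n} (true Vec.∷ x) = cong₂ _+_
  (∑ˢ-zero n (λ e → ⟦⟧-no ((false Vec.∷ e) ≟ˢ (true Vec.∷ x)) λ ()))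
  (trans (∑ˢ-cong n (λ e → ⟦⟧-cong ((true Vec.∷ e) ≟ˢ (true Vec.∷ x)) (e ≟ˢ x) (cong Vec.tail)
        (cong (true Vec.∷_)))) (∑ˢ-δ x))

_∈?_ : ∀ {n} (e : Subset n) (H : CGH n) → Dec (e ∈ H)
e ∈? H = Any.any? (e ≟ˢ_) H

length-∑ˢ : ∀ {n} {H : CGH n} → Unique H → length H ≡ ∑ˢ n (λ e → ⟦ e ∈? H ⟧)
length-∑ˢ {n} {[]}    AllPairs.[]          = sym (∑ˢ-zero n (λ _ → refl))
length-∑ˢ {n} {h ∷ H} (h∉H AllPairs.∷ uH) = sym (begin
  ∑ˢ n (λ e → ⟦ e ∈? (h ∷ H) ⟧)                        ≡⟨ ∑ˢ-cong n split ⟩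
  ∑ˢ n (λ e → ⟦ e ≟ˢ h ⟧ + ⟦ e ∈? H ⟧)                 ≡⟨ ∑ˢ-+ n _ _ ⟩
  ∑ˢ n (λ e → ⟦ e ≟ˢ h ⟧) + ∑ˢ n (λ e → ⟦ e ∈? H ⟧)    ≡⟨ cong₂ _+_ (∑ˢ-δ h) (sym (length-∑ˢ uH)) ⟩
  suc (length H)                                       ∎)
  where
  open ≡-Reasoning
  split : ∀ e → ⟦ e ∈? (h ∷ H) ⟧ ≡ ⟦ e ≟ˢ h ⟧ + ⟦ e ∈? H ⟧
  split e with e ≟ˢ h | e ∈? H
  ... | no _     | yes _   = refl
  ... | no _     | no _    = refl
  ... | yes _    | no _    = refl
  ... | yes refl | yes e∈H = contradiction e∈H (All¬⇒¬Any h∉H)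

-- Counting subsets subject to prescribed members and non-members

compat : Maybe Bool → Bool → Bool
compat nothing  b = true
compat (just c) b = does (b Bool.≟ c)

-- A pattern prescribes membership at the places with `just` and leaves the places with `nothing`
-- open. It is defined on all naturals, so that its tail is simply `p ∘ suc`.
fits : ∀ {n} → (ℕ → Maybe Bool) → Subset n → Bool
fits p Vec.[]      = true
fits p (b Vec.∷ e) = compat (p 0) b ∧ fits (p ∘ suc) e

forced : Maybe Bool → ℕ
forced (just true) = 1
forced _           = 0

free : Maybe Bool → ℕ
free nothing  = 1
free (just _) = 0

nC0≡1 : ∀ n → n C 0 ≡ 1
nC0≡1 zero    = refl
nC0≡1 (suc n) = refl

fits⇒forced≤ : ∀ {n} p (e : Subset n) → T (fits p e) → ∑ n (forced ∘ p) ≤ ∣ e ∣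
fits⇒forced≤ p Vec.[]      _ = z≤n
fits⇒forced≤ p (b Vec.∷ e) t with p 0 | b
... | nothing    | true  = m≤n⇒m≤1+n (fits⇒forced≤ (p ∘ suc) e t)
... | nothing    | false = fits⇒forced≤ (p ∘ suc) e t
... | just true  | true  = s≤s (fits⇒forced≤ (p ∘ suc) e t)
... | just false | false = fits⇒forced≤ (p ∘ suc) e t

-- Written as `k` plus the forced members, the size leaves exactly `k` members to choose among the
-- open places; an open first place is Pascal's rule.
∑ˢ-fits : ∀ n p k → ∑ˢ n (λ e → ⟦ ∣ e ∣ ≟ k + ∑ n (forced ∘ p) ⟧ * 𝟙 (fits p e)) ≡ ∑ n (free ∘ p) C k
∑ˢ-fits zero p zero    = refl
∑ˢ-fits zero p (suc k) = refl
∑ˢ-fits (suc n) p k with p 0 | k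
... | just false | k = trans (cong₂ _+_ (∑ˢ-fits n (p ∘ suc) k)
      (∑ˢ-zero n (λ e → *-zeroʳ ⟦ suc ∣ e ∣ ≟ k + ∑ n (forced ∘ p ∘ suc) ⟧)))
                             (+-identityʳ _)
... | just true  | k rewrite +-suc k (∑ n (forced ∘ p ∘ suc)) =
  cong₂ _+_ (∑ˢ-zero n (λ e → *-zeroʳ ⟦ ∣ e ∣ ≟ suc (k + ∑ n (forced ∘ p ∘ suc)) ⟧)) (∑ˢ-fits n (p ∘ suc) k)
... | nothing | suc k = trans (cong₂ _+_ (∑ˢ-fits n (p ∘ suc) (suc k)) (∑ˢ-fits n (p ∘ suc) k))
                       (trans (+-comm (f C suc k) _) (nCk+nC[k+1]≡[n+1]C[k+1] f k))
  where f = ∑ n (free ∘ p ∘ suc)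
... | nothing | zero  = trans (cong₂ _+_ (trans (∑ˢ-fits n (p ∘ suc) 0) (nC0≡1 (∑ n (free ∘ p ∘ suc))))
      (∑ˢ-zero n none)) refl
  where
  -- All members are already forced, so a set that takes this open place exceeds the size.
  none : ∀ e → ⟦ suc ∣ e ∣ ≟ ∑ n (forced ∘ p ∘ suc) ⟧ * 𝟙 (fits (p ∘ suc) e) ≡ 0
  none e with fits (p ∘ suc) e in eq
  ... | false = *-zeroʳ ⟦ suc ∣ e ∣ ≟ ∑ n (forced ∘ p ∘ suc) ⟧
  ... | true  = trans (*-identityʳ _) (⟦⟧-no (suc ∣ e ∣ ≟ ∑ n (forced ∘ p ∘ suc)) λ e≡ →
                  <⇒≱ (≤-reflexive e≡) (fits⇒forced≤ (p ∘ suc) e (subst T (sym eq) _)))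

-- The list of all subsets

∈-allSubsets : ∀ {n} (e : Subset n) → e ∈ allSubsets n
∈-allSubsets Vec.[]                  = here refl
∈-allSubsets {suc n} (false Vec.∷ e) = ∈-++⁺ˡ (∈-map⁺ (false Vec.∷_) (∈-allSubsets e))
∈-allSubsets {suc n} (true Vec.∷ e)  = ∈-++⁺ʳ (map (false Vec.∷_) (allSubsets n)) (∈-map⁺ (true Vec.∷_) (∈-allSubsets e))

allSubsets-unique : ∀ n → Unique (allSubsets n)
allSubsets-unique zero    = All.[] AllPairs.∷ AllPairs.[]
allSubsets-unique (suc n) = Unique.++⁺
  (Unique.map⁺ (cong Vec.tail) (allSubsets-unique n)) (Unique.map⁺ (cong Vec.tail) (allSubsets-unique n))
  λ (∈f , ∈t) → case-heads (∈-map⁻ _ ∈f) (∈-map⁻ _ ∈t)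
  where
  case-heads : ∀ {v : Subset (suc n)} → (∃[ e ] e ∈ allSubsets n × v ≡ false Vec.∷ e) →
               (∃[ e ] e ∈ allSubsets n × v ≡ true Vec.∷ e) → ⊥
  case-heads (_ , _ , refl) (_ , _ , ())

-- A subset as an n-periodic set of natural numbers

module _ {n : ℕ} .{{_ : NonZero n}} where

  toℕ-mod : ∀ y → toℕ (y mod n) ≡ y % n
  toℕ-mod y = toℕ-fromℕ< (m%n<n y n)

  mod-cong : ∀ {x y} → x % n ≡ y % n → x mod n ≡ y mod n
  mod-cong {x} {y} eq = toℕ-injective (trans (toℕ-mod x) (trans eq (sym (toℕ-mod y))))

  toℕ-mod-toℕ : ∀ (i : Fin n) → toℕ i mod n ≡ i
  toℕ-mod-toℕ i = toℕ-injective (trans (toℕ-mod (toℕ i)) (m<n⇒m%n≡m (toℕ<n i)))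

  opaque
    χ : Subset n → ℕ → Bool
    χ e y = lookup e (y mod n)

    χ-mod : ∀ e y → χ e y ≡ lookup e (y mod n)
    χ-mod e y = refl

    χ-toℕ : ∀ e i → χ e (toℕ i) ≡ lookup e i
    χ-toℕ e i = cong (lookup e) (toℕ-mod-toℕ i)

    χ-periodic : ∀ e k y → χ e (y + k * n) ≡ χ e y
    χ-periodic e k y = cong (lookup e) (mod-cong ([m+kn]%n≡m%n y k n))

    χ-periodic₁ : ∀ e y → χ e (y + n) ≡ χ e y
    χ-periodic₁ e y = cong (lookup e) (mod-cong ([m+n]%n≡m%n y n))

lookup-memIdx : ∀ {n} (e : Subset n) i → memIdx e (toℕ i) ≡ lookup e i
lookup-memIdx (b Vec.∷ e) Fin.zero    = refl
lookup-memIdx (b Vec.∷ e) (Fin.suc i) = lookup-memIdx e i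

∣∣-memIdx : ∀ {n} (e : Subset n) → ∣ e ∣ ≡ ∑ n (𝟙 ∘ memIdx e)
∣∣-memIdx Vec.[]          = refl
∣∣-memIdx (true Vec.∷ e)  = cong suc (∣∣-memIdx e)
∣∣-memIdx (false Vec.∷ e) = ∣∣-memIdx e

a+i+a[n-1] : ∀ a i n .{{_ : NonZero n}} → (a + i) + a * (n ∸ 1) ≡ i + a * n
a+i+a[n-1] a i (suc m) = expand a i m
  where
  expand : ∀ a i m → (a + i) + a * m ≡ i + a * suc m
  expand a i m = solve (a ∷ i ∷ m ∷ [])

module _ {n : ℕ} .{{_ : NonZero n}} where

  memIdx-χ : ∀ (e : Subset n) {y} → y < n → memIdx e y ≡ χ e y
  memIdx-χ e {y} y<n = begin
    memIdx e y                    ≡⟨ cong (memIdx e) (sym (trans (toℕ-mod y) (m<n⇒m%n≡m y<n))) ⟩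
    memIdx e (toℕ (y mod n))      ≡⟨ trans (lookup-memIdx e (y mod n)) (sym (χ-mod e y)) ⟩
    χ e y                         ∎
    where open ≡-Reasoning

  ∣∣-window : ∀ (e : Subset n) a → ∣ e ∣ ≡ ∑ n (λ i → 𝟙 (χ e (a + i)))
  ∣∣-window e a = begin
    ∣ e ∣                            ≡⟨ ∣∣-memIdx e ⟩
    ∑ n (𝟙 ∘ memIdx e)               ≡⟨ ∑-cong n (λ i i<n → cong 𝟙 (memIdx-χ e i<n)) ⟩
    ∑ n (𝟙 ∘ χ e)                    ≡⟨ sym (∑-shift n (λ i → cong 𝟙 (χ-periodic₁ e i)) a) ⟩
    ∑ n (λ i → 𝟙 (χ e (a + i)))      ∎
    where open ≡-Reasoning

  -- y + a (n − 1) is y − a modulo n.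
  unroll : ∀ {A : Set} → ℕ → (ℕ → A) → ℕ → A
  unroll a g y = g ((y + a * (n ∸ 1)) % n)

  unroll-window : ∀ {A : Set} a (g : ℕ → A) {i} → i < n → unroll a g (a + i) ≡ g i
  unroll-window a g {i} i<n = cong g (begin
    ((a + i) + a * (n ∸ 1)) % n   ≡⟨ cong (_% n) (a+i+a[n-1] a i n) ⟩
    (i + a * n) % n               ≡⟨ [m+kn]%n≡m%n i a n ⟩
    i % n                         ≡⟨ m<n⇒m%n≡m i<n ⟩
    i                             ∎)
    where open ≡-Reasoning

  unroll-periodic : ∀ {A : Set} a (g : ℕ → A) k y → unroll a g (y + k * n) ≡ unroll a g y
  unroll-periodic a g k y = cong g (begin
    ((y + k * n) + a * (n ∸ 1)) % n   ≡⟨ cong (_% n) (trans (+-assoc y _ _)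
                                           (trans (cong (y +_) (+-comm (k * n) _)) (sym (+-assoc y _ _)))) ⟩
    ((y + a * (n ∸ 1)) + k * n) % n   ≡⟨ [m+kn]%n≡m%n (y + a * (n ∸ 1)) k n ⟩
    (y + a * (n ∸ 1)) % n             ∎)
    where open ≡-Reasoning

  opaque
    -- The summand `a * n` comes first because `x` may lie before `a`; the offset from `a` to `x` is
    -- then the natural number `z`, up to a multiple of `n`.
    into-window : ∀ a x → ∃₂ λ i k → i < n × x + a * n ≡ (a + i) + k * n
    into-window a x = z % n , z / n , m%n<n z n , (begin
      x + a * n                          ≡⟨ shift ⟩
      a + z                              ≡⟨ cong (a +_) (m≡m%n+[m/n]*n z n) ⟩
      a + (z % n + (z / n) * n)          ≡⟨ sym (+-assoc a _ _) ⟩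
      (a + z % n) + (z / n) * n          ∎)
      where
      open ≡-Reasoning
      z : ℕ
      z = x + a * (n ∸ 1)
      shift : x + a * n ≡ a + z
      shift = trans (sym (a+i+a[n-1] a x n)) (+-assoc a x _)

  periodic-everywhere : ∀ {ℓ} (p : ℕ → Set ℓ) → (∀ k y → p (y + k * n) → p y) → (∀ k y → p y → p (y + k * n)) →
                        ∀ a → (∀ i → i < n → p (a + i)) → ∀ x → p x
  periodic-everywhere p down up a h x with i , k , i<n , eq ← into-window a x =
    down a x (subst p (sym eq) (up k (a + i) (h i i<n)))

  opaque
    subset-of : ∀ a (g : ℕ → Bool) → ∃[ e ] ∀ i → i < n → χ e (a + i) ≡ g i
    subset-of a g = tabulate (unroll a g ∘ toℕ) , λ i i<n → begin
      χ (tabulate (unroll a g ∘ toℕ)) (a + i)   ≡⟨ trans (χ-mod _ (a + i)) (lookup∘tabulate _ ((a + i) mod n)) ⟩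
      unroll a g (toℕ ((a + i) mod n))          ≡⟨ cong (unroll a g) (toℕ-mod (a + i)) ⟩
      unroll a g ((a + i) % n)                  ≡⟨ sym (unroll-periodic a g ((a + i) / n) _) ⟩
      unroll a g ((a + i) % n + (a + i) / n * n) ≡⟨ cong (unroll a g) (sym (m≡m%n+[m/n]*n (a + i) n)) ⟩
      unroll a g (a + i)                        ≡⟨ unroll-window a g i<n ⟩
      g i                                       ∎
      where open ≡-Reasoning
  
-- Nearest elements on either side of a point

opaque
  last-before : ∀ (p : ℕ → Bool) t {z} → z < t → p z ≡ true →
                ∃[ x ] x < t × p x ≡ true × (∀ y → x < y → y < t → p y ≡ false)
  last-before p (suc t) {z} z<1+t pz with p t in pt
  ... | true  = t , ≤-refl , pt , λ y t<y y<1+t → contradiction (≤-trans t<y (≤-pred y<1+t)) (<-irrefl refl)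
  ... | false with z ≟ t
  ...   | yes refl = contradiction (trans (sym pz) pt) λ ()
  ...   | no z≢t with x , x<t , px , gap ← last-before p t (≤∧≢⇒< (≤-pred z<1+t) z≢t) pz =
    x , m≤n⇒m≤1+n x<t , px , λ y x<y y<1+t → below y x<y y<1+t gap
    where
    below : ∀ y {x} → x < y → y < suc t → (∀ y → x < y → y < t → p y ≡ false) → p y ≡ false
    below y x<y y<1+t gap with y ≟ t
    ... | yes refl = pt
    ... | no y≢t   = gap y x<y (≤∧≢⇒< (≤-pred y<1+t) y≢t)

opaque
  first-from : ∀ (p : ℕ → Bool) t d → p (t + d) ≡ true →
               ∃[ x ] t ≤ x × p x ≡ true × (∀ y → t ≤ y → y < x → p y ≡ false)
  first-from p t d pz with p t in pt
  ... | true = t , ≤-refl , pt , λ y t≤y y<t → contradiction (≤-trans y<t t≤y) (<-irrefl refl)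
  first-from p t zero    pz | false = contradiction (trans (sym pz) (trans (cong p (+-identityʳ t)) pt)) λ ()
  first-from p t (suc d) pz | false with x , 1+t≤x , px , gap ← first-from p (suc t) d
        (trans (cong p (sym (+-suc t d))) pz) =
    x , <⇒≤ 1+t≤x , px , λ y t≤y y<x → above y t≤y y<x gap
    where
    above : ∀ y {x} → t ≤ y → y < x → (∀ y → suc t ≤ y → y < x → p y ≡ false) → p y ≡ false
    above y t≤y y<x gap with t ≟ y
    ... | yes refl = pt
    ... | no t≢y   = gap y (≤∧≢⇒< t≤y t≢y) y<x

-- The arc [a, b) of the n-cycle is given by naturals a ≤ b ≤ a + n taken modulo n;
-- its complement is [b, a + n).

module _ {n : ℕ} .{{_ : NonZero n}} where

  Empty : Subset n → ℕ → ℕ → Set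
  Empty e a b = ∀ y → a ≤ y → y < b → χ e y ≡ false

  opaque
    Empty? : ∀ e a b → Dec (Empty e a b)
    Empty? e a b = map′ (λ h y a≤y y<b → h y<b a≤y) (λ h {y} y<b a≤y → h y a≤y y<b)
      (allUpTo? (λ y → (a ≤? y) →-dec (χ e y Bool.≟ false)) b)

  Empty-⊆ : ∀ {e a b a' b'} → a ≤ a' → b' ≤ b → Empty e a b → Empty e a' b'
  Empty-⊆ a≤a' b'≤b h y a'≤y y<b' = h y (≤-trans a≤a' a'≤y) (<-≤-trans y<b' b'≤b)

  Empty-++ : ∀ {e a b c} → Empty e a b → Empty e b c → Empty e a c
  Empty-++ {b = b} h h' y a≤y y<c with y <? b
  ... | yes y<b = h y a≤y y<b
  ... | no y≮b  = h' y (≮⇒≥ y≮b) y<c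

  ∉-Empty : ∀ {e a b y} → Empty e a b → χ e y ≡ true → a ≤ y → y < b → ⊥
  ∉-Empty {y = y} h ey a≤y y<b with () ← trans (sym ey) (h y a≤y y<b)

  -- Congruence modulo `n` takes the form `x + k * n ≡ y + l * n`, which covers shifts in both
  -- directions without subtraction.
  χ-≈ : ∀ e {x y} k l → x + k * n ≡ y + l * n → χ e x ≡ χ e y
  χ-≈ e {x} {y} k l eq = trans (sym (χ-periodic e k x)) (trans (cong (χ e) eq) (χ-periodic e l y))

  Empty-≈ : ∀ {e a b a' b'} k l → a + k * n ≡ a' + l * n → b + k * n ≡ b' + l * n → Empty e a b → Empty e a' b'
  Empty-≈ {e} {a} {b} {a'} {b'} k l aa bb h y a'≤y y<b' =
    trans (χ-≈ e l k (sym z≡)) (h z (+-cancelʳ-≤ (k * n) a z (≤-trans lo (≤-reflexive (sym z≡))))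
                                    (+-cancelʳ-< (k * n) z b (≤-<-trans (≤-reflexive z≡) hi)))
    where
    lo : a + k * n ≤ y + l * n
    lo = ≤-trans (≤-reflexive aa) (+-monoˡ-≤ (l * n) a'≤y)
    hi : y + l * n < b + k * n
    hi = <-≤-trans (+-monoˡ-< (l * n) y<b') (≤-reflexive (sym bb))
    z = (y + l * n) ∸ k * n
    z≡ : z + k * n ≡ y + l * n
    z≡ = m∸n+n≡m (≤-trans (m≤n+m (k * n) a) lo)

  1-turn : ∀ a → (a + n) + 0 * n ≡ a + 1 * n
  1-turn a = solve (a ∷ n ∷ [])

  Empty-down : ∀ {e a b} → Empty e (a + n) (b + n) → Empty e a b
  Empty-down {e} {a} {b} = Empty-≈ {e} 0 1 (1-turn a) (1-turn b)

  Empty-up : ∀ {e a b} → Empty e a b → Empty e (a + n) (b + n)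
  Empty-up {e} {a} {b} = Empty-≈ {e} 1 0 (sym (1-turn a)) (sym (1-turn b))

  ∣∣-arc : ∀ e a d → d ≤ n → Empty e (a + d) (a + n) → ∣ e ∣ ≡ ∑ d (λ i → 𝟙 (χ e (a + i)))
  ∣∣-arc e a d d≤n h = begin
    ∣ e ∣                                    ≡⟨ ∣∣-window e a ⟩
    ∑ n f                                    ≡⟨ cong (λ m → ∑ m f) (sym (m+[n∸m]≡n d≤n)) ⟩
    ∑ (d + (n ∸ d)) f                        ≡⟨ ∑-split d (n ∸ d) f ⟩
    ∑ d f + ∑ (n ∸ d) (λ i → f (d + i))      ≡⟨ cong (∑ d f +_) (∑-zero (n ∸ d) outside) ⟩
    ∑ d f + 0                                ≡⟨ +-identityʳ _ ⟩
    ∑ d f                                    ∎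
    where
    open ≡-Reasoning
    f = λ i → 𝟙 (χ e (a + i))
    outside : ∀ i → i < n ∸ d → f (d + i) ≡ 0
    outside i i<n∸d = cong 𝟙 (h (a + (d + i)) (+-monoʳ-≤ a (m≤m+n d i))
      (+-monoʳ-< a (<-≤-trans (+-monoʳ-< d i<n∸d) (≤-reflexive (m+[n∸m]≡n d≤n)))))

  ∣∣-arc≤ : ∀ e a d → d ≤ n → Empty e (a + d) (a + n) → ∣ e ∣ ≤ d
  ∣∣-arc≤ e a d d≤n h = begin
    ∣ e ∣                             ≡⟨ ∣∣-arc e a d d≤n h ⟩
    ∑ d (λ i → 𝟙 (χ e (a + i)))       ≤⟨ ∑-mono d (λ i _ → 𝟙≤1 (χ e (a + i))) ⟩
    ∑ d (λ _ → 1)                     ≡⟨ trans (∑-const d 1) (*-identityʳ d) ⟩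
    d                                 ∎
    where
    open ≤-Reasoning
    𝟙≤1 : ∀ b → 𝟙 b ≤ 1
    𝟙≤1 true  = ≤-refl
    𝟙≤1 false = z≤n

  opaque
    some-element : ∀ e → 0 < ∣ e ∣ → ∀ a → ∃[ i ] i < n × χ e (a + i) ≡ true
    some-element e pos a with i , i<n , p ← ∑-pos n (λ i → 𝟙 (χ e (a + i))) (subst (0 <_) (∣∣-window e a) pos) =
      i , i<n , 𝟙-pos (χ e (a + i)) p
      where
      𝟙-pos : ∀ b → 0 < 𝟙 b → b ≡ true
      𝟙-pos true _ = refl

  -- The two emptiness conditions put `e` into the arc [s, t) and `f` into its complement [t, s +
  -- n).
  Sep : Subset n → Subset n → Set
  Sep e f = ∃₂ λ s t → s ≤ t × t ≤ s + n × Empty e t (s + n) × Empty f s t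

  Sep-sym : ∀ {e f} → Sep e f → Sep f e
  Sep-sym {e} {f} (s , t , s≤t , t≤s+n , he , hf) = t , s + n , t≤s+n , +-monoˡ-≤ n s≤t , Empty-up {f} hf , he

  -- An edge inside [a, b) is expressed as an edge that avoids the complement [b, a + n).
  Full : CGH n → ℕ → ℕ → Set
  Full H a b = ∃[ f ] f ∈ H × Empty f b (a + n)

  opaque
    Full? : ∀ H a b → Dec (Full H a b)
    Full? H a b = map′ find (λ (f , f∈H , h) → lose f∈H h) (Any.any? (λ f → Empty? f b (a + n)) H)

  Full-⊆ : ∀ {H a b a' b'} → a' ≤ a → b ≤ b' → Full H a b → Full H a' b'
  Full-⊆ a'≤a b≤b' (f , f∈H , h) = f , f∈H , Empty-⊆ {f} b≤b' (+-monoˡ-≤ n a'≤a) h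

  turn-comm : ∀ a k → (a + n) + k * n ≡ (a + k * n) + n
  turn-comm a k = solve (a ∷ k ∷ n ∷ [])

  Full-≈ : ∀ {H a b a' b'} k l → a + k * n ≡ a' + l * n → b + k * n ≡ b' + l * n → Full H a b → Full H a' b'
  Full-≈ {a = a} {a' = a'} k l aa bb (f , f∈H , h) = f , f∈H ,
    Empty-≈ {f} k l bb (trans (turn-comm a k) (trans (cong (_+ n) aa) (sym (turn-comm a' l)))) h

  Full-down : ∀ {H a b} → Full H (a + n) (b + n) → Full H a b
  Full-down {H} {a} {b} = Full-≈ {H} 0 1 (1-turn a) (1-turn b)

  Full-up : ∀ {H a b} → Full H a b → Full H (a + n) (b + n)
  Full-up {H} {a} {b} = Full-≈ {H} 1 0 (sym (1-turn a)) (sym (1-turn b))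

  -- Two cyclically consecutive elements. A one-element set has a gap from `x` to `x + n`;
  -- `gap-short` excludes this case later.
  record Gap (e : Subset n) (x y : ℕ) : Set where
    constructor gap
    field
      start  : χ e x ≡ true
      end    : χ e y ≡ true
      proper : x < y
      inside : Empty e (suc x) y

  open Gap public

  gap-next : ∀ {e x y z} → Gap e x y → x < z → χ e z ≡ true → y ≤ z
  gap-next {e} {y = y} {z} g x<z ez with y ≤? z
  ... | yes y≤z = y≤z
  ... | no y≰z  = ⊥-elim (∉-Empty {e} (inside g) ez x<z (≰⇒> y≰z))

  gap-≤n : ∀ {e x y} → Gap e x y → y ≤ x + n
  gap-≤n {e} {x} g = gap-next {e} g (m<m+n x (>-nonZero⁻¹ n)) (trans (χ-periodic₁ e x) (start g))

  gap-≈ : ∀ {e x y x' y'} k l → x + k * n ≡ x' + l * n → y + k * n ≡ y' + l * n → Gap e x y → Gap e x' y'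
  gap-≈ {e} {x} {y} {x'} {y'} k l xx yy g = gap
    (trans (χ-≈ e l k (sym xx)) (start g)) (trans (χ-≈ e l k (sym yy)) (end g))
    (+-cancelʳ-< (l * n) x' y' (subst₂ _<_ xx yy (+-monoˡ-< (k * n) (proper g))))
    (Empty-≈ {e} k l (cong suc xx) yy (inside g))

  -- Saturation freed of embeddings: a copy of `M1 r` enters only as a separated pair. The
  -- translations are `saturated⇒maxNonSep` and `maxNonSep⇒saturated`.
  record MaxNonSep (r : ℕ) (H : CGH n) : Set where
    field
      unique  : Unique H
      size    : ∀ {h} → h ∈ H → ∣ h ∣ ≡ r
      nonsep  : ∀ {e f} → e ∈ H → f ∈ H → ¬ Sep e f
      maximal : ∀ {e} → ∣ e ∣ ≡ r → e ∉ H → ∃[ f ] f ∈ H × Sep e f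

-- Full arcs of a saturated family

opaque
  -- The set contains both end points of the arc, so that each of its gaps lies inside the arc or is
  -- the whole outside.
  splice : ∀ {n} .{{_ : NonZero n}} r d → suc (suc r) ≤ d → d ≤ n → ∀ a →
           ∃[ e ] ∣ e ∣ ≡ suc (suc r) × Empty {n} e (a + d) (a + n) × χ e a ≡ true × ∃[ c ] (d ≡ suc c × χ e (a + c) ≡ true)
  splice {n} r d r<d d≤n a = e , card , outside , trans (cong (χ e) (sym (+-identityʳ a)))
        (val 0 (<-≤-trans (s≤s z≤n) 1<n)) ,
                         c , d≡ , trans (val c c<n) g-c
    where
    c : ℕ
    c = d ∸ 1
    d≡ : d ≡ suc c
    d≡ = sym (m+[n∸m]≡n (≤-trans (s≤s z≤n) r<d))
    1<n : 1 < n
    1<n = ≤-trans (≤-trans (s≤s (s≤s z≤n)) r<d) d≤n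
    c<n : c < n
    c<n = ≤-trans (≤-reflexive (sym d≡)) d≤n
    r≤c : suc r ≤ c
    r≤c = ≤-pred (≤-trans r<d (≤-reflexive d≡))
    -- The first `suc r` points of the arc and its last point.
    g : ℕ → Bool
    g i = does (i <? suc r) ∨ does (i ≟ c)
    g-c : g c ≡ true
    g-c = trans (cong (does (c <? suc r) ∨_) (dec-true (c ≟ c) refl)) (Bool.∨-zeroʳ (does (c <? suc r)))
    e-g : ∃[ e ] ∀ i → i < n → χ {n} e (a + i) ≡ g i
    e-g = subset-of {n} a g
    e : Subset n
    e = proj₁ e-g
    val : ∀ i → i < n → χ e (a + i) ≡ g i
    val = proj₂ e-g
    g-low : ∀ i → i < suc r → g i ≡ true
    g-low i i<r = cong (_∨ does (i ≟ c)) (dec-true (i <? suc r) i<r)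
    g-off : ∀ i → suc r ≤ i → i ≢ c → g i ≡ false
    g-off i r≤i i≢c = cong₂ _∨_ (dec-false (i <? suc r) (≤⇒≯ r≤i)) (dec-false (i ≟ c) i≢c)
    outside : Empty e (a + d) (a + n)
    outside y a+d≤y y<a+n with i , refl ← m≤n⇒∃[o]m+o≡n (≤-trans (m≤m+n a d) a+d≤y) =
      trans (val i (+-cancelˡ-< a i n y<a+n)) (g-off i (≤-trans (≤-trans r≤c (n≤1+n c)) c<i)
            (λ i≡c → <-irrefl (sym i≡c) c<i))
      where
      c<i : suc c ≤ i
      c<i = ≤-trans (≤-reflexive (sym d≡)) (+-cancelˡ-≤ a d i a+d≤y)
    card : ∣ e ∣ ≡ suc (suc r)
    card = begin
      ∣ e ∣                                        ≡⟨ ∣∣-arc e a d d≤n outside ⟩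
      ∑ d (λ i → 𝟙 (χ e (a + i)))                  ≡⟨ ∑-cong d (λ i i<d → cong 𝟙 (val i (<-≤-trans i<d d≤n))) ⟩
      ∑ d (𝟙 ∘ g)                                  ≡⟨ cong (λ m → ∑ m (𝟙 ∘ g)) d≡ ⟩
      ∑ (suc c) (𝟙 ∘ g)                            ≡⟨ ∑-snoc c (𝟙 ∘ g) ⟩
      ∑ c (𝟙 ∘ g) + 𝟙 (g c)                        ≡⟨ cong₂ (λ m b → ∑ m (𝟙 ∘ g) + 𝟙 b) (sym (m+[n∸m]≡n r≤c)) g-c ⟩
      ∑ (suc r + (c ∸ suc r)) (𝟙 ∘ g) + 1          ≡⟨ cong (_+ 1) (∑-split (suc r) (c ∸ suc r) (𝟙 ∘ g)) ⟩
      ∑ (suc r) (𝟙 ∘ g) + ∑ (c ∸ suc r) (λ i → 𝟙 (g (suc r + i))) + 1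
        ≡⟨ cong₂ (λ p q → p + q + 1)
             (trans (∑-cong (suc r) (λ i i<r → cong 𝟙 (g-low i i<r))) (trans (∑-const (suc r) 1) (*-identityʳ (suc r))))
             (∑-zero (c ∸ suc r) (λ i i<c-r → cong 𝟙 (g-off (suc r + i) (m≤m+n (suc r) i)
               (<⇒≢ (<-≤-trans (+-monoʳ-< (suc r) i<c-r) (≤-reflexive (m+[n∸m]≡n r≤c))))))) ⟩
      suc r + 0 + 1                                ≡⟨ trans (cong (_+ 1) (+-identityʳ (suc r))) (+-comm (suc r) 1) ⟩
      suc (suc r)                                  ∎
      where open ≡-Reasoning

translate : ∀ x y z {A B} → x ≤ y → x + A ≡ z + B → y + A ≡ (z + (y ∸ x)) + B
translate x y z {A} {B} x≤y eq = begin
  y + A                   ≡⟨ cong (_+ A) (sym (m+[n∸m]≡n x≤y)) ⟩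
  (x + (y ∸ x)) + A       ≡⟨ slide x (y ∸ x) A ⟩
  (x + A) + (y ∸ x)       ≡⟨ cong (_+ (y ∸ x)) eq ⟩
  (z + B) + (y ∸ x)       ≡⟨ slide z B (y ∸ x) ⟩
  (z + (y ∸ x)) + B       ∎
  where
  open ≡-Reasoning
  slide : ∀ p q s → (p + q) + s ≡ (p + s) + q
  slide p q s = solve (p ∷ q ∷ s ∷ [])

module _ {n : ℕ} .{{_ : NonZero n}} where

  opaque
    -- `x` is the last element of `e` before the cut `t` and `y` the first one from `t` on. As `e`
    -- avoids [t, s + n), `y` is not before `s + n`, so the gap encloses the arc that holds `f`.
    sep⇒gap : ∀ {e f} → 0 < ∣ e ∣ → Sep e f → ∃₂ λ x y → Gap {n} e x y × Empty f y (suc x + n)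
    sep⇒gap {e} {f} e≢∅ (s , t , s≤t , t≤s+n , he , hf)
      with i , i<n , ei ← some-element e e≢∅ s =
      found (last-before (χ e) t z<t ei)
      where
      z : ℕ
      z = s + i
      z<s+n : z < s + n
      z<s+n = +-monoʳ-< s i<n
      z<t : z < t
      z<t with z <? t
      ... | yes lt = lt
      ... | no z≮t = ⊥-elim (∉-Empty {n} {e} he ei (≮⇒≥ z≮t) z<s+n)
      t≤z+n : t ≤ z + n
      t≤z+n = ≤-trans t≤s+n (+-monoˡ-≤ n (m≤m+n s i))
      found : (∃[ x ] x < t × χ e x ≡ true × (∀ y → x < y → y < t → χ e y ≡ false)) →
              ∃₂ λ x y → Gap e x y × Empty f y (suc x + n)
      found (x , x<t , ex , below) with y , t≤y , ey , above ← first-from (χ e) t (z + n ∸ t)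
                                          (trans (cong (χ e) (m+[n∸m]≡n t≤z+n)) (trans (χ-periodic₁ e z) ei)) =
        x , y , gap ex ey (<-≤-trans x<t t≤y) (Empty-++ {n} {e} below above) ,
        Empty-⊆ {n} {f} s+n≤y (+-monoˡ-≤ n x<t) (Empty-up {n} {f} hf)
        where
        s+n≤y : s + n ≤ y
        s+n≤y with s + n ≤? y
        ... | yes le = le
        ... | no nle = ⊥-elim (∉-Empty {n} {e} he ey t≤y (≰⇒> nle))

  module MaxNonSepProperties {r : ℕ} {H : CGH n} (sat : MaxNonSep r H) (2≤r : 2 ≤ r) where
    open MaxNonSep sat

    full-disjoint : ∀ {a b c d} → a ≤ b → b ≤ c → c ≤ d → d ≤ a + n → Full H a b → Full H c d → ⊥
    full-disjoint {a} {b} {c} {d} a≤b b≤c c≤d d≤a+n (f , f∈H , hf) (g , g∈H , hg) = nonsep f∈H g∈H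
      (a , b , a≤b , ≤-trans b≤c (≤-trans c≤d d≤a+n) , hf ,
       Empty-down {n} {g} (Empty-⊆ {n} {g} d≤a+n (+-monoˡ-≤ n b≤c) hg))

    edge-meets-full : ∀ {e a b} → e ∈ H → a ≤ b → b ≤ a + n → Full H a b → Empty e a b → ⊥
    edge-meets-full {e} {a} {b} e∈H a≤b b≤a+n (f , f∈H , hf) he = nonsep f∈H e∈H (a , b , a≤b , b≤a+n , hf , he)

    0<r : 0 < r
    0<r = ≤-trans (s≤s z≤n) 2≤r

    opaque
      nonedge-full-gap : ∀ {e} → ∣ e ∣ ≡ r → e ∉ H → ∃₂ λ x y → Gap e x y × Full H (suc x) y
      nonedge-full-gap {e} ∣e∣≡r e∉H with f , f∈H , sep ← maximal ∣e∣≡r e∉H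
        with x , y , g , h ← sep⇒gap {e} {f} (subst (0 <_) (sym ∣e∣≡r) 0<r) sep = x , y , g , f , f∈H , h

    opaque
      full-gap-from : ∀ a {e} → ∣ e ∣ ≡ r → e ∉ H → ∃₂ λ i y → i < n × Gap e (a + i) y × Full H (suc (a + i)) y
      full-gap-from a {e} ∣e∣≡r e∉H with x , y , g , fl ← nonedge-full-gap ∣e∣≡r e∉H
        with i , k , i<n , xx ← into-window {n} a x =
        i , y' , i<n , gap-≈ {n} {e} a k xx yy g , Full-≈ {n} {H} a k (cong suc xx) yy fl
        where
        y' : ℕ
        y' = (a + i) + (y ∸ x)
        yy : y + a * n ≡ y' + k * n
        yy = translate x y (a + i) (<⇒≤ (proper g)) xx

    opaque
      -- The start `a + i` of the full gap of the `splice` set decides: before the last point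
      -- `a + c` the gap lies inside the arc, at `a + c` it is the outside, and beyond there is no
      -- element.
      full-complement : ∀ a d → r ≤ d → d ≤ n → ¬ Full H a (a + d) → Full H (a + d) (a + n)
      full-complement a d r≤d d≤n not-full
        with r' , refl ← m≤n⇒∃[o]m+o≡n 2≤r
        with e , ∣e∣≡r , outside , ea , c , refl , ec ← splice r' d r≤d d≤n a
        with i , y , i<n , g , fl ← full-gap-from a ∣e∣≡r (λ e∈H → not-full (e , e∈H , outside))
        with <-cmp i c
      ... | tri< i<c _ _ = contradiction
              (Full-⊆ {n} {H} (m≤n⇒m≤1+n (m≤m+n a i))
                      (≤-trans (gap-next {n} {e} g (+-monoʳ-< a i<c) ec) (+-monoʳ-≤ a (n≤1+n c))) fl) not-full
      ... | tri≈ _ refl _ = Full-⊆ {n} {H} (≤-reflexive (+-suc a c))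
              (gap-next {n} {e} g (+-monoʳ-< a i<n) (trans (χ-periodic₁ e a) ea)) fl
      ... | tri> _ _ c<i = ⊥-elim (∉-Empty {n} {e} outside (start g) (+-monoʳ-≤ a c<i) (+-monoʳ-< a i<n))

    -- Two full arcs would be disjoint. If neither is full, `full-complement` is applied to
    -- whichever arc has length at least `r`: for `j < r` this is the complement, by `r + r ≤ n`.
    full-or-complement : r + r ≤ n → ∀ a j → j ≤ n → ⟦ Full? H a (a + j) ⟧ + ⟦ Full? H (a + j) (a + n) ⟧ ≡ 1
    full-or-complement 2r≤n a j j≤n with Full? H a (a + j) | Full? H (a + j) (a + n)
    ... | yes p | yes q = ⊥-elim (full-disjoint (m≤m+n a j) ≤-refl (+-monoʳ-≤ a j≤n) ≤-refl p q)
    ... | yes _ | no _  = refl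
    ... | no _  | yes _ = refl
    ... | no ¬p | no ¬q with r ≤? j
    ...   | yes r≤j = contradiction (full-complement a j r≤j j≤n ¬p) ¬q
    ...   | no r≰j  = contradiction (Full-down {n} {H} (subst (λ z → Full H z ((a + j) + n)) a+j+d≡
                        (full-complement (a + j) d r≤d (m∸n≤m n j) (¬q ∘ subst (Full H (a + j)) a+j+d≡)))) ¬p
      where
      d = n ∸ j
      a+j+d≡ : (a + j) + d ≡ a + n
      a+j+d≡ = trans (+-assoc a j d) (cong (a +_) (m+[n∸m]≡n j≤n))
      r≤d : r ≤ d
      r≤d = m+n≤o⇒m≤o∸n r (≤-trans (+-monoʳ-≤ r (<⇒≤ (≰⇒> r≰j))) 2r≤n)

    full-size : ∀ {a d} → d ≤ n → Full H a (a + d) → r ≤ d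
    full-size {a} {d} d≤n (f , f∈H , h) = subst (_≤ d) (size f∈H) (∣∣-arc≤ f a d d≤n h)

-- Counting full arcs of a given length

full-count : ∀ {n} .{{_ : NonZero n}} → CGH n → ℕ → ℕ
full-count {n} H j = ∑ n (λ x → ⟦ Full? H x (x + j) ⟧)

module _ {n : ℕ} .{{_ : NonZero n}} where

  full-periodic : ∀ H j x → ⟦ Full? {n} H (x + n) ((x + n) + j) ⟧ ≡ ⟦ Full? H x (x + j) ⟧
  full-periodic H j x = ⟦⟧-cong (Full? H (x + n) ((x + n) + j)) (Full? H x (x + j))
    (λ p → Full-down {n} {H} (subst (Full H (x + n)) (swap x j) p))
    (λ p → subst (Full H (x + n)) (sym (swap x j)) (Full-up {n} {H} p))
    where
    swap : ∀ x j → (x + n) + j ≡ (x + j) + n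
    swap x j = solve (x ∷ n ∷ j ∷ [])

  full-count-from : ∀ H j a → full-count {n} H j ≡ ∑ n (λ x → ⟦ Full? H (a + x) ((a + x) + j) ⟧)
  full-count-from H j a = sym (∑-shift n (full-periodic H j) a)

  module FullCounts {r : ℕ} {H : CGH n} (sat : MaxNonSep r H) (2≤r : 2 ≤ r) where
    open MaxNonSep sat
    open MaxNonSepProperties sat 2≤r

    opaque
      -- Sum `full-or-complement` over all starts: the complements of the arcs of length `j` are the
      -- arcs of length `n ∸ j`, listed from the start `j`.
      full-count-complement : r + r ≤ n → ∀ j → j ≤ n → full-count H j + full-count H (n ∸ j) ≡ n
      full-count-complement 2r≤n j j≤n = begin
        full-count H j + full-count H (n ∸ j)
          ≡⟨ cong (full-count H j +_) (trans (full-count-from H (n ∸ j) j) (∑-cong n λ x _ → reindex x)) ⟩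
        full-count H j + ∑ n (λ x → ⟦ Full? H (x + j) (x + n) ⟧)
          ≡⟨ sym (∑-+ n (λ x → ⟦ Full? H x (x + j) ⟧) (λ x → ⟦ Full? H (x + j) (x + n) ⟧)) ⟩
        ∑ n (λ x → ⟦ Full? H x (x + j) ⟧ + ⟦ Full? H (x + j) (x + n) ⟧)
          ≡⟨ ∑-cong n (λ x _ → full-or-complement 2r≤n x j j≤n) ⟩
        ∑ n (λ _ → 1)
          ≡⟨ trans (∑-const n 1) (*-identityʳ n) ⟩
        n ∎
        where
        open ≡-Reasoning
        end≡ : ∀ x → (j + x) + (n ∸ j) ≡ x + n
        end≡ x = trans (cong (_+ (n ∸ j)) (+-comm j x)) (trans (+-assoc x j (n ∸ j)) (cong (x +_) (m+[n∸m]≡n j≤n)))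
        reindex : ∀ x → ⟦ Full? H (j + x) ((j + x) + (n ∸ j)) ⟧ ≡ ⟦ Full? H (x + j) (x + n) ⟧
        reindex x = cong₂ (λ a b → ⟦ Full? H a b ⟧) (+-comm j x) (end≡ x)

    full-count-small : ∀ {j} → j ≤ n → j < r → full-count H j ≡ 0
    full-count-small {j} j≤n j<r = ∑-zero n (λ x _ → ⟦⟧-no (Full? H x (x + j)) λ p → <⇒≱ j<r (full-size j≤n p))

    -- Katona's cycle argument: an arc of length j meeting [a, a + j) starts at a + i or ends at a + i for
    -- some i < j, and the two arcs with the same i are disjoint.
    katona-pairs : ∀ {a j} → j + j ≤ n → Full H a (a + j) → full-count H j ≡
      ∑ j (λ i → ⟦ Full? H (a + i) ((a + i) + j) ⟧ + ⟦ Full? H ((a + (n ∸ j)) + i) (((a + (n ∸ j)) + i) + j) ⟧)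
    katona-pairs {a} {j} 2j≤n full with m , refl ← m≤n⇒∃[o]m+o≡n 2j≤n = begin
      full-count H j                                   ≡⟨ full-count-from H j a ⟩
      ∑ (j + j + m) f                                  ≡⟨ cong (λ k → ∑ k f) (rearrange j m) ⟩
      ∑ (j + (m + j)) f                                ≡⟨ ∑-split j (m + j) f ⟩
      ∑ j f + ∑ (m + j) (λ i → f (j + i))              ≡⟨ cong (∑ j f +_) (∑-split m j (λ i → f (j + i))) ⟩
      ∑ j f + (∑ m (λ i → f (j + i)) + ∑ j (λ i → f (j + (m + i))))
                                                       ≡⟨ cong (λ z → ∑ j f + (z + ∑ j (λ i → f (j + (m + i)))))
                                                             (∑-zero m middle) ⟩
      ∑ j f + ∑ j (λ i → f (j + (m + i)))              ≡⟨ cong (∑ j f +_)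
            (∑-cong j λ i _ → cong (λ z → ⟦ Full? H z (z + j) ⟧) (last i)) ⟩
      ∑ j f + ∑ j g                                    ≡⟨ sym (∑-+ j f g) ⟩
      ∑ j (λ i → f i + g i)                            ∎
      where
      open ≡-Reasoning
      f g : ℕ → ℕ
      f i = ⟦ Full? H (a + i) ((a + i) + j) ⟧
      g i = ⟦ Full? H ((a + (j + j + m ∸ j)) + i) (((a + (j + j + m ∸ j)) + i) + j) ⟧
      rearrange : ∀ j m → j + j + m ≡ j + (m + j)
      rearrange j m = solve (j ∷ m ∷ [])
      n∸j : j + j + m ∸ j ≡ j + m
      n∸j = trans (cong (_∸ j) (+-assoc j j m)) (m+n∸m≡n j (j + m))
      last : ∀ i → a + (j + (m + i)) ≡ (a + (j + j + m ∸ j)) + i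
      last i = trans (reassoc a j m i) (cong (λ z → (a + z) + i) (sym n∸j))
        where
        reassoc : ∀ a j m i → a + (j + (m + i)) ≡ (a + (j + m)) + i
        reassoc a j m i = solve (a ∷ j ∷ m ∷ i ∷ [])
      -- These arcs start after the full arc [a, a + j) has ended and end before it begins again.
      middle : ∀ i → i < m → f (j + i) ≡ 0
      middle i i<m = ⟦⟧-no (Full? H (a + (j + i)) _)
        (full-disjoint (m≤m+n a j) (+-monoʳ-≤ a (m≤m+n j i)) (m≤m+n _ j) (bound a j i m i<m) full)
        where
        bound : ∀ a j i m → i < m → (a + (j + i)) + j ≤ a + (j + j + m)
        bound a j i m i<m = by-lin 1 i<m (solve (a ∷ j ∷ i ∷ m ∷ []))

    -- Modulo `n` the second arc ends where the first begins, and `j + j ≤ n` keeps them from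
    -- overlapping on the other side.
    opposite-arcs : ∀ {a j i} → j + j ≤ n → i < j →
      ⟦ Full? H (a + i) ((a + i) + j) ⟧ + ⟦ Full? H ((a + (n ∸ j)) + i) (((a + (n ∸ j)) + i) + j) ⟧ ≤ 1
    opposite-arcs {a} {j} {i} 2j≤n i<j with k , eq ← m≤n⇒∃[o]m+o≡n (≤-trans (m≤m+n j j) 2j≤n) =
      ⟦⟧-exclusive (Full? H (a + i) _) (Full? H _ _)
        (full-disjoint (m≤m+n _ j) apart (m≤m+n _ j) within)
      where
      n∸j≡k : n ∸ j ≡ k
      n∸j≡k = trans (cong (_∸ j) (sym eq)) (m+n∸m≡n j k)
      j≤k : j ≤ k
      j≤k = +-cancelˡ-≤ j j k (≤-trans 2j≤n (≤-reflexive (sym eq)))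
      apart : (a + i) + j ≤ (a + (n ∸ j)) + i
      apart = subst (λ z → (a + i) + j ≤ (a + z) + i) (sym n∸j≡k) (lemma a i j k j≤k)
        where
        lemma : ∀ a i j k → j ≤ k → (a + i) + j ≤ (a + k) + i
        lemma a i j k j≤k = by-lin 0 j≤k (solve (a ∷ i ∷ j ∷ k ∷ []))
      within : ((a + (n ∸ j)) + i) + j ≤ (a + i) + n
      within = subst₂ (λ z w → ((a + z) + i) + j ≤ (a + i) + w) (sym n∸j≡k) eq (≤-reflexive (lemma a i j k))
        where
        lemma : ∀ a i j k → ((a + k) + i) + j ≡ (a + i) + (j + k)
        lemma a i j k = solve (a ∷ i ∷ j ∷ k ∷ [])

    opaque
      full-count-≤ : ∀ {j} → j + j ≤ n → full-count H j ≤ j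
      full-count-≤ {j} 2j≤n with 0 <? full-count H j
      ... | no zero?  = ≤-trans (≮⇒≥ zero?) z≤n
      ... | yes pos with a , _ , fa ← ∑-pos n _ pos = begin
        full-count H j           ≡⟨ katona-pairs 2j≤n (⟦⟧-pos (Full? H a (a + j)) fa) ⟩
        ∑ j (λ i → pairs a i)    ≤⟨ ∑-mono j {pairs a} {λ _ → 1} (λ i i<j → opposite-arcs {a} 2j≤n i<j) ⟩
        ∑ j (λ _ → 1)            ≡⟨ trans (∑-const j 1) (*-identityʳ j) ⟩
        j                        ∎
        where
        open ≤-Reasoning
        pairs : ℕ → ℕ → ℕ
        pairs a i = ⟦ Full? H (a + i) ((a + i) + j) ⟧ + ⟦ Full? H ((a + (n ∸ j)) + i) (((a + (n ∸ j)) + i) + j) ⟧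

-- Copies of M1 are separated pairs

-- `at` is a total function whose values from `k` on mean nothing; this keeps the index arithmetic
-- in ℕ.
record Enum (p : ℕ → Bool) (a b k : ℕ) : Set where
  field
    at     : ℕ → ℕ
    lower  : ∀ {i} → i < k → a ≤ at i
    upper  : ∀ {i} → i < k → at i < b
    member : ∀ {i} → i < k → p (at i) ≡ true
    mono   : ∀ {i j} → i < j → j < k → at i < at j
    onto   : ∀ {y} → a ≤ y → y < b → p y ≡ true → ∃[ i ] i < k × at i ≡ y

enum-cons : ∀ {p a b k} → a < b → Enum p (suc a) b k → Enum p a b (𝟙 (p a) + k)
enum-cons {p} {a} {b} {k} a<b E with p a in pa
... | true = record
  { at = at ; lower = lower ; upper = upper ; member = member ; mono = mono ; onto = onto }
  where
  module E = Enum E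
  at : ℕ → ℕ
  at zero    = a
  at (suc i) = E.at i
  lower : ∀ {i} → i < suc k → a ≤ at i
  lower {zero}  _         = ≤-refl
  lower {suc i} (s≤s i<k) = <⇒≤ (E.lower i<k)
  upper : ∀ {i} → i < suc k → at i < b
  upper {zero}  _         = a<b
  upper {suc i} (s≤s i<k) = E.upper i<k
  member : ∀ {i} → i < suc k → p (at i) ≡ true
  member {zero}  _         = pa
  member {suc i} (s≤s i<k) = E.member i<k
  mono : ∀ {i j} → i < j → j < suc k → at i < at j
  mono {zero}  {suc j} _         (s≤s j<k) = E.lower j<k
  mono {suc i} {suc j} (s≤s i<j) (s≤s j<k) = E.mono i<j j<k
  onto : ∀ {y} → a ≤ y → y < b → p y ≡ true → ∃[ i ] i < suc k × at i ≡ y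
  onto {y} a≤y y<b py with a ≟ y
  ... | yes a≡y = 0 , s≤s z≤n , a≡y
  ... | no a≢y with i , i<k , eq ← E.onto (≤∧≢⇒< a≤y a≢y) y<b py = suc i , s≤s i<k , eq
... | false = record
  { at = E.at ; lower = λ i<k → <⇒≤ (E.lower i<k) ; upper = E.upper ; member = E.member ; mono = E.mono
  ; onto = λ {y} a≤y y<b py → E.onto (≤∧≢⇒< a≤y λ { refl → contradiction (trans (sym pa) py) λ () }) y<b py }
  where module E = Enum E

enumerate : ∀ p d a → Enum p a (a + d) (∑ d (λ i → 𝟙 (p (a + i))))
enumerate p zero a = record
  { at = id ; lower = λ () ; upper = λ () ; member = λ () ; mono = λ _ ()
  ; onto = λ a≤y y<a _ → contradiction a≤y (<⇒≱ (<-≤-trans y<a (≤-reflexive (+-identityʳ a)))) }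
enumerate p (suc d) a = subst₂ (Enum p a) (sym (+-suc a d))
  (cong₂ _+_ (cong (𝟙 ∘ p) (sym (+-identityʳ a))) (∑-cong d (λ i _ → cong (𝟙 ∘ p) (sym (+-suc a i)))))
  (enum-cons (s≤s (m≤m+n a d)) (enumerate p d (suc a)))

∈-tabulate⁻ : ∀ {n} {p : Fin n → Bool} {x} → x Sub.∈ tabulate p → T (p x)
∈-tabulate⁻ {p = p} {x} x∈ = subst T (trans (sym ([]=⇒lookup x∈)) (lookup∘tabulate p x)) _

∈-tabulate⁺ : ∀ {n} {p : Fin n → Bool} {x} → T (p x) → x Sub.∈ tabulate p
∈-tabulate⁺ {p = p} {x} t = lookup⇒[]= x _ (trans (lookup∘tabulate p x) (T⇒≡ t))
  where
  T⇒≡ : ∀ {b} → T b → b ≡ true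
  T⇒≡ {true} _ = refl

Cyc-rotate : ∀ {n} {a b c : Fin n} → Cyc a b c → Cyc b c a
Cyc-rotate (inj₁ (p , q))        = inj₂ (inj₂ (p , q))
Cyc-rotate (inj₂ (inj₁ (p , q))) = inj₁ (p , q)
Cyc-rotate (inj₂ (inj₂ (p , q))) = inj₂ (inj₁ (p , q))

-- For s, y < n, the representative of y modulo n in the window [s, s + n).
opaque
  up : ℕ → ℕ → ℕ → ℕ
  up n s y = if does (s ≤? y) then y else y + n

  up-≥ : ∀ n {s y} → s ≤ y → up n s y ≡ y
  up-≥ n {s} {y} s≤y rewrite dec-true (s ≤? y) s≤y = refl

  up-< : ∀ n {s y} → y < s → up n s y ≡ y + n
  up-< n {s} {y} y<s rewrite dec-false (s ≤? y) (<⇒≱ y<s) = refl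

≤-up : ∀ {n s y} → s < n → s ≤ up n s y
≤-up {n} {s} {y} s<n with s ≤? y
... | yes s≤y = ≤-trans s≤y (≤-reflexive (sym (up-≥ n s≤y)))
... | no s≰y  = ≤-trans (≤-trans (<⇒≤ s<n) (m≤n+m n y)) (≤-reflexive (sym (up-< n (≰⇒> s≰y))))

up<s+n : ∀ {n s y} → y < n → up n s y < s + n
up<s+n {n} {s} {y} y<n with s ≤? y
... | yes s≤y = ≤-<-trans (≤-reflexive (up-≥ n s≤y)) (<-≤-trans y<n (m≤n+m n s))
... | no s≰y  = ≤-<-trans (≤-reflexive (up-< n (≰⇒> s≰y))) (+-monoˡ-< n (≰⇒> s≰y))

module _ {n : ℕ} .{{_ : NonZero n}} where

  up-% : ∀ {s y} → y < n → up n s y % n ≡ y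
  up-% {s} {y} y<n with s ≤? y
  ... | yes s≤y = trans (cong (_% n) (up-≥ n s≤y)) (m<n⇒m%n≡m y<n)
  ... | no s≰y  = trans (cong (_% n) (up-< n (≰⇒> s≰y))) (trans ([m+n]%n≡m%n y n) (m<n⇒m%n≡m y<n))

  up-unique : ∀ {s y} → s < n → s ≤ y → y < s + n → up n s (y % n) ≡ y
  up-unique {s} {y} s<n s≤y y<s+n with y <? n
  ... | yes y<n = trans (cong (up n s) (m<n⇒m%n≡m y<n)) (up-≥ n s≤y)
  ... | no y≮n  = trans (cong (up n s) (trans (cong (_% n) (sym z+n))
        (trans ([m+n]%n≡m%n z n) (m<n⇒m%n≡m (<-trans z<s s<n)))))
                        (trans (up-< n z<s) z+n)
    where
    z = y ∸ n
    z+n : z + n ≡ y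
    z+n = m∸n+n≡m (≮⇒≥ y≮n)
    z<s : z < s
    z<s = +-cancelʳ-< n z s (≤-<-trans (≤-reflexive z+n) y<s+n)

  -- Read from `a`, the cyclic order is the linear order of the representatives.
  cyc⇒up< : ∀ {a b c : Fin n} → Cyc a b c → up n (toℕ a) (toℕ b) < up n (toℕ a) (toℕ c)
  cyc⇒up< (inj₁ (a<b , b<c)) rewrite up-≥ n (<⇒≤ a<b) | up-≥ n (<⇒≤ (<-trans a<b b<c)) = b<c
  cyc⇒up< (inj₂ (inj₁ (b<c , c<a))) rewrite up-< n (<-trans b<c c<a) | up-< n c<a = +-monoˡ-< n b<c
  cyc⇒up< {b = b} {c} (inj₂ (inj₂ (c<a , a<b))) rewrite up-≥ n (<⇒≤ a<b) | up-< n c<a = <-≤-trans (toℕ<n b) (m≤n+m n (toℕ c))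

  up<⇒cyc : ∀ {s} {a b c : Fin n} → up n s (toℕ a) < up n s (toℕ b) → up n s (toℕ b) < up n s (toℕ c) → Cyc a b c
  up<⇒cyc {s} {a} {b} {c} p q with s ≤? toℕ a | s ≤? toℕ b | s ≤? toℕ c
  ... | yes sa | yes sb | yes sc rewrite up-≥ n sa | up-≥ n sb | up-≥ n sc = inj₁ (p , q)
  ... | yes sa | yes sb | no sc  rewrite up-≥ n sa | up-≥ n sb = inj₂ (inj₂ (<-≤-trans (≰⇒> sc) sa , p))
  ... | yes sa | no sb  | no sc  rewrite up-< n (≰⇒> sb) | up-< n (≰⇒> sc) =
    inj₂ (inj₁ (+-cancelʳ-< n _ _ q , <-≤-trans (≰⇒> sc) sa))
  ... | no sa  | no sb  | no sc  rewrite up-< n (≰⇒> sa) | up-< n (≰⇒> sb) | up-< n (≰⇒> sc) =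
    inj₁ (+-cancelʳ-< n _ _ p , +-cancelʳ-< n _ _ q)
  -- Representatives raised by `n` exceed all those that are not, so the remaining cases contradict
  -- the assumed order.
  ... | _      | no sb  | yes sc rewrite up-< n (≰⇒> sb) | up-≥ n sc =
    contradiction (<-trans q (toℕ<n c)) (≤⇒≯ (m≤n+m n (toℕ b)))
  ... | no sa  | yes sb | _      rewrite up-< n (≰⇒> sa) | up-≥ n sb =
    contradiction (<-trans p (toℕ<n b)) (≤⇒≯ (m≤n+m n (toℕ a)))

  ∈⇒χ : ∀ {e : Subset n} {y} → (y mod n) Sub.∈ e → χ e y ≡ true
  ∈⇒χ {e} {y} y∈e = trans (χ-mod e y) ([]=⇒lookup y∈e)

  χ⇒∈ : ∀ {e : Subset n} {y} → χ e y ≡ true → (y mod n) Sub.∈ e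
  χ⇒∈ {e} {y} ey = lookup⇒[]= (y mod n) e (trans (sym (χ-mod e y)) ey)

  up-mod : ∀ {s} (y : Fin n) → up n s (toℕ y) mod n ≡ y
  up-mod y = toℕ-injective (trans (toℕ-mod _) (up-% (toℕ<n y)))

  -- The cycle is cut at the images `s` and `t` of the points 0 and `r`. Cyclic order puts the
  -- images of the points below `r` into [s, t) and the others into [t, s + n).
  contains⇒sep : ∀ {r} {G : CGH n} → 0 < r → Contains (M1 r) G → ∃₂ λ e f → e ∈ G × f ∈ G × Sep e f
  contains⇒sep {r} {G} 0<r (φ , (φ-inj , φ-cyc) , φ-edges)
    with e , e∈G , e-onto ← φ-edges _ (here refl)
       | f , f∈G , f-onto ← φ-edges _ (there (here refl)) =
    e , f , e∈G , f∈G , s , t , ≤-up s<n , <⇒≤ (up<s+n (toℕ<n (φ 𝐫))) , e-empty , f-empty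
    where
    0<2r : 0 < r + r
    0<2r = ≤-trans 0<r (m≤m+n r r)
    r<2r : r < r + r
    r<2r = m<m+n r 0<r
    𝟎 𝐫 : Fin (r + r)
    𝟎 = fromℕ< 0<2r
    𝐫 = fromℕ< r<2r
    s t : ℕ
    s = toℕ (φ 𝟎)
    t = up n s (toℕ (φ 𝐫))
    s<n : s < n
    s<n = toℕ<n (φ 𝟎)
    s<t : s < t
    s<t = ≤∧≢⇒< (≤-up s<n) λ s≡t → <⇒≢ 0<r (trans (sym (toℕ-fromℕ< 0<2r)) (trans (cong toℕ (φ-inj (toℕ-injective
      (trans (sym (m<n⇒m%n≡m s<n)) (trans (cong (_% n) s≡t) (up-% (toℕ<n (φ 𝐫)))))))) (toℕ-fromℕ< r<2r)))
    lifted : ∀ {y x} → s ≤ y → y < s + n → φ x ≡ y mod n → y ≡ up n s (toℕ (φ x))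
    lifted {y} s≤y y<s+n eq = trans (sym (up-unique s<n s≤y y<s+n)) (cong (up n s) (sym (trans (cong toℕ eq) (toℕ-mod y))))
    e-empty : Empty {n} e t (s + n)
    e-empty y t≤y y<s+n with χ e y in ey
    ... | false = refl
    ... | true with x , x∈ , φx ← Equivalence.to (e-onto (y mod n)) (χ⇒∈ ey)
               with y≡ ← lifted {y} {x} (≤-trans (≤-up s<n) t≤y) y<s+n φx
               -- `Cyc` speaks of distinct points only, so the point 0 itself is treated apart.
               with toℕ x ≟ 0
    ... | yes x≡0 = contradiction (<-≤-trans s<t t≤y) (≤⇒≯ (≤-reflexive (trans y≡
                      (trans (cong (λ x → up n s (toℕ (φ x))) (toℕ-injective (trans x≡0 (sym (toℕ-fromℕ< 0<2r)))))
                            (up-≥ n ≤-refl)))))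
    ... | no x≢0  = contradiction (≤-trans t≤y (≤-reflexive y≡)) (<⇒≱ (cyc⇒up< (φ-cyc 𝟎 x 𝐫 (inj₁
                      ( ≤-<-trans (≤-reflexive (toℕ-fromℕ< 0<2r)) (n≢0⇒n>0 x≢0)
                      , <-≤-trans (<ᵇ⇒< _ r (∈-tabulate⁻ x∈)) (≤-reflexive (sym (toℕ-fromℕ< r<2r))))))))
    f-empty : Empty {n} f s t
    f-empty y s≤y y<t with χ f y in fy
    ... | false = refl
    ... | true with x , x∈ , φx ← Equivalence.to (f-onto (y mod n)) (χ⇒∈ fy)
               with y≡ ← lifted {y} {x} s≤y (<-trans y<t (up<s+n (toℕ<n (φ 𝐫)))) φx
               with toℕ x ≟ r
    ... | yes x≡r = contradiction y<t (≤⇒≯ (≤-reflexive (sym (trans y≡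
                      (cong (λ x → up n s (toℕ (φ x))) (toℕ-injective (trans x≡r (sym (toℕ-fromℕ< r<2r)))))))))
    ... | no x≢r  = contradiction (≤-trans (≤-reflexive (cong suc (sym y≡))) y<t) (<⇒≯ (cyc⇒up< (φ-cyc 𝟎 𝐫 x (inj₁
                      ( subst₂ _<_ (sym (toℕ-fromℕ< 0<2r)) (sym (toℕ-fromℕ< r<2r)) 0<r
                      , ≤-<-trans (≤-reflexive (toℕ-fromℕ< r<2r)) (≤∧≢⇒< (≤ᵇ⇒≤ r _ (∈-tabulate⁻ x∈)) (x≢r ∘ sym)))))))

  sep-normal : ∀ {e f} → Sep {n} e f → ∃₂ λ s t → s < n × s ≤ t × t ≤ s + n × Empty e t (s + n) × Empty f s t
  sep-normal {e} {f} (s , t , s≤t , t≤s+n , he , hf) = s₀ , t₀ , m%n<n s n ,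
    +-cancelʳ-≤ (k * n) s₀ t₀ (≤-trans (≤-reflexive (sym s≡)) (≤-trans s≤t (≤-reflexive t≡))) ,
    +-cancelʳ-≤ (k * n) t₀ (s₀ + n) (≤-trans (≤-reflexive (sym t≡)) (≤-trans t≤s+n (≤-reflexive s+n≡))) ,
    Empty-≈ {n} {e} 0 k (trans (+-identityʳ t) t≡) (trans (+-identityʳ (s + n)) s+n≡) he ,
    Empty-≈ {n} {f} 0 k (trans (+-identityʳ s) s≡) (trans (+-identityʳ t) t≡) hf
    where
    k s₀ t₀ : ℕ
    k = s / n
    s₀ = s % n
    t₀ = t ∸ k * n
    s≡ : s ≡ s₀ + k * n
    s≡ = m≡m%n+[m/n]*n s n
    t≡ : t ≡ t₀ + k * n
    t≡ = sym (m∸n+n≡m (≤-trans (≤-trans (m≤n+m (k * n) s₀) (≤-reflexive (sym s≡))) s≤t))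
    s+n≡ : s + n ≡ (s₀ + n) + k * n
    s+n≡ = trans (cong (_+ n) s≡) (sym (turn-comm s₀ k))

  -- The first `r` points go to the elements of `e` in increasing order, the last `r` to those of
  -- `f`. All images increase within one window of length `n`, hence the cyclic order is preserved.
  enums⇒contains : ∀ {r} {G : CGH n} {e f s t} → e ∈ G → f ∈ G → s < n → s ≤ t → t ≤ s + n →
                   Empty e t (s + n) → Empty f s t → Enum (χ e) s t r → Enum (χ f) t (s + n) r → Contains (M1 r) G
  enums⇒contains {r} {G} {e} {f} {s} {t} e∈G f∈G s<n s≤t t≤s+n he hf E F = φ , (φ-inj , φ-cyc) , edges
    where
    module E = Enum E
    module F = Enum F
    Φ : ℕ → ℕ
    Φ i = if does (i <? r) then E.at i else F.at (i ∸ r)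
    Φ-E : ∀ {i} → i < r → Φ i ≡ E.at i
    Φ-E {i} i<r rewrite dec-true (i <? r) i<r = refl
    Φ-F : ∀ {i} → r ≤ i → Φ i ≡ F.at (i ∸ r)
    Φ-F {i} r≤i rewrite dec-false (i <? r) (≤⇒≯ r≤i) = refl
    i-r<r : ∀ {i} → r ≤ i → i < r + r → i ∸ r < r
    i-r<r {i} r≤i i<2r = +-cancelˡ-< r (i ∸ r) r (≤-<-trans (≤-reflexive (m+[n∸m]≡n r≤i)) i<2r)
    Φ-lower : ∀ {i} → i < r + r → s ≤ Φ i
    Φ-lower {i} i<2r with i <? r
    ... | yes i<r = ≤-trans (E.lower i<r) (≤-reflexive (sym (Φ-E i<r)))
    ... | no i≮r  = ≤-trans s≤t (≤-trans (F.lower (i-r<r (≮⇒≥ i≮r) i<2r)) (≤-reflexive (sym (Φ-F (≮⇒≥ i≮r)))))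
    Φ-upper : ∀ {i} → i < r + r → Φ i < s + n
    Φ-upper {i} i<2r with i <? r
    ... | yes i<r = ≤-<-trans (≤-reflexive (Φ-E i<r)) (<-≤-trans (E.upper i<r) t≤s+n)
    ... | no i≮r  = ≤-<-trans (≤-reflexive (Φ-F (≮⇒≥ i≮r))) (F.upper (i-r<r (≮⇒≥ i≮r) i<2r))
    Φ-mono : ∀ {i j} → i < j → j < r + r → Φ i < Φ j
    Φ-mono {i} {j} i<j j<2r with i <? r | j <? r
    ... | yes i<r | yes j<r = subst₂ _<_ (sym (Φ-E i<r)) (sym (Φ-E j<r)) (E.mono i<j j<r)
    ... | yes i<r | no j≮r  = subst₂ _<_ (sym (Φ-E i<r)) (sym (Φ-F (≮⇒≥ j≮r)))
                                (<-≤-trans (E.upper i<r) (F.lower (i-r<r (≮⇒≥ j≮r) j<2r)))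
    ... | no i≮r  | yes j<r = contradiction (<-trans i<j j<r) i≮r
    ... | no i≮r  | no j≮r  = subst₂ _<_ (sym (Φ-F (≮⇒≥ i≮r))) (sym (Φ-F (≮⇒≥ j≮r)))
                                (F.mono (∸-monoˡ-< i<j (≮⇒≥ i≮r)) (i-r<r (≮⇒≥ j≮r) j<2r))
    φ : Fin (r + r) → Fin n
    φ i = Φ (toℕ i) mod n
    up-φ : ∀ i → up n s (toℕ (φ i)) ≡ Φ (toℕ i)
    up-φ i = trans (cong (up n s) (toℕ-mod (Φ (toℕ i)))) (up-unique s<n (Φ-lower (toℕ<n i)) (Φ-upper (toℕ<n i)))
    φ-inj : ∀ {i j} → φ i ≡ φ j → i ≡ j
    φ-inj {i} {j} eq with <-cmp (toℕ i) (toℕ j)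
    ... | tri≈ _ i≡j _ = toℕ-injective i≡j
    ... | tri< i<j _ _ = contradiction (trans (sym (up-φ i)) (trans (cong (up n s ∘ toℕ) eq) (up-φ j)))
          (<⇒≢ (Φ-mono i<j (toℕ<n j)))
    ... | tri> _ _ j<i = contradiction (trans (sym (up-φ i)) (trans (cong (up n s ∘ toℕ) eq) (up-φ j)))
          (>⇒≢ (Φ-mono j<i (toℕ<n i)))
    φ-< : ∀ {i j} → toℕ i < toℕ j → up n s (toℕ (φ i)) < up n s (toℕ (φ j))
    φ-< {i} {j} i<j = subst₂ _<_ (sym (up-φ i)) (sym (up-φ j)) (Φ-mono i<j (toℕ<n j))
    φ-cyc : ∀ i j k → Cyc i j k → Cyc (φ i) (φ j) (φ k)
    φ-cyc i j k (inj₁ (p , q))        = up<⇒cyc (φ-< p) (φ-< q)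
    φ-cyc i j k (inj₂ (inj₁ (p , q))) = Cyc-rotate (Cyc-rotate (up<⇒cyc (φ-< p) (φ-< q)))
    φ-cyc i j k (inj₂ (inj₂ (p , q))) = Cyc-rotate (up<⇒cyc (φ-< p) (φ-< q))
    χ-up : ∀ {h y} → y Sub.∈ h → χ h (up n s (toℕ y)) ≡ true
    χ-up {h} {y} y∈h = ∈⇒χ (subst (Sub._∈ h) (sym (up-mod y)) y∈h)
    ∈-φ : ∀ {h x y} → φ x ≡ y → χ h (Φ (toℕ x)) ≡ true → y Sub.∈ h
    ∈-φ {h} eq hx = subst (Sub._∈ h) eq (χ⇒∈ hx)
    onto : ∀ {y i} → (i<2r : i < r + r) → Φ i ≡ up n s (toℕ y) → φ (fromℕ< i<2r) ≡ y
    onto {y} i<2r eq = trans (cong (λ i → Φ i mod n) (toℕ-fromℕ< i<2r)) (trans (cong (_mod n) eq) (up-mod y))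
    onto-e : ∀ y → y Sub.∈ e → ∃[ x ] x Sub.∈ tabulate {n = r + r} (λ i → toℕ i <ᵇ r) × φ x ≡ y
    onto-e y y∈e with up n s (toℕ y) <? t
    ... | no y≮t = ⊥-elim (∉-Empty {n} {e} he (χ-up y∈e) (≮⇒≥ y≮t) (up<s+n (toℕ<n y)))
    ... | yes y<t with i , i<r , eq ← E.onto (≤-up s<n) y<t (χ-up y∈e) =
      fromℕ< i<2r , ∈-tabulate⁺ (<⇒<ᵇ (≤-<-trans (≤-reflexive (toℕ-fromℕ< i<2r)) i<r)) , onto i<2r (trans (Φ-E i<r) eq)
      where
      i<2r : i < r + r
      i<2r = <-≤-trans i<r (m≤m+n r r)
    onto-f : ∀ y → y Sub.∈ f → ∃[ x ] x Sub.∈ tabulate {n = r + r} (λ i → r ≤ᵇ toℕ i) × φ x ≡ y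
    onto-f y y∈f with up n s (toℕ y) <? t
    ... | yes y<t = ⊥-elim (∉-Empty {n} {f} hf (χ-up y∈f) (≤-up s<n) y<t)
    ... | no y≮t with i , i<r , eq ← F.onto (≮⇒≥ y≮t) (up<s+n (toℕ<n y)) (χ-up y∈f) =
      fromℕ< r+i<2r , ∈-tabulate⁺ (≤⇒≤ᵇ (≤-trans (m≤m+n r i) (≤-reflexive (sym (toℕ-fromℕ< r+i<2r))))) ,
      onto r+i<2r (trans (Φ-F (m≤m+n r i)) (trans (cong F.at (m+n∸m≡n r i)) eq))
      where
      r+i<2r : r + i < r + r
      r+i<2r = +-monoʳ-< r i<r
    edges : ∀ h → h ∈ M1 r → ∃[ g ] g ∈ G × MapsOnto φ h g
    edges _ (here refl) = e , e∈G , λ y → mk⇔ (onto-e y) λ (x , x∈ , eq) →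
      let x<r = <ᵇ⇒< (toℕ x) r (∈-tabulate⁻ x∈) in
      ∈-φ {e} {x} eq (trans (cong (χ e) (Φ-E x<r)) (E.member x<r))
    edges _ (there (here refl)) = f , f∈G , λ y → mk⇔ (onto-f y) λ (x , x∈ , eq) →
      let r≤x = ≤ᵇ⇒≤ r (toℕ x) (∈-tabulate⁻ x∈) in
      ∈-φ {f} {x} eq (trans (cong (χ f) (Φ-F r≤x)) (F.member (i-r<r r≤x (toℕ<n x))))

  sep⇒contains : ∀ {r} {G : CGH n} {e f} → ∣ e ∣ ≡ r → ∣ f ∣ ≡ r → e ∈ G → f ∈ G → Sep e f → Contains (M1 r) G
  sep⇒contains {r} {G} {e} {f} ∣e∣≡r ∣f∣≡r e∈G f∈G sep
    with s , t , s<n , s≤t , t≤s+n , he , hf ← sep-normal {e} {f} sep =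
    enums⇒contains e∈G f∈G s<n s≤t t≤s+n he hf E F
    where
    s+d : s + (t ∸ s) ≡ t
    s+d = m+[n∸m]≡n s≤t
    t+d : t + (s + n ∸ t) ≡ s + n
    t+d = m+[n∸m]≡n t≤s+n
    E : Enum (χ e) s t r
    E = subst₂ (Enum (χ e) s) s+d
          (trans (sym (∣∣-arc e s (t ∸ s) (m≤n+o⇒m∸n≤o t s t≤s+n) (subst (λ z → Empty {n} e z (s + n)) (sym s+d) he))) ∣e∣≡r)
          (enumerate (χ e) (t ∸ s) s)
    F : Enum (χ f) t (s + n) r
    F = subst₂ (Enum (χ f) t) t+d
          (trans (sym (∣∣-arc f t (s + n ∸ t) (m≤n+o⇒m∸n≤o (s + n) t (+-monoˡ-≤ n s≤t))
                   (subst (λ z → Empty {n} f z (t + n)) (sym t+d) (Empty-up {n} {f} hf)))) ∣f∣≡r)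
          (enumerate (χ f) (s + n ∸ t) t)

  saturated⇒maxNonSep : ∀ {r} {H : CGH n} → 0 < r → Saturated r (M1 r) H → MaxNonSep r H
  saturated⇒maxNonSep {r} {H} 0<r ((uniq , sizes) , isFree , sat) = record
    { unique  = uniq
    ; size    = All.lookup sizes
    ; nonsep  = nonsep
    ; maximal = λ {e} ∣e∣≡r e∉H → maximal ∣e∣≡r e∉H (contains⇒sep 0<r (sat e ∣e∣≡r e∉H))
    }
    where
    nonsep : ∀ {e f} → e ∈ H → f ∈ H → ¬ Sep e f
    nonsep e∈H f∈H sep = isFree (sep⇒contains (All.lookup sizes e∈H) (All.lookup sizes f∈H) e∈H f∈H sep)
    maximal : ∀ {e} → ∣ e ∣ ≡ r → e ∉ H → (∃₂ λ g h → g ∈ (e ∷ H) × h ∈ (e ∷ H) × Sep g h) → ∃[ f ] f ∈ H × Sep e f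
    -- The two edges of the copy cannot both be `e`: a set separated from itself is empty.
    maximal {e} ∣e∣≡r _ (_ , _ , here refl , here refl , s , t , s≤t , t≤s+n , h₁ , h₂)
      with i , i<n , ei ← some-element e (subst (0 <_) (sym ∣e∣≡r) 0<r) s
      with () ← trans (sym ei) (Empty-++ {n} {e} h₂ h₁ (s + i) (m≤m+n s i) (+-monoʳ-< s i<n))
    maximal _ _ (g , h , here refl , there h∈H , sep) = h , h∈H , sep
    maximal _ _ (g , h , there g∈H , here refl , sep) = g , g∈H , Sep-sym {n} {g} sep
    maximal _ _ (g , h , there g∈H , there h∈H , sep) = ⊥-elim (nonsep g∈H h∈H sep)

  maxNonSep⇒saturated : ∀ {r} {H : CGH n} → 0 < r → MaxNonSep r H → Saturated r (M1 r) H
  maxNonSep⇒saturated {r} {H} 0<r m =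
    (unique , All.tabulate size) , isFree ,
    λ e ∣e∣≡r e∉H → extend ∣e∣≡r (maximal ∣e∣≡r e∉H)
    where
    open MaxNonSep m
    isFree : Free (M1 r) H
    isFree c with _ , _ , e∈H , f∈H , sep ← contains⇒sep 0<r c = nonsep e∈H f∈H sep
    extend : ∀ {e} → ∣ e ∣ ≡ r → (∃[ f ] f ∈ H × Sep e f) → Contains (M1 r) (e ∷ H)
    extend ∣e∣≡r (f , f∈H , sep) = sep⇒contains ∣e∣≡r (size f∈H) (here refl) (there f∈H) sep

-- Every non-edge has exactly one full gap

fits⁺ : ∀ {n} p (e : Subset n) → (∀ i c → p (toℕ i) ≡ just c → lookup e i ≡ c) → fits p e ≡ true
fits⁺ p Vec.[]      h = refl
fits⁺ p (b Vec.∷ e) h = cong₂ _∧_ (head (p 0) (h Fin.zero)) (fits⁺ (p ∘ suc) e (h ∘ Fin.suc))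
  where
  head : ∀ m → (∀ c → m ≡ just c → b ≡ c) → compat m b ≡ true
  head nothing  h = refl
  head (just c) h = dec-true (b Bool.≟ c) (h c refl)

fits⁻ : ∀ {n} p (e : Subset n) → fits p e ≡ true → ∀ i c → p (toℕ i) ≡ just c → lookup e i ≡ c
fits⁻ p (b Vec.∷ e) t Fin.zero c pc rewrite pc with b Bool.≟ c
... | yes b≡c = b≡c
fits⁻ p (b Vec.∷ e) t (Fin.suc i) c pc = fits⁻ (p ∘ suc) e (∧-right t) i c pc
  where
  ∧-right : ∀ {a b} → a ∧ b ≡ true → b ≡ true
  ∧-right {true} eq = eq

-- Membership relative to the left end of a gap of length `j`: in at 0, out from 1 to `j`, in at
-- `j + 1`, open beyond.
gap-shape : ℕ → ℕ → Maybe Bool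
gap-shape j       zero          = just true
gap-shape zero    (suc zero)    = just true
gap-shape zero    (suc (suc i)) = nothing
gap-shape (suc j) (suc zero)    = just false
gap-shape (suc j) (suc (suc i)) = gap-shape j (suc i)

gap-shape-end : ∀ j → gap-shape j (suc j) ≡ just true
gap-shape-end zero    = refl
gap-shape-end (suc j) = gap-shape-end j

gap-shape-inside : ∀ {i j} → i < j → gap-shape j (suc i) ≡ just false
gap-shape-inside {zero}  {suc j} _         = refl
gap-shape-inside {suc i} {suc j} (s≤s i<j) = gap-shape-inside i<j

gap-shape-outside : ∀ {i j} → j < i → gap-shape j (suc i) ≡ nothing
gap-shape-outside {suc i} {zero}  _         = refl
gap-shape-outside {suc i} {suc j} (s≤s j<i) = gap-shape-outside j<i

gap-shape-forced : ∀ j m → ∑ (j + suc m) (λ i → forced (gap-shape j (suc i))) ≡ 1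
gap-shape-forced zero    m = cong suc (∑-zero m (λ _ _ → refl))
gap-shape-forced (suc j) m = gap-shape-forced j m

gap-shape-free : ∀ j m → ∑ (j + suc m) (λ i → free (gap-shape j (suc i))) ≡ m
gap-shape-free zero    m = trans (∑-const m 1) (*-identityʳ m)
gap-shape-free (suc j) m = gap-shape-free j m

module _ {n : ℕ} .{{_ : NonZero n}} where

  opaque
    Gap? : ∀ (e : Subset n) x y → Dec (Gap e x y)
    Gap? e x y = map′ (λ (p , q , r , s) → gap p q r s) (λ g → start g , end g , proper g , inside g)
      ((χ e x Bool.≟ true) ×-dec (χ e y Bool.≟ true) ×-dec (x <? y) ×-dec Empty? e (suc x) y)

  module GapPattern (x j : ℕ) (j<n-1 : 2 + j ≤ n) where

    pattern-at : ℕ → Maybe Bool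
    pattern-at = unroll {n} x (gap-shape j)

    on-window : ∀ {i} → i < n → pattern-at (x + i) ≡ gap-shape j i
    on-window = unroll-window {n} x (gap-shape j)

    total : ∀ (w : Maybe Bool → ℕ) m → n ≡ 2 + j + m →
            ∑ n (w ∘ pattern-at) ≡ w (just true) + ∑ (j + suc m) (λ i → w (gap-shape j (suc i)))
    total w m n≡ = begin
      ∑ n (w ∘ pattern-at)                    ≡⟨ sym
            (∑-shift n (λ i → cong w (trans (cong pattern-at (cong (i +_) (sym (+-identityʳ n))))
                                                  (unroll-periodic {n} x (gap-shape j) 1 i))) x) ⟩
      ∑ n (λ i → w (pattern-at (x + i)))      ≡⟨ ∑-cong n (λ i i<n → cong w (on-window i<n)) ⟩
      ∑ n (w ∘ gap-shape j)                   ≡⟨ cong (λ k → ∑ k (w ∘ gap-shape j)) (trans n≡ (cong suc (sym (+-suc j m)))) ⟩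
      ∑ (suc (j + suc m)) (w ∘ gap-shape j)   ∎
      where open ≡-Reasoning

    fits⇒gap : ∀ e → fits pattern-at e ≡ true → Gap e x (suc x + j)
    fits⇒gap e t = gap
      (trans (cong (χ e) (sym (+-identityʳ x))) (value (<-≤-trans (s≤s z≤n) j<n-1) refl))
      (trans (cong (χ e) (sym (+-suc x j))) (value j<n-1 (gap-shape-end j)))
      (s≤s (m≤m+n x j))
      λ y x<y y<x+j → within y (m≤n⇒∃[o]m+o≡n x<y) y<x+j
      where
      everywhere : ∀ y c → pattern-at y ≡ just c → χ e y ≡ c
      everywhere y c pc = trans (χ-mod e y) (fits⁻ pattern-at e t (y mod n) c
        (trans (cong pattern-at (toℕ-mod y)) (trans (sym (unroll-periodic {n} x (gap-shape j) (y / n) (y % n)))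
          (trans (cong pattern-at (sym (m≡m%n+[m/n]*n y n))) pc))))
      value : ∀ {i c} → i < n → gap-shape j i ≡ just c → χ e (x + i) ≡ c
      value {i} {c} i<n eq = everywhere (x + i) c (trans (on-window i<n) eq)
      within : ∀ y → (∃[ i ] suc x + i ≡ y) → y < suc x + j → χ e y ≡ false
      within _ (i , refl) y<x+j = trans (cong (χ e) (sym (+-suc x i)))
            (value (≤-trans (s≤s (<⇒≤ (s≤s i<j))) j<n-1) (gap-shape-inside i<j))
        where
        i<j : i < j
        i<j = +-cancelˡ-< (suc x) i j y<x+j

    gap⇒fits : ∀ e → Gap e x (suc x + j) → fits pattern-at e ≡ true
    gap⇒fits e g = fits⁺ pattern-at e λ i c pc → trans (sym (χ-toℕ e i)) (everywhere (toℕ i) c pc)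
      where
      Agrees : ℕ → Set
      Agrees y = ∀ c → pattern-at y ≡ just c → χ e y ≡ c
      window : ∀ i → i < n → Agrees (x + i)
      window i i<n c pc with trans (sym (on-window i<n)) pc
      window zero    i<n .true pc | refl = trans (cong (χ e) (+-identityʳ x)) (start g)
      window (suc i) i<n c     pc | eq with <-cmp i j
      ... | tri< i<j _ _ with refl ← trans (sym eq) (gap-shape-inside i<j) =
        inside g (x + suc i) (≤-trans (s≤s (m≤m+n x i)) (≤-reflexive (sym (+-suc x i))))
              (≤-trans (≤-reflexive (cong suc (+-suc x i))) (s≤s (+-monoʳ-< x i<j)))
      ... | tri≈ _ refl _ with refl ← trans (sym eq) (gap-shape-end j) = trans (cong (χ e) (+-suc x j)) (end g)
      ... | tri> _ _ j<i with () ← trans (sym eq) (gap-shape-outside j<i)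
      everywhere : ∀ y → Agrees y
      everywhere = periodic-everywhere {n} Agrees
        (λ k y h c pc → trans (sym (χ-periodic e k y)) (h c (trans (unroll-periodic {n} x (gap-shape j) k y) pc)))
        (λ k y h c pc → trans (χ-periodic e k y) (h c (trans (sym (unroll-periodic {n} x (gap-shape j) k y)) pc)))
        x window

    gap-indicator : ∀ e → ⟦ Gap? e x (suc x + j) ⟧ ≡ 𝟙 (fits pattern-at e)
    gap-indicator e with fits pattern-at e in eq
    ... | true  = ⟦⟧-yes (Gap? e x (suc x + j)) (fits⇒gap e eq)
    ... | false = ⟦⟧-no (Gap? e x (suc x + j)) λ g → contradiction (trans (sym eq) (gap⇒fits e g)) λ ()

    -- The two ends are forced in and the `j` inner points forced out, so `q` members remain to be
    -- chosen from the other points. This is the w(j) of the overview.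
    count : ∀ q → ∑ˢ n (λ e → ⟦ ∣ e ∣ ≟ 2 + q ⟧ * ⟦ Gap? e x (suc x + j) ⟧) ≡ (n ∸ (2 + j)) C q
    count q = begin
      ∑ˢ n (λ e → ⟦ ∣ e ∣ ≟ 2 + q ⟧ * ⟦ Gap? e x (suc x + j) ⟧)
        ≡⟨ ∑ˢ-cong n (λ e → cong₂ (λ k b → ⟦ ∣ e ∣ ≟ k ⟧ * b) k≡ (gap-indicator e)) ⟩
      ∑ˢ n (λ e → ⟦ ∣ e ∣ ≟ q + ∑ n (forced ∘ pattern-at) ⟧ * 𝟙 (fits pattern-at e))
        ≡⟨ ∑ˢ-fits n pattern-at q ⟩
      ∑ n (free ∘ pattern-at) C q
        ≡⟨ cong (_C q) (trans (total free m n≡) (gap-shape-free j m)) ⟩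
      m C q ∎
      where
      open ≡-Reasoning
      m : ℕ
      m = n ∸ (2 + j)
      n≡ : n ≡ 2 + j + m
      n≡ = sym (m+[n∸m]≡n j<n-1)
      k≡ : 2 + q ≡ q + ∑ n (forced ∘ pattern-at)
      k≡ = trans (+-comm 2 q) (cong (q +_) (sym (trans (total forced m n≡) (cong suc (gap-shape-forced j m)))))

  module EdgeCount {q : ℕ} {H : CGH n} (sat : MaxNonSep (2 + q) H) where
    private
      r : ℕ
      r = 2 + q
    open MaxNonSep sat
    open MaxNonSepProperties sat (s≤s (s≤s z≤n))

    -- Two different gaps of one set are disjoint arcs, so `full-disjoint` applies.
    full-gaps-unordered : ∀ {e x y x' y'} → Gap e x y → Full H (suc x) y → Gap e x' y' → Full H (suc x') y' →
                          x < x' → x' < n → ⊥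
    full-gaps-unordered {e} {x} {y} {x'} {y'} g fl g' fl' x<x' x'<n = full-disjoint
      (proper g) (≤-trans (gap-next {n} {e} g x<x' (start g')) (n≤1+n x')) (proper g')
      (≤-trans (gap-next {n} {e} g' (<-≤-trans x'<n (m≤n+m n x)) (trans (χ-periodic₁ e x) (start g))) (n≤1+n (x + n)))
      fl fl'

    full-gap-start-unique : ∀ {e x y x' y'} → Gap e x y → Full H (suc x) y → Gap e x' y' → Full H (suc x') y' →
                            x < n → x' < n → x ≡ x'
    full-gap-start-unique {x = x} {x' = x'} g fl g' fl' x<n x'<n with <-cmp x x'
    ... | tri≈ _ x≡x' _ = x≡x'
    ... | tri< x<x' _ _ = ⊥-elim (full-gaps-unordered g fl g' fl' x<x' x'<n)
    ... | tri> _ _ x'<x = ⊥-elim (full-gaps-unordered g' fl' g fl x'<x x<n)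

    term : Subset n → ℕ → ℕ → ℕ
    term e x j = ⟦ Full? H (suc x) (suc x + j) ⟧ * (⟦ ∣ e ∣ ≟ r ⟧ * ⟦ Gap? e x (suc x + j) ⟧)

    term-0 : ∀ {e x j} → ¬ (∣ e ∣ ≡ r × Gap e x (suc x + j) × Full H (suc x) (suc x + j)) → term e x j ≡ 0
    term-0 {e} {x} {j} h with Full? H (suc x) (suc x + j) | ∣ e ∣ ≟ r | Gap? e x (suc x + j)
    ... | no _   | _       | _     = refl
    ... | yes _  | no ≢r   | _     = trans (+-identityʳ _) (cong (_* _) (⟦⟧-no (∣ e ∣ ≟ r) ≢r))
    ... | yes _  | yes _   | no _  = trans (+-identityʳ _) (*-zeroʳ ⟦ ∣ e ∣ ≟ r ⟧)
    ... | yes fl | yes ≡r  | yes g = contradiction (≡r , g , fl) h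

    term-1 : ∀ {e x j} → ∣ e ∣ ≡ r → Gap e x (suc x + j) → Full H (suc x) (suc x + j) → term e x j ≡ 1
    term-1 {e} {x} {j} ≡r g fl = cong₂ _*_ (⟦⟧-yes (Full? H (suc x) (suc x + j)) fl)
      (cong₂ _*_ (⟦⟧-yes (∣ e ∣ ≟ r) ≡r) (⟦⟧-yes (Gap? e x (suc x + j)) g))

    -- With `y = x + n` the set would have one element, but its size is at least 2. Hence gap
    -- lengths `j < n ∸ 1` suffice in the count.
    gap-short : ∀ {e x y} → ∣ e ∣ ≡ r → Gap e x y → y < x + n
    gap-short {e} {x} {y} ∣e∣≡r g = ≤∧≢⇒< (gap-≤n {n} {e} g) λ y≡x+n →
      contradiction (subst (_≤ 1) ∣e∣≡r (∣∣-arc≤ e x 1 (>-nonZero⁻¹ n)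
        (subst₂ (Empty {n} e) (+-comm 1 x) y≡x+n (inside g)))) λ { (s≤s ()) }

    gap-terms : Subset n → ℕ
    gap-terms e = ∑ n (λ x → ∑ (n ∸ 1) (term e x))

    gap-terms-0 : ∀ {e} → (∀ x j → j < n ∸ 1 → term e x j ≡ 0) → gap-terms e ≡ 0
    gap-terms-0 h = ∑-zero n λ x _ → ∑-zero (n ∸ 1) (h x)

    gap-terms-1 : ∀ {e x j} → x < n → j < n ∸ 1 → ∣ e ∣ ≡ r → Gap e x (suc x + j) → Full H (suc x) (suc x + j) →
                  gap-terms e ≡ 1
    gap-terms-1 {e} {x} {j} x<n j<n-1 ∣e∣≡r g fl = begin
      gap-terms e             ≡⟨ ∑-single (λ x → ∑ (n ∸ 1) (term e x)) x<n other-start ⟩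
      ∑ (n ∸ 1) (term e x)    ≡⟨ ∑-single (term e x) j<n-1 other-end ⟩
      term e x j              ≡⟨ term-1 ∣e∣≡r g fl ⟩
      1                       ∎
      where
      open ≡-Reasoning
      other-start : ∀ x' → x' < n → x' ≢ x → ∑ (n ∸ 1) (term e x') ≡ 0
      other-start x' x'<n x'≢x = ∑-zero (n ∸ 1) λ j' _ → term-0 {e} {x'} {j'} λ (_ , g' , fl') →
        x'≢x (full-gap-start-unique g' fl' g fl x'<n x<n)
      other-end : ∀ j' → j' < n ∸ 1 → j' ≢ j → term e x j' ≡ 0
      other-end j' _ j'≢j = term-0 {e} {x} {j'} λ (_ , g' , _) → j'≢j (+-cancelˡ-≡ (suc x) j' j
        (≤-antisym (gap-next {n} {e} g' (proper g) (end g)) (gap-next {n} {e} g (proper g') (end g'))))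

    -- An edge has no full gap, since an edge inside that gap would be separated from it; a non-edge
    -- of size `r` has exactly one. So each `r`-set is counted once.
    edge-or-gap : ∀ e → ⟦ e ∈? H ⟧ + gap-terms e ≡ ⟦ ∣ e ∣ ≟ r ⟧
    edge-or-gap e with e ∈? H
    ... | yes e∈H = trans (cong suc (gap-terms-0 {e} λ x j j<n-1 → term-0 {e} {x} {j} λ (_ , g , fl) →
            edge-meets-full e∈H (m≤m+n (suc x) j) (+-monoʳ-≤ (suc x) (≤-trans (<⇒≤ j<n-1) (m∸n≤m n 1))) fl (inside g)))
            (sym (⟦⟧-yes (∣ e ∣ ≟ r) (size e∈H)))
    ... | no e∉H = non-edge (∣ e ∣ ≟ r)
      where
      non-edge : (d : Dec (∣ e ∣ ≡ r)) → gap-terms e ≡ ⟦ ∣ e ∣ ≟ r ⟧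
      non-edge (no ≢r)  = trans (gap-terms-0 {e} λ x j _ → term-0 {e} {x} {j} (≢r ∘ proj₁)) (sym (⟦⟧-no (∣ e ∣ ≟ r) ≢r))
      non-edge (yes ≡r) with x , y , x<n , g , fl ← full-gap-from 0 ≡r e∉H
                        with j , refl ← m≤n⇒∃[o]m+o≡n (proper g) =
        trans (gap-terms-1 {e} {x} {j} x<n (m+n≤o⇒n≤o∸m'
              (+-cancelˡ-≤ x _ _ (≤-trans (≤-reflexive (lemma x j)) (gap-short ≡r g)))) ≡r g fl)
              (sym (⟦⟧-yes (∣ e ∣ ≟ r) ≡r))
        where
        lemma : ∀ x j → x + (2 + j) ≡ suc (suc x + j)
        lemma x j = solve (x ∷ j ∷ [])
        m+n≤o⇒n≤o∸m' : 2 + j ≤ n → suc j ≤ n ∸ 1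
        m+n≤o⇒n≤o∸m' = ∸-monoˡ-≤ 1

    edges+nonedges : length H + ∑ (n ∸ 1) (λ j → full-count H j * ((n ∸ (2 + j)) C q)) ≡ ∑ˢ n (λ e → ⟦ ∣ e ∣ ≟ r ⟧)
    edges+nonedges = begin
      length H + ∑ (n ∸ 1) (λ j → full-count H j * ((n ∸ (2 + j)) C q))
        ≡⟨ cong₂ _+_ (length-∑ˢ unique) (sym gap-total) ⟩
      ∑ˢ n (λ e → ⟦ e ∈? H ⟧) + ∑ˢ n gap-terms
        ≡⟨ sym (∑ˢ-+ n (λ e → ⟦ e ∈? H ⟧) gap-terms) ⟩
      ∑ˢ n (λ e → ⟦ e ∈? H ⟧ + gap-terms e)
        ≡⟨ ∑ˢ-cong n edge-or-gap ⟩
      ∑ˢ n (λ e → ⟦ ∣ e ∣ ≟ r ⟧) ∎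
      where
      open ≡-Reasoning
      F : ℕ → ℕ → ℕ
      F x j = ⟦ Full? H (suc x) (suc x + j) ⟧
      j-ok : ∀ {j} → j < n ∸ 1 → 2 + j ≤ n
      j-ok {j} j<n-1 = ≤-trans (s≤s j<n-1) (≤-reflexive (m+[n∸m]≡n (>-nonZero⁻¹ n)))
      gap-total : ∑ˢ n gap-terms ≡ ∑ (n ∸ 1) (λ j → full-count H j * ((n ∸ (2 + j)) C q))
      gap-total = begin
        ∑ˢ n gap-terms
          ≡⟨ ∑ˢ-∑ n n (λ e x → ∑ (n ∸ 1) (term e x)) ⟩
        ∑ n (λ x → ∑ˢ n (λ e → ∑ (n ∸ 1) (term e x)))
          ≡⟨ ∑-cong n (λ x _ → ∑ˢ-∑ n (n ∸ 1) (λ e → term e x)) ⟩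
        ∑ n (λ x → ∑ (n ∸ 1) (λ j → ∑ˢ n (λ e → term e x j)))
          ≡⟨ ∑-cong n (λ x _ → ∑-cong (n ∸ 1) λ j j<n-1 → trans
               (∑ˢ-*ˡ n (F x j) (λ e → ⟦ ∣ e ∣ ≟ r ⟧ * ⟦ Gap? e x (suc x + j) ⟧))
               (cong (F x j *_) (GapPattern.count x j (j-ok j<n-1) q))) ⟩
        ∑ n (λ x → ∑ (n ∸ 1) (λ j → F x j * ((n ∸ (2 + j)) C q)))
          ≡⟨ ∑-swap n (n ∸ 1) (λ x j → F x j * ((n ∸ (2 + j)) C q)) ⟩
        ∑ (n ∸ 1) (λ j → ∑ n (λ x → F x j * ((n ∸ (2 + j)) C q)))
          -- The gap after `x` begins at `suc x`, so the arcs are listed from the start 1.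
          ≡⟨ ∑-cong (n ∸ 1) (λ j _ → sym (trans (cong (_* ((n ∸ (2 + j)) C q)) (full-count-from H j 1))
               (∑-*ʳ n (λ x → F x j) ((n ∸ (2 + j)) C q)))) ⟩
        ∑ (n ∸ 1) (λ j → full-count H j * ((n ∸ (2 + j)) C q)) ∎

-- The star: all r-sets meeting every arc of length r through a given point

subarc : ∀ {r s t q} → 0 < r → s + r ≤ t → s ≤ q → q < t → ∃[ s' ] s ≤ s' × s' ≤ q × q < s' + r × s' + r ≤ t
subarc {r} {s} {t} {q} 0<r s+r≤t s≤q q<t with q + r ≤? t
... | yes q+r≤t = q , s≤q , ≤-refl , m<m+n q 0<r , q+r≤t
... | no q+r≰t  = t ∸ r , m+n≤o⇒m≤o∸n s s+r≤t , m≤n+o⇒m∸n≤o t r (<⇒≤ (<-≤-trans (≰⇒> q+r≰t) (≤-reflexive (+-comm q r)))) ,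
                  <-≤-trans q<t (≤-reflexive (sym t≡)) , ≤-reflexive t≡
  where
  t≡ : t ∸ r + r ≡ t
  t≡ = m∸n+n≡m (≤-trans (m≤n+m r s) s+r≤t)

module _ {n : ℕ} .{{_ : NonZero n}} where

  -- An arc of length `r` through `q` is avoided. Listing these arcs by a natural start is complete
  -- only if `q` is large enough, so centres are taken to be at least `n` below.
  Miss : ℕ → ℕ → Subset n → Set
  Miss r q e = ∃[ s ] s < suc q × q < s + r × Empty e s (s + r)

  Miss? : ∀ r q e → Dec (Miss r q e)
  Miss? r q e = anyUpTo? (λ s → (q <? s + r) ×-dec Empty? e s (s + r)) (suc q)

  Star : ℕ → ℕ → Subset n → Set
  Star r q e = ¬ Miss r q e

  miss-down : ∀ {r q e} k → r ≤ q → Miss r (q + k * n) e → Miss r q e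
  miss-down {r} {q} {e} k r≤q (s , s≤q+kn , q+kn<s+r , h) =
    s' , s≤s (+-cancelʳ-≤ (k * n) s' q (≤-trans (≤-reflexive s≡) (≤-pred s≤q+kn))) ,
    +-cancelʳ-< (k * n) q (s' + r) (<-≤-trans q+kn<s+r (≤-reflexive s+r≡)) ,
    Empty-≈ {n} {e} 0 k (trans (+-identityʳ s) (sym s≡)) (trans (+-identityʳ (s + r)) s+r≡) h
    where
    kn≤s : k * n ≤ s
    kn≤s = +-cancelʳ-≤ r (k * n) s (≤-trans (+-monoʳ-≤ (k * n) r≤q)
          (≤-trans (≤-reflexive (+-comm (k * n) q)) (<⇒≤ q+kn<s+r)))
    s' : ℕ
    s' = s ∸ k * n
    s≡ : s' + k * n ≡ s
    s≡ = m∸n+n≡m kn≤s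
    slide : ∀ p q s → (p + q) + s ≡ (p + s) + q
    slide p q s = solve (p ∷ q ∷ s ∷ [])
    s+r≡ : s + r ≡ (s' + r) + k * n
    s+r≡ = trans (cong (_+ r) (sym s≡)) (slide s' (k * n) r)

  opaque
    interval : ∀ s {r} → r ≤ n → ∃[ f ] ∣ f ∣ ≡ r × (∀ i → i < r → χ {n} f (s + i) ≡ true) × Empty f (s + r) (s + n)
    interval s {r} r≤n = f , card , inside-f , outside
      where
      f-val : ∃[ f ] ∀ i → i < n → χ {n} f (s + i) ≡ does (i <? r)
      f-val = subset-of {n} s (λ i → does (i <? r))
      f : Subset n
      f = proj₁ f-val
      inside-f : ∀ i → i < r → χ f (s + i) ≡ true
      inside-f i i<r = trans (proj₂ f-val i (<-≤-trans i<r r≤n)) (dec-true (i <? r) i<r)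
      outside : Empty f (s + r) (s + n)
      outside y s+r≤y y<s+n with i , refl ← m≤n⇒∃[o]m+o≡n (≤-trans (m≤m+n s r) s+r≤y) =
        trans (proj₂ f-val i (+-cancelˡ-< s i n y<s+n)) (dec-false (i <? r) (≤⇒≯ (+-cancelˡ-≤ s r i s+r≤y)))
      card : ∣ f ∣ ≡ r
      card = trans (∣∣-arc f s r r≤n outside) (trans (∑-cong r (λ i i<r → cong 𝟙 (inside-f i i<r)))
            (trans (∑-const r 1) (*-identityʳ r)))

    sep-window : ∀ {e f q} → n ≤ q → Sep e f →
                 ∃₂ λ s t → s ≤ q × q < s + n × s ≤ t × t ≤ s + n × Empty {n} e t (s + n) × Empty f s t
    sep-window {e} {f} {q} n≤q (s , t , s≤t , t≤s+n , he , hf)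
      with i , k , i<n , ss ← into-window {n} (suc q ∸ n) s =
      s' , s' + (t ∸ s) ,
      ≤-pred (<-≤-trans (+-monoʳ-< a i<n) (≤-reflexive a+n≡)) ,
      ≤-trans (≤-reflexive (sym a+n≡)) (+-monoˡ-≤ n (m≤m+n a i)) ,
      m≤m+n s' (t ∸ s) , +-monoʳ-≤ s' (m≤n+o⇒m∸n≤o t s t≤s+n) ,
      Empty-≈ {n} {e} a k (translate s t s' s≤t ss)
            (trans (turn-comm s a) (trans (cong (_+ n) ss) (sym (turn-comm s' k)))) he ,
      Empty-≈ {n} {f} a k ss (translate s t s' s≤t ss) hf
      where
      a s' : ℕ
      a = suc q ∸ n
      s' = a + i
      a+n≡ : a + n ≡ suc q
      a+n≡ = m∸n+n≡m (m≤n⇒m≤1+n n≤q)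

  module Stars {r : ℕ} (0<r : 0 < r) (r≤n : r ≤ n) {q : ℕ} (n≤q : n ≤ q) where

    miss-in-arc : ∀ {e s t} → Empty e s t → s + r ≤ t → s ≤ q → q < t → Miss r q e
    miss-in-arc {e} h s+r≤t s≤q q<t with s' , s≤s' , s'≤q , q<s'+r , s'+r≤t ← subarc 0<r s+r≤t s≤q q<t =
      s' , s≤s s'≤q , q<s'+r , Empty-⊆ {n} {e} s≤s' s'+r≤t h

    -- The point `q` lies in one of the two arcs. That arc holds an `r`-set, so its length is at
    -- least `r`, and the other set, avoiding it, misses an arc of length `r` through `q`.
    star-nonsep : ∀ {e f} → ∣ e ∣ ≡ r → ∣ f ∣ ≡ r → Star r q e → Star r q f → ¬ Sep e f
    star-nonsep {e} {f} ∣e∣≡r ∣f∣≡r star-e star-f sep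
      with s , t , s≤q , q<s+n , s≤t , t≤s+n , he , hf ← sep-window {e} {f} n≤q sep
      with q <? t
    ... | yes q<t = star-f (miss-in-arc {f} hf (size-e s≤t t≤s+n he) s≤q q<t)
      where
      size-e : s ≤ t → t ≤ s + n → Empty e t (s + n) → s + r ≤ t
      size-e s≤t t≤s+n he = ≤-trans (+-monoʳ-≤ s (subst (_≤ t ∸ s) ∣e∣≡r (∣∣-arc≤ e s (t ∸ s) (m≤n+o⇒m∸n≤o t s t≤s+n)
        (subst (λ z → Empty {n} e z (s + n)) (sym (m+[n∸m]≡n s≤t)) he)))) (≤-reflexive (m+[n∸m]≡n s≤t))
    ... | no q≮t  = star-e (miss-in-arc {e} he t+r≤s+n (≮⇒≥ q≮t) q<s+n)
      where
      t+r≤s+n : t + r ≤ s + n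
      t+r≤s+n = ≤-trans (+-monoʳ-≤ t (subst (_≤ s + n ∸ t) ∣f∣≡r
            (∣∣-arc≤ f t (s + n ∸ t) (m≤n+o⇒m∸n≤o (s + n) t (+-monoˡ-≤ n s≤t))
        (subst (λ z → Empty {n} f z (t + n)) (sym (m+[n∸m]≡n t≤s+n)) (Empty-up {n} {f} hf)))))
              (≤-reflexive (m+[n∸m]≡n t≤s+n))

    interval-star : ∀ {f s} → (∀ i → i < r → χ f (s + i) ≡ true) → s ≤ q → q < s + r → Star r q f
    interval-star {f} {s} on s≤q q<s+r (s' , s'≤q , q<s'+r , h) = ∉-Empty {n} {f} h
      (trans (cong (χ f) (sym (m+[n∸m]≡n s≤q)))
            (on (q ∸ s) (+-cancelˡ-< s (q ∸ s) r (≤-<-trans (≤-reflexive (m+[n∸m]≡n s≤q)) q<s+r))))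
      (≤-pred s'≤q) q<s'+r

    -- The missed arc is itself an `r`-set through `q`, hence in the star.
    miss⇒sep-star : ∀ {e} → Miss r q e → ∃[ f ] ∣ f ∣ ≡ r × Star r q f × Sep e f
    miss⇒sep-star {e} (s , s≤q , q<s+r , he) with f , ∣f∣≡r , on , off ← interval s r≤n =
      f , ∣f∣≡r , interval-star {f} {s} on (≤-pred s≤q) q<s+r ,
      Sep-sym {n} {f} {e} (s , s + r , m≤m+n s r , +-monoʳ-≤ s r≤n , off , he)

    module _ {H : CGH n} (uniq : Unique H) (∈⇒ : ∀ {e} → e ∈ H → ∣ e ∣ ≡ r × Star r q e)
             (⇒∈ : ∀ {e} → ∣ e ∣ ≡ r → Star r q e → e ∈ H) where

      star-maxNonSep : MaxNonSep r H
      star-maxNonSep = record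
        { unique  = uniq
        ; size    = proj₁ ∘ ∈⇒
        ; nonsep  = λ e∈H f∈H → star-nonsep (proj₁ (∈⇒ e∈H)) (proj₁ (∈⇒ f∈H)) (proj₂ (∈⇒ e∈H)) (proj₂ (∈⇒ f∈H))
        ; maximal = λ {e} ∣e∣≡r e∉H →
            let f , ∣f∣≡r , star-f , sep = miss⇒sep-star {e}
                  (decidable-stable (Miss? r q e) λ star-e → e∉H (⇒∈ ∣e∣≡r star-e))
            in f , ⇒∈ ∣f∣≡r star-f , sep
        }

      star-full : ∀ {s t} → s + r ≤ t → s ≤ q → q < t → Full H s t
      star-full s+r≤t s≤q q<t with s' , s≤s' , s'≤q , q<s'+r , s'+r≤t ← subarc 0<r s+r≤t s≤q q<t
                              with f , ∣f∣≡r , on , off ← interval s' r≤n =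
        f , ⇒∈ ∣f∣≡r (interval-star {f} {s'} on s'≤q q<s'+r) , Empty-⊆ {n} {f} s'+r≤t (+-monoˡ-≤ n s≤s') off

      -- All `j` arcs of length `j` through `q` are full; the first of them starts at `suc q ∸ j`.
      star-full-count : ∀ {j} → r ≤ j → j ≤ n → j ≤ full-count H j
      star-full-count {j} r≤j j≤n = begin
        j                                                        ≡⟨ sym (trans (∑-const j 1) (*-identityʳ j)) ⟩
        ∑ j (λ _ → 1)                                            ≤⟨ ∑-mono j
              (λ i i<j → ≤-reflexive (sym (⟦⟧-yes (Full? H (a + i) ((a + i) + j))
                                                                      (star-full (+-monoʳ-≤ (a + i) r≤j) (below i<j) (above i))))) ⟩
        ∑ j f                                                    ≤⟨ m≤m+n (∑ j f) _ ⟩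
        ∑ j f + ∑ (n ∸ j) (λ i → f (j + i))                      ≡⟨ sym (∑-split j (n ∸ j) f) ⟩
        ∑ (j + (n ∸ j)) f                                        ≡⟨ cong (λ k → ∑ k f) (m+[n∸m]≡n j≤n) ⟩
        ∑ n f                                                    ≡⟨ sym (full-count-from H j a) ⟩
        full-count H j                                           ∎
        where
        open ≤-Reasoning
        a : ℕ
        a = suc q ∸ j
        f : ℕ → ℕ
        f i = ⟦ Full? H (a + i) ((a + i) + j) ⟧
        a+j≡ : a + j ≡ suc q
        a+j≡ = m∸n+n≡m (≤-trans j≤n (m≤n⇒m≤1+n n≤q))
        below : ∀ {i} → i < j → a + i ≤ q
        below {i} i<j = ≤-pred (<-≤-trans (+-monoʳ-< a i<j) (≤-reflexive a+j≡))
        above : ∀ i → q < (a + i) + j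
        above i = ≤-trans (≤-reflexive (sym a+j≡)) (+-monoˡ-≤ j (m≤m+n a i))

  starCGH : ℕ → ℕ → CGH n
  starCGH r q = filter (λ e → (∣ e ∣ ≟ r) ×-dec ¬? (Miss? r q e)) (allSubsets n)

  starCGH-unique : ∀ r q → Unique (starCGH r q)
  starCGH-unique r q = Unique.filter⁺ (λ e → (∣ e ∣ ≟ r) ×-dec ¬? (Miss? r q e)) (allSubsets-unique n)

  ∈-starCGH⁻ : ∀ {r q e} → e ∈ starCGH r q → ∣ e ∣ ≡ r × Star r q e
  ∈-starCGH⁻ {r} {q} e∈ = proj₂ (∈-filter⁻ (λ e → (∣ e ∣ ≟ r) ×-dec ¬? (Miss? r q e)) {xs = allSubsets n} e∈)

  ∈-starCGH⁺ : ∀ {r q e} → ∣ e ∣ ≡ r → Star r q e → e ∈ starCGH r q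
  ∈-starCGH⁺ {r} {q} {e} ∣e∣≡r star = ∈-filter⁺ (λ e → (∣ e ∣ ≟ r) ×-dec ¬? (Miss? r q e)) (∈-allSubsets e) (∣e∣≡r , star)

-- Comparing an arbitrary saturated family with the star

C-mono : ∀ {m n} k → m ≤ n → m C k ≤ n C k
C-mono k m≤n with d , refl ← m≤n⇒∃[o]m+o≡n m≤n = grow _ d
  where
  step : ∀ n k → n C k ≤ suc n C k
  step n zero    = ≤-reflexive (trans (nC0≡1 n) (sym (nC0≡1 (suc n))))
  step n (suc k) = ≤-trans (m≤n+m _ (n C k)) (≤-reflexive (nCk+nC[k+1]≡[n+1]C[k+1] n k))
  grow : ∀ m d → m C k ≤ (m + d) C k
  grow m zero    = ≤-reflexive (cong (_C k) (sym (+-identityʳ m)))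
  grow m (suc d) = ≤-trans (grow m d) (≤-trans (step (m + d) k) (≤-reflexive (cong (_C k) (sym (+-suc m d)))))

count-subsets : ∀ n k → ∑ˢ n (λ e → ⟦ ∣ e ∣ ≟ k ⟧) ≡ n C k
count-subsets n k = begin
  ∑ˢ n (λ e → ⟦ ∣ e ∣ ≟ k ⟧)
    ≡⟨ ∑ˢ-cong n (λ e → trans (cong (λ j → ⟦ ∣ e ∣ ≟ j ⟧)
          (sym (trans (cong (k +_) (∑-zero n λ _ _ → refl)) (+-identityʳ k))))
         (sym (trans (cong (λ b → ⟦ ∣ e ∣ ≟ k + ∑ n (λ _ → 0) ⟧ * 𝟙 b) (fits⁺ (λ _ → nothing) e λ _ _ ()))
               (*-identityʳ _)))) ⟩
  ∑ˢ n (λ e → ⟦ ∣ e ∣ ≟ k + ∑ n (λ _ → 0) ⟧ * 𝟙 (fits (λ _ → nothing) e))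
    ≡⟨ ∑ˢ-fits n (λ _ → nothing) k ⟩
  ∑ n (λ _ → 1) C k
    ≡⟨ cong (_C k) (trans (∑-const n 1) (*-identityʳ n)) ⟩
  n C k ∎
  where open ≡-Reasoning

-- Raising `a` and lowering `b` by the same `d` changes the weighted sum by `d * (w ∸ v)`. This is
-- the excess `c`; for `v < w` it vanishes only with `d`.
weigh : ∀ {a a' b b' v w} → a ≤ a' → a + b ≡ a' + b' → v ≤ w → ∃[ c ] a * w + b * v + c ≡ a' * w + b' * v ×
      (v < w → c ≡ 0 → a ≡ a')
weigh {a} {a'} {b} {b'} {v} {w} a≤a' eq v≤w
  with d , refl ← m≤n⇒∃[o]m+o≡n a≤a' with t , refl ← m≤n⇒∃[o]m+o≡n v≤w
  with refl ← +-cancelˡ-≡ a b (d + b') (trans eq (+-assoc a d b')) =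
  d * t , identity a d b' v t , λ v<w dt≡0 → sym (trans (cong (a +_) (d≡0 v<w (m*n≡0⇒m≡0∨n≡0 d dt≡0))) (+-identityʳ a))
  where
  identity : ∀ a d b v t → a * (v + t) + (d + b) * v + d * t ≡ (a + d) * (v + t) + b * v
  identity a d b v t = solve (a ∷ d ∷ b ∷ v ∷ t ∷ [])
  d≡0 : ∀ {d t} → v < v + t → d ≡ 0 ⊎ t ≡ 0 → d ≡ 0
  d≡0 _   (inj₁ d≡0)  = d≡0
  d≡0 v<v (inj₂ refl) = contradiction v<v (≤⇒≯ (≤-reflexive (+-identityʳ v)))

-- The number of (2 + q)-sets having a given arc of length j as a gap; no set has a gap of length n − 1 or n.
opaque
  weight : ℕ → ℕ → ℕ → ℕ
  weight n q j = if does (j <? n ∸ 1) then (n ∸ (2 + j)) C q else 0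

  weight-< : ∀ {n j} q → j < n ∸ 1 → weight n q j ≡ (n ∸ (2 + j)) C q
  weight-< {n} {j} q j<n-1 rewrite dec-true (j <? n ∸ 1) j<n-1 = refl

  weight-≥ : ∀ {n j} q → n ∸ 1 ≤ j → weight n q j ≡ 0
  weight-≥ {n} {j} q n-1≤j rewrite dec-false (j <? n ∸ 1) (≤⇒≯ n-1≤j) = refl

weight-antitone : ∀ n q {i j} → i ≤ j → weight n q j ≤ weight n q i
weight-antitone n q {i} {j} i≤j with j <? n ∸ 1
... | no j≮n-1  = ≤-trans (≤-reflexive (weight-≥ q (≮⇒≥ j≮n-1))) z≤n
... | yes j<n-1 = subst₂ _≤_ (sym (weight-< q j<n-1)) (sym (weight-< q (≤-<-trans i≤j j<n-1)))
                    (C-mono q (∸-monoʳ-≤ n (+-monoʳ-≤ 2 i≤j)))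

n≡n-1+1 : ∀ n .{{_ : NonZero n}} → n ≡ suc (n ∸ 1)
n≡n-1+1 (suc n) = refl

module _ {n : ℕ} .{{_ : NonZero n}} where

  gap-sum : ℕ → CGH n → ℕ
  gap-sum q H = ∑ (n ∸ 1) (λ j → full-count H j * ((n ∸ (2 + j)) C q))

  paired : ℕ → CGH n → ℕ → ℕ
  paired q H j = full-count H j * weight n q j + full-count H (n ∸ j) * weight n q (n ∸ j)

  -- The lengths `n ∸ 1` and `n` are added with weight 0, which makes the range symmetric under
  -- replacing `j` by `n ∸ j`.
  gap-sum-weight : ∀ q H → gap-sum q H ≡ ∑ (suc n) (λ j → full-count H j * weight n q j)
  gap-sum-weight q H = sym (begin
    ∑ (suc n) f                                              ≡⟨ cong (λ k → ∑ (suc k) f) (n≡n-1+1 n) ⟩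
    ∑ (suc (suc (n ∸ 1))) f                                  ≡⟨ ∑-snoc (suc (n ∸ 1)) f ⟩
    ∑ (suc (n ∸ 1)) f + f (suc (n ∸ 1))                      ≡⟨ cong₂ _+_ (∑-snoc (n ∸ 1) f) (vanish (n≤1+n (n ∸ 1))) ⟩
    ∑ (n ∸ 1) f + f (n ∸ 1) + 0                              ≡⟨ trans (+-identityʳ _)
          (cong (∑ (n ∸ 1) f +_) (vanish ≤-refl)) ⟩
    ∑ (n ∸ 1) f + 0                                          ≡⟨ +-identityʳ _ ⟩
    ∑ (n ∸ 1) f                                              ≡⟨ ∑-cong (n ∸ 1)
          (λ j j<n-1 → cong (full-count H j *_) (weight-< q j<n-1)) ⟩
    gap-sum q H                                              ∎)
    where
    open ≡-Reasoning
    f : ℕ → ℕ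
    f j = full-count H j * weight n q j
    vanish : ∀ {j} → n ∸ 1 ≤ j → f j ≡ 0
    vanish {j} n-1≤j = trans (cong (full-count H j *_) (weight-≥ q n-1≤j)) (*-zeroʳ (full-count H j))

  -- Doubling lets every `j` appear together with `n ∸ j`, without splitting the range in the
  -- middle.
  gap-sum-paired : ∀ q H → gap-sum q H + gap-sum q H ≡ ∑ (suc n) (paired q H)
  gap-sum-paired q H = begin
    gap-sum q H + gap-sum q H                        ≡⟨ cong₂ _+_ (gap-sum-weight q H)
          (trans (gap-sum-weight q H) (∑-rev n f)) ⟩
    ∑ (suc n) f + ∑ (suc n) (λ j → f (n ∸ j))        ≡⟨ sym (∑-+ (suc n) f (λ j → f (n ∸ j))) ⟩
    ∑ (suc n) (paired q H)                           ∎
    where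
    open ≡-Reasoning
    f : ℕ → ℕ
    f j = full-count H j * weight n q j

  paired-sym : ∀ q H {j} → j ≤ n → paired q H (n ∸ j) ≡ paired q H j
  paired-sym q H {j} j≤n = trans
    (cong (λ i → full-count H (n ∸ j) * weight n q (n ∸ j) + full-count H i * weight n q i) (m∸[m∸n]≡n j≤n))
    (+-comm (full-count H (n ∸ j) * weight n q (n ∸ j)) _)

  j≤n∸j : ∀ {j} → j + j ≤ n → j ≤ n ∸ j
  j≤n∸j {j} = m+n≤o⇒m≤o∸n j

  complement-short : ∀ {j} → j ≤ n → n ≤ j + j → (n ∸ j) + (n ∸ j) ≤ n
  complement-short {j} j≤n n≤2j = ≤-trans (+-monoʳ-≤ (n ∸ j) (m≤n+o⇒m∸n≤o n j n≤2j)) (≤-reflexive (m∸n+n≡m j≤n))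

  module Comparison {q : ℕ} {H S : CGH n} (satH : MaxNonSep (2 + q) H) (satS : MaxNonSep (2 + q) S)
                    (2r≤n : (2 + q) + (2 + q) ≤ n) (S-large : ∀ {j} → 2 + q ≤ j → j ≤ n → j ≤ full-count S j) where
    private
      r : ℕ
      r = 2 + q
      2≤r : 2 ≤ r
      2≤r = s≤s (s≤s z≤n)
    module H = FullCounts satH 2≤r
    module S = FullCounts satS 2≤r

    full-count-largest : ∀ {j} → j + j ≤ n → full-count H j ≤ full-count S j
    full-count-largest {j} 2j≤n with j <? r
    ... | yes j<r = ≤-trans (≤-reflexive (H.full-count-small j≤n j<r)) z≤n
      where
      j≤n : j ≤ n
      j≤n = ≤-trans (m≤m+n j j) 2j≤n
    ... | no j≮r  = ≤-trans (H.full-count-≤ 2j≤n) (S-large (≮⇒≥ j≮r) (≤-trans (m≤m+n j j) 2j≤n))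

    paired-weigh : ∀ {j} → j + j ≤ n → ∃[ c ] paired q H j + c ≡ paired q S j ×
                   (weight n q (n ∸ j) < weight n q j → c ≡ 0 → full-count H j ≡ full-count S j)
    paired-weigh {j} 2j≤n = weigh (full-count-largest 2j≤n)
      (trans (H.full-count-complement 2r≤n j j≤n) (sym (S.full-count-complement 2r≤n j j≤n)))
      (weight-antitone n q (j≤n∸j 2j≤n))
      where
      j≤n : j ≤ n
      j≤n = ≤-trans (m≤m+n j j) 2j≤n

    paired-≤ : ∀ j → j ≤ n → paired q H j ≤ paired q S j
    paired-≤ j j≤n with j + j ≤? n
    ... | yes 2j≤n with c , eq , _ ← paired-weigh 2j≤n = ≤-trans (m≤m+n _ c) (≤-reflexive eq)
    -- Past the middle, `n ∸ j` gives the same pair with the smaller length first.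
    ... | no 2j≰n with c , eq , _ ← paired-weigh {n ∸ j} (complement-short j≤n (<⇒≤ (≰⇒> 2j≰n))) =
      subst₂ _≤_ (paired-sym q H j≤n) (paired-sym q S j≤n) (≤-trans (m≤m+n _ c) (≤-reflexive eq))

    private
      Σ-paired-≤ : ∑ (suc n) (paired q H) ≤ ∑ (suc n) (paired q S)
      Σ-paired-≤ = ∑-mono (suc n) (λ j j<1+n → paired-≤ j (≤-pred j<1+n))

      same-total : length H + gap-sum q H ≡ length S + gap-sum q S
      same-total = trans (EdgeCount.edges+nonedges satH) (sym (EdgeCount.edges+nonedges satS))

    gap-sum-≤ : gap-sum q H ≤ gap-sum q S
    gap-sum-≤ with gap-sum q H ≤? gap-sum q S
    ... | yes le = le
    ... | no nle = contradiction (subst₂ _≤_ (sym (gap-sum-paired q H)) (sym (gap-sum-paired q S)) Σ-paired-≤)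
                     (<⇒≱ (+-mono-< (≰⇒> nle) (≰⇒> nle)))

    star-smallest : length S ≤ length H
    star-smallest = +-cancelʳ-≤ (gap-sum q H) (length S) (length H)
      (≤-trans (+-monoʳ-≤ (length S) gap-sum-≤) (≤-reflexive (sym same-total)))

    -- Equal sizes give equal gap sums, so no pair has an excess; `weigh` then fixes the count
    -- wherever the two weights differ.
    smallest⇒full-count : length H ≡ length S → ∀ {j} → j + j ≤ n → weight n q (n ∸ j) < weight n q j →
                          full-count H j ≡ full-count S j
    smallest⇒full-count len {j} 2j≤n strict with c , eq , eq⇒ ← paired-weigh {j} 2j≤n =
      eq⇒ strict (+-cancelˡ-≡ (paired q H j) c 0 (trans eq (trans (sym tight) (sym (+-identityʳ _)))))
      where
      sums≡ : gap-sum q H ≡ gap-sum q S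
      sums≡ = +-cancelˡ-≡ (length H) _ _ (trans same-total (cong (_+ gap-sum q S) (sym len)))
      tight : paired q H j ≡ paired q S j
      tight = ∑-tight (paired q H) (paired q S) (λ i i<1+n → paired-≤ i (≤-pred i<1+n))
        (trans (sym (gap-sum-paired q H)) (trans (cong₂ _+_ sums≡ sums≡) (gap-sum-paired q S)))
        (s≤s (≤-trans (m≤m+n j j) 2j≤n))

-- Graphs (r = 2)

choose-2 : ∀ n → n C 2 + n C 2 + n ≡ n * n
choose-2 zero    = refl
choose-2 (suc n) = begin
  suc n C 2 + suc n C 2 + suc n              ≡⟨ cong (λ b → b + b + suc n)
        (trans (sym (nCk+nC[k+1]≡[n+1]C[k+1] n 1)) (cong (_+ n C 2) (nC1≡n n))) ⟩
  (n + n C 2) + (n + n C 2) + suc n          ≡⟨ regroup n (n C 2) ⟩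
  (n C 2 + n C 2 + n) + (n + suc n)          ≡⟨ cong (_+ (n + suc n)) (choose-2 n) ⟩
  n * n + (n + suc n)                        ≡⟨ square n ⟩
  suc n * suc n                              ∎
  where
  open ≡-Reasoning
  regroup : ∀ n b → (n + b) + (n + b) + suc n ≡ (b + b + n) + (n + suc n)
  regroup n b = solve (n ∷ b ∷ [])
  square : ∀ n → n * n + (n + suc n) ≡ suc n * suc n
  square n = solve (n ∷ [])

module _ {n : ℕ} .{{_ : NonZero n}} where

  -- All weights are 1, so the non-edges number `A`, the sum of u(j) over j ≤ n - 2. From u(j) + u(n
  -- - j) = n, twice the sum over j ≤ n is n(n + 1), and the two largest lengths contribute n each
  -- because u(0) = u(1) = 0. Hence 2A = n(n - 3).
  graph-edge-count : ∀ {H : CGH n} → 4 ≤ n → MaxNonSep 2 H → length H ≡ n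
  graph-edge-count {H} 4≤n sat = halve _ _ (+-cancelʳ-≡ (A + A + n) _ _ (trans (regroup₁ (length H) A n) (trans
      (cong (λ b → b + b + n) edges) (trans (choose-2 n) (sym (trans (regroup₂ A n) (+-cancelʳ-≡ n _ _ doubled)))))))
    where
    open ≡-Reasoning
    open FullCounts sat ≤-refl
    1≤n : 1 ≤ n
    1≤n = ≤-trans (s≤s z≤n) 4≤n
    fc : ℕ → ℕ
    fc = full-count H
    A : ℕ
    A = ∑ (n ∸ 1) fc
    edges : length H + A ≡ n C 2
    edges = trans (cong (length H +_) (∑-cong (n ∸ 1) λ j _ → sym
          (trans (cong (fc j *_) (nC0≡1 (n ∸ (2 + j)))) (*-identityʳ (fc j)))))
                  (trans (EdgeCount.edges+nonedges sat) (count-subsets n 2))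
    fc-complement : ∀ {j} → j ≤ 1 → fc (n ∸ j) ≡ n
    fc-complement {j} j≤1 = trans (cong (_+ fc (n ∸ j)) (sym (full-count-small (≤-trans j≤1 1≤n) (s≤s j≤1))))
                                  (full-count-complement 4≤n j (≤-trans j≤1 1≤n))
    all-arcs : ∑ (suc n) fc ≡ A + n + n
    all-arcs = begin
      ∑ (suc n) fc                                 ≡⟨ ∑-snoc n fc ⟩
      ∑ n fc + fc n                                ≡⟨ cong₂ _+_ (cong (λ k → ∑ k fc) (n≡n-1+1 n)) (fc-complement z≤n) ⟩
      ∑ (suc (n ∸ 1)) fc + n                       ≡⟨ cong (_+ n) (∑-snoc (n ∸ 1) fc) ⟩
      ∑ (n ∸ 1) fc + fc (n ∸ 1) + n                ≡⟨ cong (λ z → A + z + n) (fc-complement ≤-refl) ⟩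
      A + n + n                                    ∎
    doubled : (A + n + n) + (A + n) + n ≡ n * n + n
    doubled = begin
      (A + n + n) + (A + n) + n                    ≡⟨ +-assoc (A + n + n) (A + n) n ⟩
      (A + n + n) + (A + n + n)                    ≡⟨ sym (cong₂ _+_ all-arcs all-arcs) ⟩
      ∑ (suc n) fc + ∑ (suc n) fc                  ≡⟨ cong (∑ (suc n) fc +_) (∑-rev n fc) ⟩
      ∑ (suc n) fc + ∑ (suc n) (λ j → fc (n ∸ j))  ≡⟨ sym (∑-+ (suc n) fc (λ j → fc (n ∸ j))) ⟩
      ∑ (suc n) (λ j → fc j + fc (n ∸ j))          ≡⟨ ∑-cong (suc n)
            (λ j j<1+n → full-count-complement 4≤n j (≤-pred j<1+n)) ⟩
      ∑ (suc n) (λ _ → n)                          ≡⟨ ∑-const (suc n) n ⟩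
      n + n * n                                    ≡⟨ +-comm n (n * n) ⟩
      n * n + n                                    ∎
    regroup₁ : ∀ L A n → (L + L) + (A + A + n) ≡ (L + A) + (L + A) + n
    regroup₁ L A n = solve (L ∷ A ∷ n ∷ [])
    regroup₂ : ∀ A n → (n + n) + (A + A + n) ≡ (A + n + n) + (A + n)
    regroup₂ A n = solve (A ∷ n ∷ [])
    halve : ∀ a b → a + a ≡ b + b → a ≡ b
    halve a b eq with <-cmp a b
    ... | tri≈ _ a≡b _ = a≡b
    ... | tri< a<b _ _ = contradiction eq (<⇒≢ (+-mono-< a<b a<b))
    ... | tri> _ _ b<a = contradiction eq (>⇒≢ (+-mono-< b<a b<a))

-- Extremal families of triples

⟦⟧-or : (p? : Dec P) (q? : Dec Q) → ⟦ p? ⟧ + ⟦ q? ⟧ ≡ 1 → P ⊎ Q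
⟦⟧-or (yes p) _       _ = inj₁ p
⟦⟧-or (no _)  (yes q) _ = inj₂ q

three-units : ∀ {x y z} → x ≤ 1 → y ≤ 1 → z ≤ 1 → x + (y + (z + 0)) ≡ 3 → y ≡ 1 × z ≡ 1
three-units {x} {y} {z} x≤1 y≤1 z≤1 eq =
  ≤-antisym y≤1 (by-lin 0 (+-mono-≤ (≤-reflexive (sym eq)) (+-mono-≤ x≤1 z≤1)) (solve (x ∷ y ∷ z ∷ []))) ,
  ≤-antisym z≤1 (by-lin 0 (+-mono-≤ (≤-reflexive (sym eq)) (+-mono-≤ x≤1 y≤1)) (solve (x ∷ y ∷ z ∷ [])))

module _ {n : ℕ} .{{_ : NonZero n}} where

  Full₃ : CGH n → ℕ → Set
  Full₃ H x = Full H x (x + 3)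

  Full₃-up : ∀ {H x} → Full₃ H x → Full₃ H (x + n)
  Full₃-up {H} {x} fl = subst (Full H (x + n)) (swap x) (Full-up {n} {H} fl)
    where
    swap : ∀ x → (x + 3) + n ≡ (x + n) + 3
    swap x = solve (x ∷ n ∷ [])

  module _ {H : CGH n} (sat : MaxNonSep 3 H) (7≤n : 7 ≤ n) where
    open MaxNonSep sat
    open MaxNonSepProperties sat (s≤s (s≤s z≤n))
    open FullCounts sat (s≤s (s≤s z≤n))

    -- Given a full arc at `a`, the bound 3 is attained only if each of the three Katona pairs
    -- contains a full arc: one starts at a + 1 or a - 2, another at a + 2 or a - 1. Three of the
    -- four choices give consecutive starts.
    three-full-arcs : full-count H 3 ≡ 3 → ∃[ p ] Full₃ H p × Full₃ H (1 + p) × Full₃ H (2 + p)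
    three-full-arcs fc≡3 = from-start (∑-pos n (λ x → ⟦ Full? H x (x + 3) ⟧) (subst (0 <_) (sym fc≡3) (s≤s z≤n)))
      where
      6≤n : 6 ≤ n
      6≤n = ≤-trans (n≤1+n 6) 7≤n
      k : ℕ
      k = n ∸ 3
      n≡k+3 : n ≡ k + 3
      n≡k+3 = sym (m∸n+n≡m (≤-trans (s≤s (s≤s (s≤s z≤n))) 7≤n))
      4≤k : 4 ≤ k
      4≤k = ∸-monoˡ-≤ 3 7≤n
      shift-back : ∀ a k i → (a + k + i) + 3 ≡ (a + i) + (k + 3)
      shift-back a k i = solve (a ∷ k ∷ i ∷ [])
      back₁ : ∀ a → 2 + (a + k + 1) ≡ a + n
      back₁ a = trans (lemma a k) (cong (a +_) (sym n≡k+3))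
        where
        lemma : ∀ a k → 2 + (a + k + 1) ≡ a + (k + 3)
        lemma a k = solve (a ∷ k ∷ [])
      back₂ : ∀ a → 1 + (a + k + 2) ≡ a + n
      back₂ a = trans (lemma a k) (cong (a +_) (sym n≡k+3))
        where
        lemma : ∀ a k → 1 + (a + k + 2) ≡ a + (k + 3)
        lemma a k = solve (a ∷ k ∷ [])
      Far : ℕ → ℕ → Set
      Far a i = Full₃ H (a + k + i)
      combine : ∀ a → Full₃ H a → Full₃ H (a + 1) ⊎ Far a 1 → Full₃ H (a + 2) ⊎ Far a 2 →
                ∃[ p ] Full₃ H p × Full₃ H (1 + p) × Full₃ H (2 + p)
      combine a fa (inj₁ f₁) (inj₁ f₂) = a , fa , subst (Full₃ H) (+-comm a 1) f₁ , subst (Full₃ H) (+-comm a 2) f₂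
      combine a fa (inj₁ f₁) (inj₂ b₂) = a + k + 2 , b₂ , subst (Full₃ H) (sym (back₂ a)) (Full₃-up {H} {a} fa) ,
        subst (Full₃ H) (trans (cong (_+ n) (+-comm a 1)) (cong suc (sym (back₂ a)))) (Full₃-up {H} {a + 1} f₁)
      combine a fa (inj₂ b₁) (inj₂ b₂) = a + k + 1 , b₁ , subst (Full₃ H) (+-suc (a + k) 1) b₂ ,
        subst (Full₃ H) (sym (back₁ a)) (Full₃-up {H} {a} fa)
      -- The arcs of length 3 starting at a - 2 and a + 2 are disjoint because `7 ≤ n`, so they are
      -- not both full.
      combine a fa (inj₂ b₁) (inj₁ f₂) = ⊥-elim (full-disjoint (m≤m+n (a + 2) 3) (apart a k 4≤k) (m≤m+n (a + k + 1) 3)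
        (≤-trans (≤-reflexive (trans (shift-back a k 1) (cong ((a + 1) +_) (sym n≡k+3))))
              (+-monoˡ-≤ n (+-monoʳ-≤ a (s≤s z≤n)))) f₂ b₁)
        where
        apart : ∀ a k → 4 ≤ k → (a + 2) + 3 ≤ a + k + 1
        apart a k 4≤k = by-lin 0 4≤k (solve (a ∷ k ∷ []))
      from-start : (∃[ a ] a < n × 0 < ⟦ Full? H a (a + 3) ⟧) → ∃[ p ] Full₃ H p × Full₃ H (1 + p) × Full₃ H (2 + p)
      from-start (a , _ , pos) = combine a fa
        (⟦⟧-or (Full? H (a + 1) ((a + 1) + 3)) (Full? H (a + k + 1) (a + k + 1 + 3)) (proj₁ units))
        (⟦⟧-or (Full? H (a + 2) ((a + 2) + 3)) (Full? H (a + k + 2) (a + k + 2 + 3)) (proj₂ units))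
        where
        fa : Full₃ H a
        fa = ⟦⟧-pos (Full? H a (a + 3)) pos
        units : _
        units = three-units (opposite-arcs {a} {3} {0} 6≤n (s≤s z≤n)) (opposite-arcs {a} {3} {1} 6≤n (s≤s (s≤s z≤n)))
          (opposite-arcs {a} {3} {2} 6≤n (s≤s (s≤s (s≤s z≤n)))) (trans (sym (katona-pairs 6≤n fa)) fc≡3)

    -- `p`, `1 + p` and `2 + p` are the starts of all arcs of length 3 through `2 + p`.
    three-full-arcs⇒star : ∀ {p} → Full₃ H p → Full₃ H (1 + p) → Full₃ H (2 + p) →
      ∀ {e} → e ∈ H → Star 3 (2 + p) e
    three-full-arcs⇒star {p} f₀ f₁ f₂ {e} e∈H (s , s≤q , q<s+3 , h) = edge-meets-full e∈H (m≤m+n s 3)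
          (+-monoʳ-≤ s (≤-trans (s≤s (s≤s (s≤s z≤n))) 7≤n)) full h
      where
      p≤s : p ≤ s
      p≤s = +-cancelʳ-≤ 3 p s (≤-trans (≤-reflexive (+-comm p 3)) q<s+3)
      full : Full₃ H s
      full with s ≟ p | s ≟ 1 + p
      ... | yes refl | _        = f₀
      ... | no _     | yes refl = f₁
      ... | no s≢p   | no s≢1+p = subst (Full₃ H) (≤-antisym (≤∧≢⇒< (≤∧≢⇒< p≤s (s≢p ∘ sym)) (s≢1+p ∘ sym)) (≤-pred s≤q)) f₂

    full-count-3⇒star : full-count H 3 ≡ 3 → ∃[ q ] n ≤ q × (∀ {e} → e ∈ H → Star 3 q e) ×
          (∀ {e} → ∣ e ∣ ≡ 3 → Star 3 q e → e ∈ H)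
    full-count-3⇒star fc≡3 = centred (three-full-arcs fc≡3)
      where
      centred : (∃[ p ] Full₃ H p × Full₃ H (1 + p) × Full₃ H (2 + p)) →
                ∃[ q ] n ≤ q × (∀ {e} → e ∈ H → Star 3 q e) × (∀ {e} → ∣ e ∣ ≡ 3 → Star 3 q e → e ∈ H)
      -- A triple of the star outside `H` would be separated from an edge, and that edge lies in the
      -- star as well.
      centred (p , f₀ , f₁ , f₂) = q , n≤q , in-star , λ {e} ∣e∣≡3 star-e → decidable-stable (e ∈? H) λ e∉H →
          let f , f∈H , sep = maximal ∣e∣≡3 e∉H
          in Stars.star-nonsep (s≤s z≤n) (≤-trans (s≤s (s≤s (s≤s z≤n))) 7≤n) n≤q ∣e∣≡3 (size f∈H) star-e (in-star f∈H) sep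
        where
        -- One turn is added so that the centre is at least `n`.
        q : ℕ
        q = 2 + (p + n)
        n≤q : n ≤ q
        n≤q = m≤n⇒m≤1+n (m≤n⇒m≤1+n (m≤n+m n p))
        in-star : ∀ {e} → e ∈ H → Star 3 q e
        in-star {e} = three-full-arcs⇒star (Full₃-up {H} {p} f₀) (Full₃-up {H} {1 + p} f₁) (Full₃-up {H} {2 + p} f₂)

-- Rotations

module _ {n : ℕ} .{{_ : NonZero n}} where

  rotate : ℕ → Fin n → Fin n
  rotate c i = (toℕ i + c) mod n

  ≈⇒%≡ : ∀ {x y} k l → x + k * n ≡ y + l * n → x % n ≡ y % n
  ≈⇒%≡ {x} {y} k l eq = trans (sym ([m+kn]%n≡m%n x k n)) (trans (cong (_% n) eq) ([m+kn]%n≡m%n y l n))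

  rotated : ∀ (h : Subset n) d → ∃[ g ] ∀ y → χ g y ≡ χ h (y + d)
  rotated h d = proj₁ g-val , periodic-everywhere {n} (λ y → χ g y ≡ χ h (y + d))
    (λ k y eq → trans (sym (χ-periodic g k y)) (trans eq (shift k y)))
    (λ k y eq → trans (χ-periodic g k y) (trans eq (sym (shift k y))))
    0 (proj₂ g-val)
    where
    g-val : ∃[ g ] ∀ i → i < n → χ {n} g (0 + i) ≡ χ h (i + d)
    g-val = subset-of {n} 0 (λ i → χ h (i + d))
    g : Subset n
    g = proj₁ g-val
    shift : ∀ k y → χ h (y + k * n + d) ≡ χ h (y + d)
    shift k y = trans (cong (χ h) (swap y (k * n) d)) (χ-periodic h k (y + d))
      where
      swap : ∀ y z d → y + z + d ≡ (y + d) + z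
      swap y z d = solve (y ∷ z ∷ d ∷ [])

  rotated-size : ∀ {g h d} → (∀ y → χ {n} g y ≡ χ h (y + d)) → ∣ g ∣ ≡ ∣ h ∣
  rotated-size {g} {h} {d} eq = trans (∣∣-window g 0) (trans
    (∑-cong n (λ i _ → cong 𝟙 (trans (eq i) (cong (χ h) (+-comm i d))))) (sym (∣∣-window h d)))

  rotated-miss : ∀ {g h d r q} → (∀ y → χ {n} g y ≡ χ h (y + d)) → Miss r q g → Miss r (q + d) h
  rotated-miss {g} {h} {d} {r} {q} eq (s , s≤q , q<s+r , empty) =
    s + d , s≤s (+-monoˡ-≤ d (≤-pred s≤q)) , <-≤-trans (+-monoˡ-< d q<s+r) (≤-reflexive (swap s r d)) , λ y s+d≤y y<s+d+r →
      let z+d = m∸n+n≡m (≤-trans (m≤n+m d s) s+d≤y) in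
      trans (cong (χ h) (sym z+d)) (trans (sym (eq (y ∸ d))) (empty (y ∸ d)
        (+-cancelʳ-≤ d s (y ∸ d) (≤-trans s+d≤y (≤-reflexive (sym z+d))))
        (+-cancelʳ-< d (y ∸ d) (s + r) (<-≤-trans (≤-<-trans (≤-reflexive z+d) y<s+d+r) (≤-reflexive (sym (swap s r d)))))))
    where
    swap : ∀ s r d → (s + r) + d ≡ (s + d) + r
    swap s r d = solve (s ∷ r ∷ d ∷ [])

  -- `c` is minus `q` modulo `n`. The number of turns `t` is kept because `miss-down` has to undo
  -- it.
  inverse-rotation : ∀ {q} → n ≤ q → ∃₂ λ c t → c < n × c + q ≡ n + t * n
  inverse-rotation {q} n≤q with c , k , c<n , eq ← into-window {n} q n = c , (q ∸ k) , c<n , c+q≡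
    where
    c+q+kn : (c + q) + k * n ≡ suc q * n
    c+q+kn = trans (cong (_+ k * n) (+-comm c q)) (sym eq)
    k≤q : k ≤ q
    k≤q with k ≤? q
    ... | yes k≤q = k≤q
    ... | no k≰q  = contradiction c+q+kn (>⇒≢ (≤-<-trans (*-monoˡ-≤ n (≰⇒> k≰q))
            (m<n+m (k * n) (≤-trans (>-nonZero⁻¹ n) (≤-trans n≤q (m≤n+m q c))))))
    c+q≡ : c + q ≡ n + (q ∸ k) * n
    c+q≡ = +-cancelʳ-≡ (k * n) _ _ (trans c+q+kn (trans (cong (λ z → n + z * n) (sym (m∸n+n≡m k≤q)))
             (trans (cong (n +_) (*-distribʳ-+ n (q ∸ k) k)) (sym (+-assoc n _ _)))))

  module Rotation {q c t : ℕ} (c<n : c < n) (c+q≡ : c + q ≡ n + t * n) where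

    rotate-up : ∀ x → up n c (toℕ (rotate c x)) ≡ toℕ x + c
    rotate-up x = trans (cong (up n c) (toℕ-mod (toℕ x + c)))
      (up-unique c<n (m≤n+m c (toℕ x)) (<-≤-trans (+-monoˡ-< c (toℕ<n x)) (≤-reflexive (+-comm n c))))

    rotate-injective : ∀ {x y} → rotate c x ≡ rotate c y → x ≡ y
    rotate-injective {x} {y} eq = toℕ-injective (+-cancelʳ-≡ c _ _
      (trans (sym (rotate-up x)) (trans (cong (up n c ∘ toℕ) eq) (rotate-up y))))

    full-turn : ∀ x → (x + c) + q ≡ x + suc t * n
    full-turn x = trans (+-assoc x c q) (cong (x +_) c+q≡)

    rotate-inverse : ∀ y → rotate c ((toℕ y + q) mod n) ≡ y
    rotate-inverse y = trans (mod-cong (≈⇒%≡ {toℕ ((toℕ y + q) mod n) + c} {toℕ y} k (suc t) (begin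
      (toℕ ((toℕ y + q) mod n) + c) + k * n     ≡⟨ cong (λ z → (z + c) + k * n) (toℕ-mod (toℕ y + q)) ⟩
      ((toℕ y + q) % n + c) + k * n             ≡⟨ swap ((toℕ y + q) % n) c (k * n) ⟩
      ((toℕ y + q) % n + k * n) + c             ≡⟨ cong (_+ c) (sym (m≡m%n+[m/n]*n (toℕ y + q) n)) ⟩
      (toℕ y + q) + c                           ≡⟨ swap (toℕ y) q c ⟩
      (toℕ y + c) + q                           ≡⟨ full-turn (toℕ y) ⟩
      toℕ y + suc t * n                         ∎))) (toℕ-mod-toℕ y)
      where
      open ≡-Reasoning
      k : ℕ
      k = (toℕ y + q) / n
      swap : ∀ a b c → (a + b) + c ≡ (a + c) + b
      swap a b c = solve (a ∷ b ∷ c ∷ [])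

    rotate-cyc : ∀ x y z → Cyc x y z → Cyc (rotate c x) (rotate c y) (rotate c z)
    rotate-cyc x y z (inj₁ (p , q))        = up<⇒cyc (up-mono p) (up-mono q)
      where
      up-mono : ∀ {x y} → toℕ x < toℕ y → up n c (toℕ (rotate c x)) < up n c (toℕ (rotate c y))
      up-mono {x} {y} x<y = subst₂ _<_ (sym (rotate-up x)) (sym (rotate-up y)) (+-monoˡ-< c x<y)
    rotate-cyc x y z (inj₂ (inj₁ (p , q))) = Cyc-rotate (Cyc-rotate (rotate-cyc y z x (inj₁ (p , q))))
    rotate-cyc x y z (inj₂ (inj₂ (p , q))) = Cyc-rotate (rotate-cyc z x y (inj₁ (p , q)))

    rotate-onto : ∀ {h g} → (∀ y → χ g y ≡ χ h (y + q)) → MapsOnto (rotate c) h g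
    rotate-onto {h} {g} eq y = mk⇔
      (λ y∈g → (toℕ y + q) mod n , χ⇒∈ (trans (sym (eq (toℕ y))) (trans (χ-toℕ g y) ([]=⇒lookup y∈g))) , rotate-inverse y)
      λ (x , x∈h , ρx≡y) → lookup⇒[]= y g (trans (sym (χ-toℕ g y)) (trans (eq (toℕ y))
        (trans (χ-≈ h ((toℕ x + c) / n) (suc t) (turn x ρx≡y)) (trans (χ-toℕ h x) ([]=⇒lookup x∈h)))))
      where
      turn : ∀ x → rotate c x ≡ y → (toℕ y + q) + (toℕ x + c) / n * n ≡ toℕ x + suc t * n
      turn x refl = begin
        (toℕ (rotate c x) + q) + k * n        ≡⟨ cong (λ z → (z + q) + k * n) (toℕ-mod (toℕ x + c)) ⟩
        ((toℕ x + c) % n + q) + k * n         ≡⟨ swap ((toℕ x + c) % n) q (k * n) ⟩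
        ((toℕ x + c) % n + k * n) + q         ≡⟨ cong (_+ q) (sym (m≡m%n+[m/n]*n (toℕ x + c) n)) ⟩
        (toℕ x + c) + q                       ≡⟨ full-turn (toℕ x) ⟩
        toℕ x + suc t * n                     ∎
        where
        open ≡-Reasoning
        k : ℕ
        k = (toℕ x + c) / n
        swap : ∀ a b c → (a + b) + c ≡ (a + c) + b
        swap a b c = solve (a ∷ b ∷ c ∷ [])

  -- Rotation by `c` carries the centre `q` to a multiple of `n`, the centre of the other star. On
  -- characteristic functions it is translation by `q`, and its inverse is translation by `c`.
  stars-isomorphic : ∀ {r q} {H S : CGH n} → r ≤ n → n ≤ q →
    (∀ {e} → e ∈ H → ∣ e ∣ ≡ r × Star r q e) → (∀ {e} → ∣ e ∣ ≡ r → Star r q e → e ∈ H) →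
    (∀ {e} → e ∈ S → ∣ e ∣ ≡ r × Star r n e) → (∀ {e} → ∣ e ∣ ≡ r → Star r n e → e ∈ S) → Iso H S
  stars-isomorphic {r} {q} {H} {S} r≤n n≤q H⇒ ⇒H S⇒ ⇒S with c , t , c<n , c+q≡ ← inverse-rotation n≤q = iso c t c<n c+q≡
    where
    iso : ∀ c t → c < n → c + q ≡ n + t * n → Iso H S
    iso c t c<n c+q≡ = rotate c , (R.rotate-injective , λ y → (toℕ y + q) mod n , λ { refl → R.rotate-inverse y }) ,
      R.rotate-cyc , forward , backward
      where
      module R = Rotation {q} {c} {t} c<n c+q≡
      forward : ∀ h → h ∈ H → ∃[ g ] g ∈ S × MapsOnto (rotate c) h g
      forward h h∈H with g , eq ← rotated h q = g ,
        ⇒S (trans (rotated-size eq) (proj₁ (H⇒ h∈H)))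
           (λ miss → proj₂ (H⇒ h∈H) (miss-down {e = h} 1 (≤-trans r≤n n≤q)
             (subst (λ z → Miss r z h) (trans (+-comm n q) (cong (q +_) (sym (+-identityʳ n))))
                   (rotated-miss {g} {h} eq miss)))) ,
        R.rotate-onto {h} {g} eq
      backward : ∀ g → g ∈ S → ∃[ h ] h ∈ H × MapsOnto (rotate c) h g
      backward g g∈S with h , eq ← rotated g c = h ,
        ⇒H (trans (rotated-size eq) (proj₁ (S⇒ g∈S)))
           (λ miss → proj₂ (S⇒ g∈S) (miss-down {e = g} t r≤n
             (subst (λ z → Miss r z g) (trans (+-comm q c) c+q≡) (rotated-miss {h} {g} eq miss)))) ,
        R.rotate-onto {h} {g} λ y → sym (trans (eq (y + q))
              (trans (cong (χ g) (trans (swap y q c) (R.full-turn y))) (χ-periodic g (suc t) y)))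
        where
        swap : ∀ a b c → (a + b) + c ≡ (a + c) + b
        swap a b c = solve (a ∷ b ∷ c ∷ [])

-- The family H3

count-fits : ∀ n p {r} k {f} → k + ∑ n (forced ∘ p) ≡ r → ∑ n (free ∘ p) ≡ f →
             ∑ˢ n (λ e → ⟦ ∣ e ∣ ≟ r ⟧ * 𝟙 (fits p e)) ≡ f C k
count-fits n p k refl refl = ∑ˢ-fits n p k

last-two : ℕ → Maybe Bool → Maybe Bool → ℕ → Maybe Bool
last-two zero    y z zero          = nothing
last-two zero    y z (suc zero)    = y
last-two zero    y z (suc (suc zero)) = z
last-two zero    y z _             = nothing
last-two (suc m) y z zero          = nothing
last-two (suc m) y z (suc i)       = last-two m y z i

fits-last-two : ∀ m y z (e : Subset (3 + m)) →
                fits (last-two m y z) e ≡ compat y (memIdx e (1 + m)) ∧ compat z (memIdx e (2 + m))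
fits-last-two zero    y z (_ Vec.∷ Y Vec.∷ Z Vec.∷ Vec.[]) = cong (compat y Y ∧_) (Bool.∧-identityʳ (compat z Z))
fits-last-two (suc m) y z (_ Vec.∷ e)                      = fits-last-two m y z e

∑-last-two : ∀ (w : Maybe Bool → ℕ) m y z → ∑ (3 + m) (w ∘ last-two m y z) ≡ suc m * w nothing + (w y + w z)
∑-last-two w zero    y z = trans (cong (λ t → w nothing + (w y + t)) (+-identityʳ (w z)))
      (cong (_+ (w y + w z)) (sym (+-identityʳ (w nothing))))
∑-last-two w (suc m) y z = trans (cong (w nothing +_) (∑-last-two w m y z)) (sym (+-assoc (w nothing) _ _))

-- Only the five points that decide membership in `H3` are prescribed: v_0, v_1, v_2, v_(n-2),
-- v_(n-1).
corners : ℕ → (a b c y z : Maybe Bool) → ℕ → Maybe Bool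
corners m a b c y z zero                = a
corners m a b c y z (suc zero)          = b
corners m a b c y z (suc (suc zero))    = c
corners m a b c y z (suc (suc (suc i))) = last-two m y z i

-- The overlapping conditions of `H3pred` as four disjoint cases, so that counts add up. The factors
-- `true` stand for open places, which makes the right side match the patterns `corners`.
H3-disjoint-cases : ∀ A B C Y Z → 𝟙 (A ∨ (B ∧ Y) ∨ (B ∧ Z) ∨ (C ∧ Z)) ≡
  𝟙 (compat (just true) A ∧ true) +
  (𝟙 (compat (just false) A ∧ compat (just true) B ∧ true ∧ true ∧ compat (just true) Z) +
  (𝟙 (compat (just false) A ∧ compat (just true) B ∧ true ∧ compat (just true) Y ∧ compat (just false) Z) +
   𝟙 (compat (just false) A ∧ compat (just false) B ∧ compat (just true) C ∧ true ∧ compat (just true) Z)))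
H3-disjoint-cases true  B     C     Y     Z     = refl
H3-disjoint-cases false true  C     true  true  = refl
H3-disjoint-cases false true  C     true  false = refl
H3-disjoint-cases false true  C     false true  = refl
H3-disjoint-cases false true  true  false false = refl
H3-disjoint-cases false true  false false false = refl
H3-disjoint-cases false false true  Y     true  = refl
H3-disjoint-cases false false true  Y     false = refl
H3-disjoint-cases false false false Y     Z     = refl

-- The letters stand for v_0, v_1, v_2, v_(n-2), v_(n-1). The right side says that the triple meets
-- the three arcs of length 3 through v_0, which identifies `H3` as the star centred there.
H3-as-meets : ∀ a b c y z → (a ∨ (b ∧ y) ∨ (b ∧ z) ∨ (c ∧ z)) ≡ (a ∨ y ∨ z) ∧ (a ∨ z ∨ b) ∧ (a ∨ b ∨ c)
H3-as-meets true  b     c     y     z     = refl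
H3-as-meets false true  c     true  true  = refl
H3-as-meets false true  c     true  false = refl
H3-as-meets false true  c     false true  = refl
H3-as-meets false true  true  false false = refl
H3-as-meets false true  false false false = refl
H3-as-meets false false true  true  true  = refl
H3-as-meets false false true  false true  = refl
H3-as-meets false false true  true  false = refl
H3-as-meets false false true  false false = refl
H3-as-meets false false false true  true  = refl
H3-as-meets false false false false true  = refl
H3-as-meets false false false true  false = refl
H3-as-meets false false false false false = refl

∨₃-false : ∀ {a b c} → a ∨ b ∨ c ≡ false → a ≡ false × b ≡ false × c ≡ false
∨₃-false {false} {false} {false} _ = refl , refl , refl

∧₃-false : ∀ {a b c} → a ∧ b ∧ c ≡ false → a ≡ false ⊎ b ≡ false ⊎ c ≡ false
∧₃-false {false}               _ = inj₁ refl
∧₃-false {true} {false}        _ = inj₂ (inj₁ refl)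
∧₃-false {true} {true} {false} _ = inj₂ (inj₂ refl)

∧₃-true : ∀ {a b c} → a ∧ b ∧ c ≡ true → a ≡ true × b ≡ true × c ≡ true
∧₃-true {true} {true} {true} _ = refl , refl , refl

∑ˢ-+₄ : ∀ n (f g h k : Subset n → ℕ) → ∑ˢ n (λ e → f e + (g e + (h e + k e))) ≡ ∑ˢ n f + (∑ˢ n g + (∑ˢ n h + ∑ˢ n k))
∑ˢ-+₄ n f g h k = trans (∑ˢ-+ n f (λ e → g e + (h e + k e))) (cong (∑ˢ n f +_)
  (trans (∑ˢ-+ n g (λ e → h e + k e)) (cong (∑ˢ n g +_) (∑ˢ-+ n h k))))

module TripleStar (m : ℕ) where

  n : ℕ
  n = 6 + m

  module _ (e : Subset n) where

    χ₀ : χ e n ≡ memIdx e 0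
    χ₀ = trans (χ-periodic₁ e 0) (sym (memIdx-χ e (s≤s z≤n)))

    χ₁ : χ e (1 + n) ≡ memIdx e 1
    χ₁ = trans (χ-periodic₁ e 1) (sym (memIdx-χ e (s≤s (s≤s z≤n))))

    χ₂ : χ e (2 + n) ≡ memIdx e 2
    χ₂ = trans (χ-periodic₁ e 2) (sym (memIdx-χ e (s≤s (s≤s (s≤s z≤n)))))

    χ₋₂ : χ e (4 + m) ≡ memIdx e (4 + m)
    χ₋₂ = sym (memIdx-χ e (n≤1+n (5 + m)))

    χ₋₁ : χ e (5 + m) ≡ memIdx e (5 + m)
    χ₋₁ = sym (memIdx-χ e ≤-refl)

    empty₃ : ∀ s → χ e s ≡ false → χ e (1 + s) ≡ false → χ e (2 + s) ≡ false → Empty e s (s + 3)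
    empty₃ s p q r y s≤y y<s+3 with i , refl ← m≤n⇒∃[o]m+o≡n s≤y = at i (+-cancelˡ-< s i 3 y<s+3)
      where
      at : ∀ i → i < 3 → χ e (s + i) ≡ false
      at 0 _ = trans (cong (χ e) (+-identityʳ s)) p
      at 1 _ = trans (cong (χ e) (+-comm s 1)) q
      at 2 _ = trans (cong (χ e) (+-comm s 2)) r
      at (suc (suc (suc _))) (s≤s (s≤s (s≤s ())))

    empty₃⁻ : ∀ {s} → Empty e s (s + 3) → χ e s ≡ false × χ e (1 + s) ≡ false × χ e (2 + s) ≡ false
    empty₃⁻ {s} h = h s ≤-refl (m<m+n s (s≤s z≤n)) , at 1 (s≤s (s≤s z≤n)) , at 2 (s≤s (s≤s (s≤s z≤n)))
      where
      at : ∀ i → i < 3 → χ e (i + s) ≡ false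
      at i i<3 = h (i + s) (m≤n+m s i) (≤-trans (≤-reflexive (+-comm (suc i) s)) (+-monoʳ-≤ s i<3))

    ∨₃-⊥ : ∀ {a b c a' b' c'} → a ∨ b ∨ c ≡ true → a' ≡ a → b' ≡ b → c' ≡ c → a' ≡ false → b' ≡ false → c' ≡ false → ⊥
    ∨₃-⊥ () refl refl refl refl refl refl

    meets₀ meets₁ meets₂ : Bool
    meets₀ = memIdx e 0 ∨ memIdx e (4 + m) ∨ memIdx e (5 + m)
    meets₁ = memIdx e 0 ∨ memIdx e (5 + m) ∨ memIdx e 1
    meets₂ = memIdx e 0 ∨ memIdx e 1 ∨ memIdx e 2

    H3pred-meets : H3pred n e ≡ meets₀ ∧ meets₁ ∧ meets₂
    H3pred-meets = H3-as-meets (memIdx e 0) (memIdx e 1) (memIdx e 2) (memIdx e (4 + m)) (memIdx e (5 + m))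

    H3pred⇒star : H3pred n e ≡ true → Star 3 n e
    H3pred⇒star pred (s , s≤n , n<s+3 , h) = arcs
          (∧₃-true {meets₀} {meets₁} {meets₂} (trans (sym H3pred-meets) pred)) (s ≟ 4 + m) (s ≟ 5 + m) (empty₃⁻ h)
      where
      arcs : meets₀ ≡ true × meets₁ ≡ true × meets₂ ≡ true → Dec (s ≡ 4 + m) → Dec (s ≡ 5 + m) →
             χ e s ≡ false × χ e (1 + s) ≡ false × χ e (2 + s) ≡ false → ⊥
      arcs (p , _ , _) (yes refl) _          (y , z , a) = ∨₃-⊥ p χ₀ χ₋₂ χ₋₁ a y z
      arcs (_ , q , _) (no _)     (yes refl) (z , a , b) = ∨₃-⊥ q χ₀ χ₋₁ χ₁ a z b
      arcs (_ , _ , r) (no s≢4+m) (no s≢5+m) (a , b , c) = ∨₃-⊥ r (trans (cong (χ e) n≡s) χ₀)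
            (trans (cong (χ e ∘ suc) n≡s) χ₁) (trans (cong (χ e ∘ suc ∘ suc) n≡s) χ₂) a b c
        where
        n≡s : s ≡ n
        n≡s = ≤-antisym (≤-pred s≤n) (≤∧≢⇒< (≤∧≢⇒<
              (+-cancelʳ-≤ 3 (4 + m) s (≤-trans (≤-reflexive (+-comm (4 + m) 3)) n<s+3)) (s≢4+m ∘ sym)) (s≢5+m ∘ sym))

    star⇒H3pred : Star 3 n e → H3pred n e ≡ true
    star⇒H3pred star with H3pred n e in eq
    ... | true  = refl
    ... | false = ⊥-elim (star (miss (∧₃-false {meets₀} {meets₁} {meets₂} (trans (sym H3pred-meets) eq))))
      where
      miss : meets₀ ≡ false ⊎ meets₁ ≡ false ⊎ meets₂ ≡ false → Miss 3 n e
      miss (inj₁ f) with a , y , z ← ∨₃-false {memIdx e 0} {memIdx e (4 + m)} {memIdx e (5 + m)} f =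
        4 + m , s≤s (m≤n+m (4 + m) 2) , ≤-reflexive (+-comm 3 (4 + m)) , empty₃ (4 + m) (trans χ₋₂ y)
              (trans χ₋₁ z) (trans χ₀ a)
      miss (inj₂ (inj₁ f)) with a , z , b ← ∨₃-false {memIdx e 0} {memIdx e (5 + m)} {memIdx e 1} f =
        5 + m , s≤s (n≤1+n (5 + m)) , ≤-trans (n≤1+n _) (≤-reflexive (+-comm 3 (5 + m))) , empty₃ (5 + m)
              (trans χ₋₁ z) (trans χ₀ a) (trans χ₁ b)
      miss (inj₂ (inj₂ f)) with a , b , c ← ∨₃-false {memIdx e 0} {memIdx e 1} {memIdx e 2} f =
        n , ≤-refl , m<m+n n (s≤s z≤n) , empty₃ n (trans χ₀ a) (trans χ₁ b) (trans χ₂ c)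

  H3-filter : Subset n → Bool
  H3-filter h = (∣ h ∣ ≡ᵇ 3) ∧ H3pred n h

  ∧-true : ∀ {a b} → a ∧ b ≡ true → a ≡ true × b ≡ true
  ∧-true {true} {true} _ = refl , refl

  ∈-H3⁻ : ∀ {e} → e ∈ H3 n → ∣ e ∣ ≡ 3 × Star 3 n e
  ∈-H3⁻ {e} e∈ with _ , t ← ∈-filter⁻ (T? ∘ H3-filter) {xs = allSubsets n} e∈
               with p , q ← ∧-true (Equivalence.to Bool.T-≡ t) =
    ≡ᵇ⇒≡ ∣ e ∣ 3 (Equivalence.from Bool.T-≡ p) , H3pred⇒star e q

  ∈-H3⁺ : ∀ {e} → ∣ e ∣ ≡ 3 → Star 3 n e → e ∈ H3 n
  ∈-H3⁺ {e} ∣e∣≡3 star = ∈-filter⁺ (T? ∘ H3-filter) (∈-allSubsets e)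
    (Equivalence.from Bool.T-≡ (cong₂ _∧_ (Equivalence.to Bool.T-≡ (≡⇒≡ᵇ ∣ e ∣ 3 ∣e∣≡3)) (star⇒H3pred e star)))

  H3-unique : Unique (H3 n)
  H3-unique = Unique.filter⁺ (T? ∘ H3-filter) (allSubsets-unique n)

  size-and : (a b c y z : Maybe Bool) → Subset n → ℕ
  size-and a b c y z e = ⟦ ∣ e ∣ ≟ 3 ⟧ * 𝟙 (fits (corners m a b c y z) e)

  fits-corners : ∀ a b c y z (e : Subset n) → fits (corners m a b c y z) e ≡
    compat a (memIdx e 0) ∧ compat b (memIdx e 1) ∧ compat c (memIdx e 2) ∧ compat y (memIdx e (4 + m)) ∧ compat z
          (memIdx e (5 + m))
  fits-corners a b c y z (A Vec.∷ B Vec.∷ C Vec.∷ e) =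
    cong (λ t → compat a A ∧ compat b B ∧ compat c C ∧ t) (fits-last-two m y z e)

  f t ∗ : Maybe Bool
  f = just false
  t = just true
  ∗ = nothing

  count-corners : ∀ a b c y z k {g} → k + (forced a + (forced b + (forced c + (suc m * 0 + (forced y + forced z))))) ≡ 3 →
    free a + (free b + (free c + (suc m * 1 + (free y + free z)))) ≡ g → ∑ˢ n (size-and a b c y z) ≡ g C k
  count-corners a b c y z k eq eq' = count-fits n (corners m a b c y z) k
    (trans (cong (λ s → k + (forced a + (forced b + (forced c + s)))) (∑-last-two forced m y z)) eq)
    (trans (cong (λ s → free a + (free b + (free c + s))) (∑-last-two free m y z)) eq')

  membership-cases : ∀ e → ⟦ e ∈? H3 n ⟧ ≡
    size-and t ∗ ∗ ∗ ∗ e + (size-and f t ∗ ∗ t e + (size-and f t ∗ t f e + size-and f f t ∗ t e))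
  membership-cases e = begin
    ⟦ e ∈? H3 n ⟧                                ≡⟨ indicator ⟩
    b * 𝟙 (H3pred n e)                           ≡⟨ cong (b *_) cases ⟩
    b * (p₁ + (p₂ + (p₃ + p₄)))                  ≡⟨ expand b p₁ p₂ p₃ p₄ ⟩
    b * p₁ + (b * p₂ + (b * p₃ + b * p₄))        ∎
    where
    open ≡-Reasoning
    b p₁ p₂ p₃ p₄ : ℕ
    b = ⟦ ∣ e ∣ ≟ 3 ⟧
    p₁ = 𝟙 (fits (corners m t ∗ ∗ ∗ ∗) e)
    p₂ = 𝟙 (fits (corners m f t ∗ ∗ t) e)
    p₃ = 𝟙 (fits (corners m f t ∗ t f) e)
    p₄ = 𝟙 (fits (corners m f f t ∗ t) e)
    expand : ∀ b p q r s → b * (p + (q + (r + s))) ≡ b * p + (b * q + (b * r + b * s))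
    expand b p q r s = solve (b ∷ p ∷ q ∷ r ∷ s ∷ [])
    cases : 𝟙 (H3pred n e) ≡ p₁ + (p₂ + (p₃ + p₄))
    cases = trans (H3-disjoint-cases (memIdx e 0) (memIdx e 1) (memIdx e 2) (memIdx e (4 + m)) (memIdx e (5 + m)))
      (sym (cong₂ _+_ (cong 𝟙 (fits-corners t ∗ ∗ ∗ ∗ e)) (cong₂ _+_ (cong 𝟙 (fits-corners f t ∗ ∗ t e))
        (cong₂ _+_ (cong 𝟙 (fits-corners f t ∗ t f e)) (cong 𝟙 (fits-corners f f t ∗ t e))))))
    indicator : ⟦ e ∈? H3 n ⟧ ≡ b * 𝟙 (H3pred n e)
    indicator with H3pred n e in eq
    ... | true  = trans (⟦⟧-cong (e ∈? H3 n) (∣ e ∣ ≟ 3) (proj₁ ∘ ∈-H3⁻)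
          (λ ∣e∣≡3 → ∈-H3⁺ ∣e∣≡3 (H3pred⇒star e eq))) (sym (*-identityʳ b))
    ... | false = trans (⟦⟧-no (e ∈? H3 n) (λ e∈ → contradiction
          (trans (sym eq) (star⇒H3pred e (proj₂ (∈-H3⁻ e∈)))) λ ())) (sym (*-zeroʳ b))

  length-H3 : length (H3 n) ≡ (n ∸ 1) C 2 + 3 * n ∸ 11
  length-H3 = begin
    length (H3 n)
      ≡⟨ length-∑ˢ H3-unique ⟩
    ∑ˢ n (λ e → ⟦ e ∈? H3 n ⟧)
      ≡⟨ ∑ˢ-cong n membership-cases ⟩
    ∑ˢ n (λ e → c₁ e + (c₂ e + (c₃ e + c₄ e)))
      ≡⟨ ∑ˢ-+₄ n c₁ c₂ c₃ c₄ ⟩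
    ∑ˢ n c₁ + (∑ˢ n c₂ + (∑ˢ n c₃ + ∑ˢ n c₄))
      ≡⟨ cong₂ _+_ (count-corners t ∗ ∗ ∗ ∗ 2 (zeros m) (frees m))
           (cong₂ _+_ (trans (count-corners f t ∗ ∗ t 1 (zeros' m) (frees₂ m)) (nC1≡n (3 + m)))
             (cong₂ _+_ (trans (count-corners f t ∗ t f 1 (zeros' m) (frees₃ m)) (nC1≡n (2 + m)))
                        (trans (count-corners f f t ∗ t 1 (zeros' m) (frees₄ m)) (nC1≡n (2 + m))))) ⟩
    -- The four cases choose 2 of n - 1 points, then 1 of n - 3, of n - 4 and of n - 4; the last
    -- three add up to 3n - 11.
    (5 + m) C 2 + ((3 + m) + ((2 + m) + (2 + m)))
      ≡⟨ sym (m+n∸n≡m ((5 + m) C 2 + ((3 + m) + ((2 + m) + (2 + m)))) 11) ⟩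
    (5 + m) C 2 + ((3 + m) + ((2 + m) + (2 + m))) + 11 ∸ 11
      ≡⟨ cong (_∸ 11) (total ((5 + m) C 2) m) ⟩
    (n ∸ 1) C 2 + 3 * n ∸ 11 ∎
    where
    open ≡-Reasoning
    c₁ c₂ c₃ c₄ : Subset n → ℕ
    c₁ = size-and t ∗ ∗ ∗ ∗
    c₂ = size-and f t ∗ ∗ t
    c₃ = size-and f t ∗ t f
    c₄ = size-and f f t ∗ t
    zeros : ∀ m → 2 + (1 + (suc m * 0 + 0)) ≡ 3
    zeros m = solve (m ∷ [])
    zeros' : ∀ m → 1 + (1 + (suc m * 0 + 1)) ≡ 3
    zeros' m = solve (m ∷ [])
    frees : ∀ m → 1 + (1 + (suc m * 1 + 2)) ≡ 5 + m
    frees m = solve (m ∷ [])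
    frees₂ : ∀ m → 1 + (suc m * 1 + 1) ≡ 3 + m
    frees₂ m = solve (m ∷ [])
    frees₃ : ∀ m → 1 + (suc m * 1 + 0) ≡ 2 + m
    frees₃ m = solve (m ∷ [])
    frees₄ : ∀ m → suc m * 1 + 1 ≡ 2 + m
    frees₄ m = solve (m ∷ [])
    total : ∀ X m → X + ((3 + m) + ((2 + m) + (2 + m))) + 11 ≡ X + 3 * (6 + m)
    total X m = solve (X ∷ m ∷ [])

-- The size of the star

-- Makes C(n - 1, r - 2) the fraction (r - 1) / n of C(n, r - 1), so that the error term of the star
-- is negligible.
absorption : ∀ n k → suc k * (suc n C suc k) ≡ suc n * (n C k)
absorption zero    zero    = refl
absorption zero    (suc k) = *-zeroʳ (suc (suc k))
absorption (suc n) zero    = trans (*-identityˡ _) (trans (nC1≡n (suc (suc n))) (sym (*-identityʳ (suc (suc n)))))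
absorption (suc n) (suc k) = begin
  suc (suc k) * (suc (suc n) C suc (suc k))              ≡⟨ cong (suc (suc k) *_)
        (sym (nCk+nC[k+1]≡[n+1]C[k+1] (suc n) (suc k))) ⟩
  suc (suc k) * (A + suc n C suc (suc k))                ≡⟨ *-distribˡ-+ (suc (suc k)) A _ ⟩
  suc (suc k) * A + suc (suc k) * (suc n C suc (suc k))  ≡⟨ cong (suc (suc k) * A +_) (absorption n (suc k)) ⟩
  (A + suc k * A) + suc n * (n C suc k)                  ≡⟨ cong (λ z → (A + z) + suc n * (n C suc k)) (absorption n k) ⟩
  (A + suc n * (n C k)) + suc n * (n C suc k)            ≡⟨ +-assoc A _ _ ⟩
  A + (suc n * (n C k) + suc n * (n C suc k))            ≡⟨ cong (A +_) (sym (*-distribˡ-+ (suc n) (n C k) _)) ⟩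
  A + suc n * (n C k + n C suc k)                        ≡⟨ cong (λ z → A + suc n * z) (nCk+nC[k+1]≡[n+1]C[k+1] n k) ⟩
  suc (suc n) * A                                        ∎
  where
  open ≡-Reasoning
  A : ℕ
  A = suc n C suc k

-- `wide` asks for 2r + 1 points, so that a gap of length below 2r has two distinct end points
-- within one turn.
module StarSize (n' q : ℕ) (wide : suc ((2 + q) + (2 + q)) ≤ suc n') where
  private
    n r : ℕ
    n = suc n'
    r = 2 + q
    2r≤n : r + r ≤ n
    2r≤n = ≤-trans (n≤1+n _) wide
    r≤n : r ≤ n
    r≤n = ≤-trans (m≤m+n r r) 2r≤n
    star? : ∀ (e : Subset n) → Dec (e ∈ starCGH r n)
    star? e = e ∈? starCGH r n

  contains-0 : ℕ → Maybe Bool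
  contains-0 zero    = just true
  contains-0 (suc _) = nothing

  through-0 : Subset n → ℕ
  through-0 e = ⟦ ∣ e ∣ ≟ r ⟧ * 𝟙 (fits contains-0 e)

  count-through-0 : ∑ˢ n through-0 ≡ n' C (1 + q)
  count-through-0 = count-fits n contains-0 (1 + q)
    (trans (cong (λ z → 1 + q + (1 + z)) (∑-zero n' λ _ _ → refl)) (trans (+-comm (1 + q) 1) refl))
    (trans (∑-const n' 1) (*-identityʳ n'))

  0∈⇒star : ∀ {e} → χ e n ≡ true → Star r n e
  0∈⇒star {e} e0 (s , s≤n , n<s+r , h) = ∉-Empty {n} {e} h e0 (≤-pred s≤n) n<s+r

  fits-0⇒χ : ∀ (e : Subset n) → fits contains-0 e ≡ true → χ e n ≡ true
  fits-0⇒χ e eq = trans (χ-periodic₁ e 0) (trans (χ-toℕ e Fin.zero) (fits⁻ contains-0 e eq Fin.zero true refl))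

  χ⇒fits-0 : ∀ (e : Subset n) → χ e n ≡ true → fits contains-0 e ≡ true
  χ⇒fits-0 e eq = fits⁺ contains-0 e λ { Fin.zero .true refl → trans (sym (χ-toℕ e Fin.zero))
        (trans (sym (χ-periodic₁ e 0)) eq) }

  star-≥ : n' C (1 + q) ≤ length (starCGH {n} r n)
  star-≥ = subst₂ _≤_ count-through-0 (sym (length-∑ˢ (starCGH-unique {n} r n))) (∑ˢ-mono n below)
    where
    below : ∀ e → through-0 e ≤ ⟦ star? e ⟧
    below e with fits contains-0 e in eq
    ... | false = ≤-trans (≤-reflexive (*-zeroʳ ⟦ ∣ e ∣ ≟ r ⟧)) z≤n
    ... | true  = ≤-trans (≤-reflexive (*-identityʳ ⟦ ∣ e ∣ ≟ r ⟧)) (⟦⟧-mono (∣ e ∣ ≟ r) (star? e)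
                    λ ∣e∣≡r → ∈-starCGH⁺ ∣e∣≡r (0∈⇒star {e} (fits-0⇒χ e eq)))

  -- Members of the star avoiding the point 0 are counted by their gap around 0.
  around-0 : Subset n → ℕ → ℕ → ℕ
  around-0 e x j = ⟦ ∣ e ∣ ≟ r ⟧ * ⟦ Gap? e (n ∸ r + x) (suc (n ∸ r + x) + j) ⟧

  -- The point 0 is read as `n`. Its neighbours `u` and `v` in `e` satisfy `n < u + r` and
  -- `v < n + r`, since otherwise `e` would miss the arc of length `r` ending or starting at 0.
  short-gap : ∀ {e} → ∣ e ∣ ≡ r → Star r n e → χ e n ≡ false →
              ∃₂ λ x j → x < r × j < r + r × Gap e (n ∸ r + x) (suc (n ∸ r + x) + j)
  short-gap {e} ∣e∣≡r star e0 = around (some-element e (subst (0 <_) (sym ∣e∣≡r) (s≤s z≤n)) 0)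
    where
    located : ∀ {u v} → u < n → n ≤ v → Gap e u v → n < u + r → v < n + r →
              ∃₂ λ x j → x < r × j < r + r × Gap e (n ∸ r + x) (suc (n ∸ r + x) + j)
    located {u} {v} u<n n≤v g n<u+r v<n+r =
      x , j , +-cancelˡ-< (n ∸ r) x r (≤-trans (≤-reflexive (cong suc u≡)) (≤-trans u<n (≤-reflexive (sym (m∸n+n≡m r≤n))))) ,
      +-cancelˡ-< (suc u) j (r + r) (≤-<-trans (≤-reflexive v≡) (<-trans v<n+r (≤-trans (+-monoˡ-≤ r n<u+r)
        (≤-trans (≤-reflexive (+-assoc u r r)) (n≤1+n _))))) ,
      subst₂ (Gap e) (sym u≡) (trans (sym v≡) (cong (λ z → suc z + j) (sym u≡))) g
      where
      x j : ℕ
      x = u ∸ (n ∸ r)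
      j = v ∸ suc u
      u≡ : n ∸ r + x ≡ u
      u≡ = m+[n∸m]≡n (m≤n+o⇒m∸n≤o n r (≤-trans (<⇒≤ n<u+r) (≤-reflexive (+-comm u r))))
      v≡ : suc u + j ≡ v
      v≡ = m+[n∸m]≡n (≤-trans u<n n≤v)
    around : (∃[ i ] i < n × χ e i ≡ true) → ∃₂ λ x j → x < r × j < r + r × Gap e (n ∸ r + x) (suc (n ∸ r + x) + j)
    around (i , i<n , ei)
      with u , u<n , eu , below ← last-before (χ e) n i<n ei
      with v , n≤v , ev , above ← first-from (χ e) n i (trans (cong (χ e) (+-comm n i)) (trans (χ-periodic₁ e i) ei))
      with n <? u + r | v <? n + r
    ... | yes n<u+r | yes v<n+r = located u<n n≤v (gap eu ev (<-≤-trans u<n n≤v) (Empty-++ {n} {e} below above)) n<u+r v<n+r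
    ... | _         | no v≮n+r  = ⊥-elim (star (n , ≤-refl , m<m+n n (s≤s z≤n) , Empty-⊆ {n} {e} ≤-refl (≮⇒≥ v≮n+r) above))
    ... | no n≮u+r  | _         = ⊥-elim (star
          (suc (n ∸ r) , s≤s (m∸n<n) , ≤-reflexive (cong suc (sym (m∸n+n≡m r≤n))) , λ y lo hi → upto y lo hi))
      where
      m∸n<n : suc (n ∸ r) ≤ n
      m∸n<n = s≤s (m∸n≤m n' (suc q))
      u≤n∸r : u ≤ n ∸ r
      u≤n∸r = m+n≤o⇒m≤o∸n u (≮⇒≥ n≮u+r)
      upto : ∀ y → suc (n ∸ r) ≤ y → y < suc (n ∸ r) + r → χ e y ≡ false
      -- The arc ends at `n`, where `e0` applies; its other points lie between `u` and `n`.
      upto y lo hi with y ≟ n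
      ... | yes refl = e0
      ... | no y≢n   = below y (≤-trans (s≤s u≤n∸r) lo)
            (≤∧≢⇒< (≤-pred (≤-trans hi (≤-reflexive (cong suc (m∸n+n≡m r≤n))))) y≢n)

  -- A member avoiding 0 has one of at most `r * (r + r)` gaps around 0, and each of these occurs in
  -- at most `n' C q` sets of size `r`.
  star-≤ : length (starCGH {n} r n) ≤ n' C (1 + q) + r * (r + r) * (n' C q)
  star-≤ = begin
    length (starCGH {n} r n)
      ≡⟨ length-∑ˢ (starCGH-unique {n} r n) ⟩
    ∑ˢ n (λ e → ⟦ star? e ⟧)
      ≤⟨ ∑ˢ-mono n above ⟩
    ∑ˢ n (λ e → through-0 e + ∑ r (λ x → ∑ (r + r) (around-0 e x)))
      ≡⟨ trans (∑ˢ-+ n through-0 (λ e → ∑ r (λ x → ∑ (r + r) (around-0 e x)))) (cong₂ _+_ count-through-0 exchange-sums) ⟩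
    n' C (1 + q) + ∑ r (λ x → ∑ (r + r) (λ j → ∑ˢ n (λ e → around-0 e x j)))
      ≤⟨ +-monoʳ-≤ (n' C (1 + q)) (∑-mono r λ x _ → ∑-mono (r + r) {g = λ _ → n' C q} λ j j<2r → ≤-trans
           (≤-reflexive (GapPattern.count (n ∸ r + x) j (≤-trans (s≤s j<2r) wide) q)) (C-mono q (m∸n≤m n' (suc j)))) ⟩
    n' C (1 + q) + ∑ r (λ x → ∑ (r + r) (λ j → n' C q))
      ≡⟨ cong (n' C (1 + q) +_) (trans (∑-cong r λ _ _ → ∑-const (r + r) (n' C q))
            (trans (∑-const r ((r + r) * (n' C q))) (sym (*-assoc r (r + r) (n' C q))))) ⟩
    n' C (1 + q) + r * (r + r) * (n' C q) ∎
    where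
    open ≤-Reasoning
    exchange-sums : ∑ˢ n (λ e → ∑ r (λ x → ∑ (r + r) (around-0 e x))) ≡ ∑ r
          (λ x → ∑ (r + r) (λ j → ∑ˢ n (λ e → around-0 e x j)))
    exchange-sums = trans (∑ˢ-∑ n r (λ e x → ∑ (r + r) (around-0 e x)))
          (∑-cong r λ x _ → ∑ˢ-∑ n (r + r) (λ e → around-0 e x))
    witness : ∀ {e} → ∣ e ∣ ≡ r → (∃₂ λ x j → x < r × j < r + r × Gap e (n ∸ r + x) (suc (n ∸ r + x) + j)) →
              1 ≤ ∑ r (λ x → ∑ (r + r) (around-0 e x))
    witness {e} ∣e∣≡r (x , j , x<r , j<2r , g) = ≤-trans
      (≤-reflexive (sym (cong₂ _*_ (⟦⟧-yes (∣ e ∣ ≟ r) ∣e∣≡r) (⟦⟧-yes (Gap? e (n ∸ r + x) (suc (n ∸ r + x) + j)) g))))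
      (≤-trans (∑-term (around-0 e x) j<2r) (∑-term (λ x → ∑ (r + r) (around-0 e x)) x<r))
    above : ∀ e → ⟦ star? e ⟧ ≤ through-0 e + ∑ r (λ x → ∑ (r + r) (around-0 e x))
    above e with star? e
    ... | no _   = z≤n
    ... | yes e∈ with ∣e∣≡r , star ← ∈-starCGH⁻ e∈ with χ e n in e0
    ...   | true  = ≤-trans (≤-reflexive (sym (cong₂ _*_ (⟦⟧-yes (∣ e ∣ ≟ r) ∣e∣≡r) (cong 𝟙 (χ⇒fits-0 e e0)))))
          (m≤m+n (through-0 e) _)
    ...   | false = ≤-trans (witness {e} ∣e∣≡r (short-gap {e} ∣e∣≡r star e0)) (m≤n+m _ (through-0 e))

-- Minimality of the star and asymptotics

module _ {n : ℕ} .{{_ : NonZero n}} where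

  -- Stated for any list with the members of the star, to cover both `starCGH` and `H3`.
  star-isSat : ∀ {q} {S : CGH n} → (2 + q) + (2 + q) ≤ n → Unique S → (∀ {e} → e ∈ S → ∣ e ∣ ≡ 2 + q × Star (2 + q) n e) →
               (∀ {e} → ∣ e ∣ ≡ 2 + q → Star (2 + q) n e → e ∈ S) → IsSat (2 + q) (M1 (2 + q)) n (length S)
  star-isSat {q} {S} 2r≤n uniq ∈⇒ ⇒∈ =
    (S , maxNonSep⇒saturated (s≤s z≤n) satS , refl) ,
    λ H satH → Comparison.star-smallest (saturated⇒maxNonSep (s≤s z≤n) satH) satS 2r≤n large
    where
    r≤n : 2 + q ≤ n
    r≤n = ≤-trans (m≤m+n (2 + q) (2 + q)) 2r≤n
    satS : MaxNonSep (2 + q) S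
    satS = Stars.star-maxNonSep (s≤s z≤n) r≤n ≤-refl uniq ∈⇒ ⇒∈
    large : ∀ {j} → 2 + q ≤ j → j ≤ n → j ≤ full-count S j
    large = Stars.star-full-count (s≤s z≤n) r≤n ≤-refl uniq ∈⇒ ⇒∈

-- In the application `X` is C(n - 1, r - 1), `Y` is C(n - 1, r - 2) and `Y + X` is C(n, r - 1). For
-- `n` at least `k * K * suc q` the error `K * Y` is at most a `k`-th part of `Y + X`.
asymptotic-bounds : ∀ {k K s X Y q n} → 1 ≤ k → 1 ≤ K → X ≤ s → s ≤ X + K * Y → suc q * (Y + X) ≡ n * Y → k * K * suc q ≤ n →
                    k * s ≤ (k + 1) * (Y + X) × k * (Y + X) ≤ k * s + (Y + X)
asymptotic-bounds {k} {K} {s} {X} {Y} {q} {n} 1≤k 1≤K X≤s s≤ absorb large =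
  (begin
    k * s                          ≤⟨ *-monoʳ-≤ k s≤ ⟩
    k * (X + K * Y)                ≡⟨ expand k X K Y ⟩
    k * X + k * K * Y              ≤⟨ +-mono-≤ (*-monoʳ-≤ k (m≤n+m X Y)) small ⟩
    k * (Y + X) + (Y + X)          ≡⟨ collect k (Y + X) ⟩
    (k + 1) * (Y + X)              ∎) ,
  (begin
    k * (Y + X)                    ≡⟨ trans (*-distribˡ-+ k Y X) (+-comm (k * Y) (k * X)) ⟩
    k * X + k * Y                  ≤⟨ +-mono-≤ (*-monoʳ-≤ k X≤s) (≤-trans (*-monoˡ-≤ Y k≤kK) small) ⟩
    k * s + (Y + X)                ∎)
  where
  open ≤-Reasoning
  expand : ∀ k X K Y → k * (X + K * Y) ≡ k * X + k * K * Y
  expand k X K Y = solve (k ∷ X ∷ K ∷ Y ∷ [])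
  collect : ∀ k Z → k * Z + Z ≡ (k + 1) * Z
  collect k Z = solve (k ∷ Z ∷ [])
  k≤kK : k ≤ k * K
  k≤kK = ≤-trans (≤-reflexive (sym (*-identityʳ k))) (*-monoʳ-≤ k 1≤K)
  small : k * K * Y ≤ Y + X
  small = *-cancelˡ-≤ (suc q) (begin
    suc q * (k * K * Y)            ≡⟨ sym (*-assoc (suc q) (k * K) Y) ⟩
    suc q * (k * K) * Y            ≡⟨ cong (_* Y) (*-comm (suc q) (k * K)) ⟩
    k * K * suc q * Y              ≤⟨ *-monoˡ-≤ Y large ⟩
    n * Y                          ≡⟨ sym absorb ⟩
    suc q * (Y + X)                ∎)

-- Asymptotic equality cleared of fractions: for each `k`, from some `N` on, `s` differs from the
-- binomial by at most a `k`-th part of it.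
sat-asymptotics : ∀ r → 2 ≤ r → ∀ k → 1 ≤ k → ∃ λ N → ∀ n → N ≤ n →
  ∃ λ s → IsSat r (M1 r) n s × k * s ≤ (k + 1) * (n C (r ∸ 1)) × k * (n C (r ∸ 1)) ≤ k * s + n C (r ∸ 1)
sat-asymptotics (suc zero) (s≤s ())
-- The first summand of the threshold serves `StarSize`, the second `asymptotic-bounds`.
sat-asymptotics (suc (suc q)) _ k 1≤k = suc (r + r) + k * K * suc q , λ { zero () ; (suc n') N≤n →
  let wide = ≤-trans (m≤m+n (suc (r + r)) _) N≤n
      s = length (starCGH {suc n'} r (suc n'))
      pascal = nCk+nC[k+1]≡[n+1]C[k+1] n' q
  in s , star-isSat {suc n'} {q} (≤-trans (n≤1+n (r + r)) wide) (starCGH-unique {suc n'} r (suc n')) ∈-starCGH⁻ ∈-starCGH⁺ ,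
     subst (λ z → k * s ≤ (k + 1) * z × k * z ≤ k * s + z) pascal
       (asymptotic-bounds {k} {K} {s} {n' C suc q} {n' C q} {q} {suc n'} 1≤k (s≤s z≤n)
         (StarSize.star-≥ n' q wide) (StarSize.star-≤ n' q wide)
         (trans (cong (suc q *_) pascal) (absorption n' q))
         (≤-trans (m≤n+m _ (suc (r + r))) N≤n)) }
  where
  r K : ℕ
  r = 2 + q
  K = r * (r + r)

H3-isSat : ∀ n → 6 ≤ n → IsSat 3 (M1 3) n ((n ∸ 1) C 2 + 3 * n ∸ 11)
H3-isSat n 6≤n with m , refl ← m≤n⇒∃[o]m+o≡n 6≤n =
  subst (IsSat 3 (M1 3) n) (T.length-H3 m) (star-isSat {6 + m} {1} (m≤m+n 6 m) (T.H3-unique m) (T.∈-H3⁻ m) (T.∈-H3⁺ m))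
  where module T = TripleStar

H3-saturated : ∀ m → MaxNonSep 3 (H3 (6 + m))
H3-saturated m = Stars.star-maxNonSep (s≤s z≤n) (m≤m+n 3 (3 + m)) ≤-refl (T.H3-unique m) (T.∈-H3⁻ m) (T.∈-H3⁺ m)
  where module T = TripleStar

H3-unique-extremal : ∀ m (H : CGH (7 + m)) → MaxNonSep 3 H → length H ≡ length (H3 (7 + m)) → Iso H (H3 (7 + m))
H3-unique-extremal m H satH len = iso (full-count-3⇒star satH (m≤m+n 7 m) fc≡3)
  where
  module T = TripleStar (suc m)
  n : ℕ
  n = 7 + m
  large : ∀ {j} → 3 ≤ j → j ≤ n → j ≤ full-count (H3 n) j
  large = Stars.star-full-count (s≤s z≤n) (m≤m+n 3 (4 + m)) ≤-refl T.H3-unique T.∈-H3⁻ T.∈-H3⁺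
  -- For triples w(n - 3) = 1 and w(3) = n - 5, which is at least 2 because n > 6.
  strict : weight n 1 (4 + m) < weight n 1 3
  strict = subst₂ _<_
    (sym (trans (weight-< {n} {4 + m} 1 (n≤1+n (5 + m))) (trans (nC1≡n _) (m+n∸n≡m 1 (6 + m)))))
    (sym (trans (weight-< {n} {3} 1 (m≤m+n 4 (2 + m))) (nC1≡n (2 + m))))
    (s≤s (s≤s z≤n))
  6≤n : 3 + 3 ≤ n
  6≤n = m≤m+n 6 (1 + m)
  module Cmp = Comparison {n} {1} satH (H3-saturated (suc m)) 6≤n large
  fc≡3 : full-count H 3 ≡ 3
  fc≡3 = ≤-antisym (FullCounts.full-count-≤ satH (s≤s (s≤s z≤n)) {3} 6≤n)
    (≤-trans (large ≤-refl (m≤m+n 3 (4 + m))) (≤-reflexive (sym (Cmp.smallest⇒full-count len {3} 6≤n strict))))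
  iso : (∃[ q ] n ≤ q × (∀ {e} → e ∈ H → Star 3 q e) × (∀ {e} → ∣ e ∣ ≡ 3 → Star 3 q e → e ∈ H)) → Iso H (H3 n)
  iso (q , n≤q , H⇒star , star⇒H) = stars-isomorphic {n} {3} {q} (m≤m+n 3 (4 + m)) n≤q
    (λ e∈H → MaxNonSep.size satH e∈H , H⇒star e∈H) star⇒H T.∈-H3⁻ T.∈-H3⁺

theorem1p1 : (∀ (r : ℕ) → 2 ≤ r → ∀ (k : ℕ) → 1 ≤ k → ∃ λ (N : ℕ) → ∀ (n : ℕ) → N ≤ n →
    ∃ λ (s : ℕ) → IsSat r (M1 r) n s ×
    k * s ≤ (k + 1) * (n C (r ∸ 1)) × k * (n C (r ∸ 1)) ≤ k * s + n C (r ∸ 1))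
    × (∀ (n : ℕ) → 4 ≤ n → ∀ (H : CGH n) → Saturated 2 (M1 2) H → length H ≡ n)
    × (∀ (n : ℕ) → 6 ≤ n → IsSat 3 (M1 3) n ((n ∸ 1) C 2 + 3 * n ∸ 11))
    × (∀ (n : ℕ) → 6 < n →
    Saturated 3 (M1 3) (H3 n) × length (H3 n) ≡ (n ∸ 1) C 2 + 3 * n ∸ 11 ×
    (∀ (H : CGH n) → Saturated 3 (M1 3) H → length H ≡ (n ∸ 1) C 2 + 3 * n ∸ 11 →
    Iso H (H3 n)))
theorem1p1 = sat-asymptotics , graphs , H3-isSat , triples
  where
  graphs : ∀ n → 4 ≤ n → ∀ (H : CGH n) → Saturated 2 (M1 2) H → length H ≡ n
  graphs (suc n) 4≤n H sat = graph-edge-count 4≤n (saturated⇒maxNonSep (s≤s z≤n) sat)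
  triples : ∀ n → 6 < n → Saturated 3 (M1 3) (H3 n) × length (H3 n) ≡ (n ∸ 1) C 2 + 3 * n ∸ 11 ×
    (∀ (H : CGH n) → Saturated 3 (M1 3) H → length H ≡ (n ∸ 1) C 2 + 3 * n ∸ 11 → Iso H (H3 n))
  triples n 6<n with m , refl ← m≤n⇒∃[o]m+o≡n 6<n =
    maxNonSep⇒saturated (s≤s z≤n) (H3-saturated (suc m)) , TripleStar.length-H3 (suc m) ,
    λ H sat len → H3-unique-extremal m H (saturated⇒maxNonSep (s≤s z≤n) sat) (trans len (sym (TripleStar.length-H3 (suc m))))
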